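{- There exist a finite family $\mathcal{F}$ of non-planar $2$-connected subcubic graphs and a function $r$ (assigning a real number to each graph) such that the following holds: if $G$ is a connected subcubic graph that has no two vertex-disjoint cycles each of length less than five and that does not contain an induced subdivision of any member of $\mathcal{F}$, then $$\phi(G)\leq \frac{2|E(G)|-|V(G)|+2}{7}+r(G),$$ and $r(G)$ satisfies: (1) $r(G)\leq \frac{4}{7}$; (2) if $G\neq K_4$, then $r(G)\leq\frac{3}{7}$; and if $r(G)=\frac{3}{7}$, then $G$ contains a triangle; (3) if $r(G)>0$ and $G$ is $2$-connected, then for every $e\in E(G)$, $\phi(G-e)\leq \frac{2|E(G)|-|V(G)|-5}{7}+r(G)$; (4) if $G$ is planar and has girth at least five, then $r(G)=0$.
   Context: All graphs are finite and simple. A feedback vertex set of $G$ is a set $S\subseteq V(G)$ such that $G-S$ is a forest; $\phi(G)$ is its minimum size. A graph is subcubic if every vertex has degree at most three. The girth is the length of a shortest cycle. $G-e$ denotes $G$ with the edge $e$ deleted. A graph $G$ contains an induced subdivision of a graph $H$ if $G$ has an induced subgraph that can be obtained from $H$ by repeatedly subdividing edges. A graph is $2$-connected if it has at least three vertices and remains connected after deleting any single vertex. -}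

module Defs where

open import Data.Nat as ℕ using (ℕ; zero; suc; _+_; _*_; _≤_; _<_; _≤ᵇ_; _≡ᵇ_)
open import Data.Fin as Fin using (Fin; toℕ) renaming (zero to fz; suc to fs)
open import Data.Fin.Subset as Sub using (Subset)
open import Data.Bool using (Bool; true; false; _∧_; _∨_; not; if_then_else_; T)
open import Data.Bool.Properties using (∧-comm; ∨-comm)
open import Data.List using (List; []; _∷_; _++_; length)
open import Data.List.Relation.Unary.Any using (Any)
open import Data.List.Relation.Unary.Unique.Propositional using (Unique)
open import Data.List.Membership.Propositional using (_∈_; _∉_)
open import Data.Product using (Σ; ∃; _×_; _,_; proj₁; proj₂)
open import Data.Unit using (⊤)
open import Data.Empty using (⊥; ⊥-elim)
open import Function using (_∘_)
open import Function.Bundles using (Bijection; _⤖_)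
open import Function.Definitions using (Injective)
open import Relation.Nullary using (¬_; yes; no)
open import Relation.Nullary.Decidable using (⌊_⌋)
open import Relation.Binary.PropositionalEquality using (_≡_; _≢_; refl; sym; cong₂)

record Graph : Set where
  constructor mkGraph
  field
    n       : ℕ
    adj     : Fin n → Fin n → Bool
    adj-sym : ∀ u v → adj u v ≡ adj v u
    adj-irr : ∀ v → adj v v ≡ false
open Graph public

V : Graph → Set
V G = Fin (n G)

eqb : ∀ {m} → Fin m → Fin m → Bool
eqb x y = ⌊ x Fin.≟ y ⌋

eqb-sym : ∀ {m} (x y : Fin m) → eqb x y ≡ eqb y x
eqb-sym x y with x Fin.≟ y | y Fin.≟ x
... | yes _ | yes _ = refl
... | no _  | no _  = refl
... | yes p | no q  = ⊥-elim (q (sym p))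
... | no p  | yes q = ⊥-elim (p (sym q))

eqb-refl : ∀ {m} (x : Fin m) → eqb x x ≡ true
eqb-refl x with x Fin.≟ x
... | yes _ = refl
... | no p  = ⊥-elim (p refl)

count : ∀ {m} → (Fin m → Bool) → ℕ
count {zero}  p = 0
count {suc m} p = (if p fz then 1 else 0) + count (p ∘ fs)

sumFin : ∀ {m} → (Fin m → ℕ) → ℕ
sumFin {zero}  f = 0
sumFin {suc m} f = f fz + sumFin (f ∘ fs)

anyFin : ∀ {m} → (Fin m → Bool) → Bool
anyFin {zero}  p = false
anyFin {suc m} p = p fz ∨ anyFin (p ∘ fs)

allBelow : ℕ → (ℕ → Bool) → Bool
allBelow zero    p = true
allBelow (suc k) p = p k ∧ allBelow k p

iterate : ∀ {A : Set} → (A → A) → ℕ → A → A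
iterate f zero    x = x
iterate f (suc k) x = f (iterate f k x)

numEdges : Graph → ℕ
numEdges G = sumFin (λ u → count (λ v → adj G u v ∧ (suc (toℕ u) ≤ᵇ toℕ v)))

degree : (G : Graph) → V G → ℕ
degree G v = count (adj G v)

Subcubic : Graph → Set
Subcubic G = ∀ v → degree G v ≤ 3

data WalkIn (G : Graph) (P : V G → Set) : V G → V G → Set where
  here : ∀ {u} → P u → WalkIn G P u u
  step : ∀ {u w v} → P u → T (adj G u w) → WalkIn G P w v → WalkIn G P u v

Connected : Graph → Set
Connected G = (1 ≤ n G) × (∀ u v → WalkIn G (λ _ → ⊤) u v)

TwoConnected : Graph → Set
TwoConnected G = (3 ≤ n G) ×
  (∀ x u v → u ≢ x → v ≢ x → WalkIn G (λ w → w ≢ x) u v)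

Path : (G : Graph) → List (V G) → Set
Path G []            = ⊤
Path G (x ∷ [])      = ⊤
Path G (x ∷ y ∷ xs)  = T (adj G x y) × Path G (y ∷ xs)

-- a cycle x₀ x₁ … x_{k-1} (k ≥ 3, distinct vertices, closing edge x_{k-1}x₀);
-- its length is the length of the list
IsCycle : (G : Graph) → List (V G) → Set
IsCycle G []       = ⊥
IsCycle G (x ∷ xs) = (2 ≤ length xs) × Unique (x ∷ xs) × Path G (x ∷ xs ++ x ∷ [])

TwoDisjointShortCycles : Graph → Set
TwoDisjointShortCycles G =
  Σ (List (V G)) λ c₁ → Σ (List (V G)) λ c₂ →
    IsCycle G c₁ × IsCycle G c₂ × length c₁ < 5 × length c₂ < 5 ×
    (∀ x → x ∈ c₁ → x ∉ c₂)

HasTriangle : Graph → Set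
HasTriangle G = Σ (V G) λ a → Σ (V G) λ b → Σ (V G) λ c →
  T (adj G a b) × T (adj G b c) × T (adj G a c)

-- girth at least five (acyclic graphs have infinite girth)
GirthAtLeast5 : Graph → Set
GirthAtLeast5 G = ∀ c → IsCycle G c → 5 ≤ length c

-- G - S is a forest, i.e. every cycle of G meets S
-- (the cycles of G - S are exactly the cycles of G avoiding S)
IsFVS : (G : Graph) → Subset (n G) → Set
IsFVS G S = ∀ c → IsCycle G c → Any (λ x → x Sub.∈ S) c

IsPhi : Graph → ℕ → Set
IsPhi G k = (Σ (Subset (n G)) λ S → IsFVS G S × Sub.∣ S ∣ ≡ k) ×
            (∀ S → IsFVS G S → k ≤ Sub.∣ S ∣)

isEdge : ∀ {m} → Fin m → Fin m → Fin m → Fin m → Bool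
isEdge u v x y = (eqb x u ∧ eqb y v) ∨ (eqb x v ∧ eqb y u)

isEdge-sym : ∀ {m} (u v x y : Fin m) → isEdge u v x y ≡ isEdge u v y x
isEdge-sym u v x y
  rewrite ∨-comm (eqb x u ∧ eqb y v) (eqb x v ∧ eqb y u)
        | ∧-comm (eqb x v) (eqb y u) | ∧-comm (eqb x u) (eqb y v) = refl

deleteEdge : (G : Graph) → V G → V G → Graph
deleteEdge G u v = mkGraph (n G) a s i
  where
  a : V G → V G → Bool
  a x y = adj G x y ∧ not (isEdge u v x y)
  s : ∀ x y → a x y ≡ a y x
  s x y rewrite adj-sym G x y | isEdge-sym u v x y = refl
  i : ∀ x → a x x ≡ false
  i x rewrite adj-irr G x = refl

subdivide : (G : Graph) → V G → V G → Graph
subdivide G u v = mkGraph (suc (n G)) a s i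
  where
  a : Fin (suc (n G)) → Fin (suc (n G)) → Bool
  a fz     fz     = false
  a fz     (fs y) = eqb y u ∨ eqb y v
  a (fs x) fz     = eqb x u ∨ eqb x v
  a (fs x) (fs y) = adj G x y ∧ not (isEdge u v x y)
  s : ∀ x y → a x y ≡ a y x
  s fz     fz     = refl
  s fz     (fs y) = refl
  s (fs x) fz     = refl
  s (fs x) (fs y) rewrite adj-sym G x y | isEdge-sym u v x y = refl
  i : ∀ x → a x x ≡ false
  i fz     = refl
  i (fs x) rewrite adj-irr G x = refl

data IsSubdivisionOf (H : Graph) : Graph → Set where
  base : IsSubdivisionOf H H
  step : ∀ {K} u v → T (adj K u v) → IsSubdivisionOf H K →
         IsSubdivisionOf H (subdivide K u v)

HasInducedCopy : Graph → Graph → Set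
HasInducedCopy G K = Σ (V K → V G) λ f →
  Injective _≡_ _≡_ f × (∀ a b → adj K a b ≡ adj G (f a) (f b))

ContainsInducedSubdivision : Graph → Graph → Set
ContainsInducedSubdivision G H =
  Σ Graph λ K → IsSubdivisionOf H K × HasInducedCopy G K

Isomorphic : Graph → Graph → Set
Isomorphic G H = Σ (Fin (n G) ⤖ Fin (n H)) λ b →
  ∀ x y → adj G x y ≡ adj H (Bijection.to b x) (Bijection.to b y)

K4 : Graph
K4 = mkGraph 4 (λ x y → not (eqb x y)) s i
  where
  s : ∀ (x y : Fin 4) → not (eqb x y) ≡ not (eqb y x)
  s x y rewrite eqb-sym x y = refl
  i : ∀ (x : Fin 4) → not (eqb x x) ≡ false
  i x rewrite eqb-refl x = refl

-- ρ v is a cyclic permutation of the neighbourhood of v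
IsRotationSystem : (G : Graph) → (V G → V G → V G) → Set
IsRotationSystem G ρ = ∀ v u → T (adj G v u) →
  T (adj G v (ρ v u)) × (∀ w → T (adj G v w) → ∃ λ k → iterate (ρ v) k u ≡ w)

-- face-tracing permutation on darts (u , v): arrive at v from u,
-- leave along the successor of u in the rotation at v
faceStep : (G : Graph) → (V G → V G → V G) → V G × V G → V G × V G
faceStep G ρ (u , v) = (v , ρ v u)

dartKey : (G : Graph) → V G × V G → ℕ
dartKey G (u , v) = toℕ u * n G + toℕ v

-- the dart d is the least (w.r.t. dartKey) dart of its face orbit
-- (orbits have length ≤ number of darts ≤ n²)
minInFace : (G : Graph) → (V G → V G → V G) → V G × V G → Bool
minInFace G ρ d =
  allBelow (n G * n G) (λ k → dartKey G d ≤ᵇ dartKey G (iterate (faceStep G ρ) k d))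

numFaces : (G : Graph) → (V G → V G → V G) → ℕ
numFaces G ρ = sumFin (λ u → count (λ v → adj G u v ∧ minInFace G ρ (u , v)))

reachB : (G : Graph) → ℕ → V G → V G → Bool
reachB G zero    u v = eqb u v
reachB G (suc k) u v = reachB G k u v ∨ anyFin (λ w → adj G u w ∧ reachB G k w v)

numComponents : Graph → ℕ
numComponents G =
  count (λ v → not (anyFin (λ u → reachB G (n G) u v ∧ (suc (toℕ u) ≤ᵇ toℕ v))))

numIsolated : Graph → ℕ
numIsolated G = count (λ v → degree G v ≡ᵇ 0)

-- G is planar iff it has a rotation system of genus 0 on every component,
-- i.e. Euler's formula V - E + F = 2 holds componentwise (an isolated vertex
-- contributes one face but no darts):  |V| + F + #isolated = |E| + 2·#components
Planar : Graph → Set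
Planar G = Σ (V G → V G → V G) λ ρ → IsRotationSystem G ρ ×
  (n G + numFaces G ρ + numIsolated G ≡ numEdges G + 2 * numComponents G)

{-# OPTIONS --safe #-}

-- For a set X of vertices let e(X) be the number of edges inside X.  If m is a weighting with m(X) > e(X) for all
-- nonempty X, then the vertices of weight 1 induce a forest; if moreover all weights are odd, the other vertices form a
-- feedback vertex set of size at most (m(V) − |V|) / 2.  A min-max theorem in the style of Nebeský and of Frank, Jordán
-- and Szigeti gives the least m(V): it is the maximum, over the partitions of V, of the sum of the least integers g(X)
-- exceeding e(X) of the parity of |X|.  In a finest optimal partition every class is 2-edge-connected, so that
-- 14 φ(G) exceeds 2 (2 |E| − |V| + 2) by no more than the sum of the weights 3 e(X) − 5 |X| + 10 of those classes for
-- which it is positive and e(X) ≡ |X| mod 2.  Such classes have fewer than 20 vertices; one that has no cycle of length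
-- 3 or 4 is nonplanar by Euler's formula, and the family consists of these graphs.  Hence a class of positive weight
-- has a short cycle, there is at most one, and r is 1/14 times the excess.
module Submission where

open import Defs

-- The min-max theorem is proved for an arbitrary parity function `t`, since the induction changes
-- parities. If the finest optimal partition has one class, an edge uv is deleted and one unit is
-- added at v: the unit pays for the edge in every set that contains it, and the parity at v flips
-- to match. If there are several classes, they are charged separately, and the edges between them
-- must be paid for by the surplus over e(X) that each class receives. This surplus is 1, or 2 where
-- parity forces it, and the second unit has to be placed at a vertex that suits all sets
-- simultaneously; such a vertex is found by uncrossing tight sets. Both cases rest on a gap of 2:
-- splitting a class of a finest optimal partition strictly lowers the total demand, hence by at
-- least 2 because demands have a fixed parity. The same gap makes the classes 2-edge-connected. For
-- G - e the obstacle is that a forbidden graph may be induced in G - e but not in G. This can only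
-- happen in a class that contains both ends of e. That class is controlled by its degrees alone,
-- and again parity turns a strict decrease of the optimum into a decrease by 2, which lowers the
-- bound on φ by 1.

module FeedbackVertexSets where
  open import Data.Nat using (ℕ; zero; suc; _+_; _*_; _≤_; _<_; z≤n; s≤s; _∸_; _≤ᵇ_; _≡ᵇ_)
  open import Data.Nat.Tactic.RingSolver using (solve-∀)
  open import Data.Fin as Fin using (Fin; toℕ) renaming (zero to fz; suc to fs)
  open import Data.Bool using (Bool; true; false; _∧_; _∨_; not; if_then_else_; T)
  open import Data.List using (List; []; _∷_; _++_)
  open import Data.Product using (Σ; ∃; _×_; _,_; proj₁; proj₂)
  open import Data.Sum using (_⊎_; inj₁; inj₂; [_,_]′)
  open import Data.Empty using (⊥; ⊥-elim)
  open import Function using (_∘_; case_of_; id)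
  open import Relation.Nullary using (¬_; yes; no; Dec)
  open import Data.List.Membership.Propositional using (_∈_)
  open import Data.List.Membership.Propositional.Properties using (∈-map⁺; ∈-allFin; ∈-cartesianProductWith⁺; ∈-filter⁺; ∈-∃++; ∈-++⁺ˡ; ∈-++⁺ʳ; ∈-concat⁺′; ∈-upTo⁺; ∈-tabulate⁺)
  open import Relation.Nullary.Decidable using (_→-dec_; _×-dec_; ⌊_⌋; ¬?; _⊎-dec_; toWitness)
  open import Data.Maybe using (Maybe; just; nothing)
  open import Data.Fin.Subset.Properties using (anySubset?)
  open import Data.List.Relation.Unary.Any using (Any; here; there)
  open import Data.List.Relation.Unary.All using (All; []; _∷_)
  open import Data.List.Relation.Unary.AllPairs using ([]; _∷_)
  open import Data.List.Relation.Unary.Unique.Propositional using (Unique)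
  open import Relation.Binary.Definitions using (tri<; tri≈; tri>)
  open import Function.Definitions using (Injective)
  open import Function.Bundles using (_⤖_)
  open import Function.Construct.Identity using (⤖-id)
  open import Data.Nat.Properties
  open import Relation.Binary.PropositionalEquality
  import Data.Vec as Vec
  import Data.Vec.Properties as Vec
  import Data.List.Extrema.Nat as Extrema
  import Data.List as List
  import Data.List.Relation.Unary.All as All
  import Data.List.Relation.Unary.All.Properties as All
  import Data.List.Relation.Unary.Any as Any
  import Data.Fin.Properties as Fin
  import Data.Bool.Properties as Bool
  import Data.Fin.Subset as Sub
  import Data.Fin.Subset.Properties as Sub
  import Data.List.Properties as List
  import Data.Sum as Sum

  -- Finite sums

  VSet : ℕ → Set
  VSet N = Fin N → Bool

  χ : Bool → ℕ
  χ b = if b then 1 else 0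

  infix 4 _≐_
  -- Vertex sets are functions and extensionality is not assumed, so sets are compared pointwise and
  -- each quantity comes with its own congruence lemma.
  _≐_ : ∀ {N} → VSet N → VSet N → Set
  X ≐ Y = ∀ v → X v ≡ Y v

  -- A hypothesis L ≤ R yields a goal x ≤ y whenever x + R + s and y + L agree as semiring terms.
  by-≤ : ∀ {L R x y} s → L ≤ R → x + R + s ≡ y + L → x ≤ y
  by-≤ {L} {R} {x} {y} s h eq = +-cancelʳ-≤ R x y (begin
      x + R      ≤⟨ m≤m+n _ s ⟩
      x + R + s  ≡⟨ eq ⟩
      y + L      ≤⟨ +-monoʳ-≤ y h ⟩
      y + R      ∎)
    where open ≤-Reasoning

  T⇒≡ : ∀ {b} → T b → b ≡ true
  T⇒≡ {true} _ = refl

  ≡⇒T : ∀ {b} → b ≡ true → T b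
  ≡⇒T refl = _

  ∧-true : ∀ {a b} → a ∧ b ≡ true → a ≡ true × b ≡ true
  ∧-true {true} {true} _ = refl , refl

  ∧-intro : ∀ {a b} → a ≡ true → b ≡ true → a ∧ b ≡ true
  ∧-intro refl refl = refl

  true≢false : ∀ {b} {A : Set} → b ≡ true → b ≡ false → A
  true≢false refl ()

  ¬true⇒false : ∀ {b} → ¬ (b ≡ true) → b ≡ false
  ¬true⇒false {true}  h = ⊥-elim (h refl)
  ¬true⇒false {false} h = refl

  ¬false⇒true : ∀ {b} → ¬ (b ≡ false) → b ≡ true
  ¬false⇒true {true}  h = refl
  ¬false⇒true {false} h = ⊥-elim (h refl)

  true-or-false : ∀ b → b ≡ true ⊎ b ≡ false
  true-or-false true  = inj₁ refl
  true-or-false false = inj₂ refl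

  not-true : ∀ {b} → not b ≡ true → b ≡ false
  not-true {false} _ = refl

  eqb⇒≡ : ∀ {N} {x y : Fin N} → eqb x y ≡ true → x ≡ y
  eqb⇒≡ {x = x} {y} h with x Fin.≟ y
  ... | yes p = p

  ≡⇒eqb : ∀ {N} {x y : Fin N} → x ≡ y → eqb x y ≡ true
  ≡⇒eqb {x = x} refl = eqb-refl x

  ≢⇒eqb : ∀ {N} {x y : Fin N} → x ≢ y → eqb x y ≡ false
  ≢⇒eqb h = ¬true⇒false (h ∘ eqb⇒≡)

  χ≤1 : ∀ b → χ b ≤ 1
  χ≤1 true  = ≤-refl
  χ≤1 false = z≤n

  χ-mono : ∀ {a b} → (a ≡ true → b ≡ true) → χ a ≤ χ b
  χ-mono {true}  {true}  _ = ≤-refl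
  χ-mono {true}  {false} h = case h refl of λ ()
  χ-mono {false}         _ = z≤n

  χ-∧ : ∀ a b → χ (a ∧ b) ≡ χ a * χ b
  χ-∧ true  b = sym (+-identityʳ (χ b))
  χ-∧ false b = refl

  opaque
    -- Opaque, so that sums never unfold in goals and are compared by their summands.
    ∑ : ∀ {k} → (Fin k → ℕ) → ℕ
    ∑ = sumFin

    ∑-def : ∀ {k} (f : Fin k → ℕ) → ∑ f ≡ sumFin f
    ∑-def f = refl

    sum-cong : ∀ {k} {f g : Fin k → ℕ} → (∀ i → f i ≡ g i) → ∑ f ≡ ∑ g
    sum-cong {zero}  h = refl
    sum-cong {suc k} h = cong₂ _+_ (h fz) (sum-cong (h ∘ fs))

    sum-mono : ∀ {k} {f g : Fin k → ℕ} → (∀ i → f i ≤ g i) → ∑ f ≤ ∑ g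
    sum-mono {zero}  h = z≤n
    sum-mono {suc k} h = +-mono-≤ (h fz) (sum-mono (h ∘ fs))

    sum-+ : ∀ {k} (f g : Fin k → ℕ) → ∑ (λ i → f i + g i) ≡ ∑ f + ∑ g
    sum-+ {zero}  f g = refl
    sum-+ {suc k} f g = trans (cong (f fz + g fz +_) (sum-+ (f ∘ fs) (g ∘ fs)))
                              (eq (f fz) (g fz) _ _)
      where eq : ∀ a b c d → a + b + (c + d) ≡ a + c + (b + d)
            eq = solve-∀

    sum-* : ∀ {k} c (f : Fin k → ℕ) → ∑ (λ i → c * f i) ≡ c * ∑ f
    sum-* {zero}  c f = sym (*-zeroʳ c)
    sum-* {suc k} c f = trans (cong (c * f fz +_) (sum-* c (f ∘ fs)))
                              (sym (*-distribˡ-+ c (f fz) _))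

    sum-0 : ∀ {k} {f : Fin k → ℕ} → (∀ i → f i ≡ 0) → ∑ f ≡ 0
    sum-0 {zero}  h = refl
    sum-0 {suc k} h = cong₂ _+_ (h fz) (sum-0 (h ∘ fs))

    sum-swap : ∀ {k l} (f : Fin k → Fin l → ℕ) →
               ∑ (λ i → ∑ (f i)) ≡ ∑ (λ j → ∑ (λ i → f i j))
    sum-swap {zero} {l} f = sym (sum-0 {l} λ _ → refl)
    sum-swap {suc k} f = trans (cong (∑ (f fz) +_) (sum-swap (f ∘ fs)))
                               (sym (sum-+ (f fz) _))

    term≤sum : ∀ {k} (f : Fin k → ℕ) i → f i ≤ ∑ f
    term≤sum f fz     = m≤m+n _ _
    term≤sum f (fs i) = ≤-trans (term≤sum (f ∘ fs) i) (m≤n+m _ (f fz))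

    sum-single : ∀ {k} (f : Fin k → ℕ) i → (∀ j → j ≢ i → f j ≡ 0) → ∑ f ≡ f i
    sum-single f fz     h = trans (cong (f fz +_) (sum-0 λ j → h (fs j) λ ())) (+-identityʳ _)
    sum-single f (fs i) h = cong₂ _+_ (h fz λ ())
      (sum-single (f ∘ fs) i λ j j≢i → h (fs j) λ { refl → j≢i refl })

    count≡sum : ∀ {k} (X : VSet k) → count X ≡ ∑ (χ ∘ X)
    count≡sum {zero}  X = refl
    count≡sum {suc k} X = cong (χ (X fz) +_) (count≡sum (X ∘ fs))

    sum-const : ∀ {k} c → ∑ {k} (λ _ → c) ≡ k * c
    sum-const {zero}  c = refl
    sum-const {suc k} c = cong (c +_) (sum-const {k} c)

  sum-pick : ∀ {k} (f : Fin k → ℕ) j → ∑ (λ i → χ (eqb j i) * f i) ≡ f j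
  sum-pick f j = trans (sum-single _ j λ i i≢j → cong (λ b → χ b * f i) (≢⇒eqb (i≢j ∘ sym)))
    (trans (cong (λ b → χ b * f j) (eqb-refl j)) (+-identityʳ _))

  sum-pick₁ : ∀ {k} (j : Fin k) → ∑ (λ i → χ (eqb j i)) ≡ 1
  sum-pick₁ j = trans (sum-cong λ i → sym (*-identityʳ _)) (sum-pick (λ _ → 1) j)

  any-intro : ∀ {k} (X : VSet k) i → X i ≡ true → anyFin X ≡ true
  any-intro X fz     h rewrite h = refl
  any-intro X (fs i) h with X fz
  ... | true  = refl
  ... | false = any-intro (X ∘ fs) i h

  any-elim : ∀ {k} (X : VSet k) → anyFin X ≡ true → ∃ λ i → X i ≡ true
  any-elim {suc k} X h with X fz in eq
  ... | true  = fz , eq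
  ... | false with any-elim (X ∘ fs) h
  ...   | i , q = fs i , q

  any-none : ∀ {k} (X : VSet k) → anyFin X ≡ false → ∀ i → X i ≡ false
  any-none X h i = ¬true⇒false λ q → true≢false (any-intro X i q) h

  any-false : ∀ {k} (X : VSet k) → (∀ i → X i ≡ false) → anyFin X ≡ false
  any-false X h = ¬true⇒false λ q → let i , p = any-elim X q in true≢false p (h i)

  any-cong : ∀ {k} {X Y : VSet k} → X ≐ Y → anyFin X ≡ anyFin Y
  any-cong {zero}  h = refl
  any-cong {suc k} h = cong₂ _∨_ (h fz) (any-cong (h ∘ fs))

  search : ∀ {k} (X : VSet k) → (∃ λ i → X i ≡ true) ⊎ (∀ i → X i ≡ false)
  search X with anyFin X in eq
  ... | true  = inj₁ (any-elim X eq)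
  ... | false = inj₂ (any-none X eq)

  σ : ∀ {N} → (Fin N → ℕ) → VSet N → ℕ
  σ m X = ∑ λ v → χ (X v) * m v

  Edges : ℕ → Set
  Edges N = List (Fin N × Fin N)

  e : ∀ {N} → Edges N → VSet N → ℕ
  e []            X = 0
  e ((u , v) ∷ E) X = χ (X u ∧ X v) + e E X

  crossing : ∀ {N} → Edges N → (Fin N → Fin N) → VSet N → ℕ
  crossing []            p X = 0
  crossing ((u , v) ∷ E) p X = χ ((X u ∧ X v) ∧ not (eqb (p u) (p v))) + crossing E p X

  σ-cong : ∀ {N} (m : Fin N → ℕ) {X Y : VSet N} → X ≐ Y → σ m X ≡ σ m Y
  σ-cong m h = sum-cong λ v → cong (λ b → χ b * m v) (h v)

  e-cong : ∀ {N} (E : Edges N) {X Y : VSet N} → X ≐ Y → e E X ≡ e E Y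
  e-cong []            h = refl
  e-cong ((u , v) ∷ E) h = cong₂ _+_ (cong χ (cong₂ _∧_ (h u) (h v))) (e-cong E h)

  e-empty : ∀ {N} (E : Edges N) {X : VSet N} → (∀ v → X v ≡ false) → e E X ≡ 0
  e-empty []            h = refl
  e-empty ((u , v) ∷ E) h rewrite h u = e-empty E h

  crossing-cong : ∀ {N} (E : Edges N) p {X Y : VSet N} → X ≐ Y → crossing E p X ≡ crossing E p Y
  crossing-cong []            p h = refl
  crossing-cong ((u , v) ∷ E) p h =
    cong₂ _+_ (cong (λ b → χ (b ∧ _)) (cong₂ _∧_ (h u) (h v))) (crossing-cong E p h)

  crossing-mono : ∀ {N} (E : Edges N) p {X Y : VSet N} → (∀ v → X v ≡ true → Y v ≡ true) →
                  crossing E p X ≤ crossing E p Y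
  crossing-mono []            p h = z≤n
  crossing-mono ((u , v) ∷ E) p h = +-mono-≤
    (χ-mono λ q → let q₁ , q₂ = ∧-true q ; x , y = ∧-true q₁ in ∧-intro (∧-intro (h u x) (h v y)) q₂)
    (crossing-mono E p h)

  _∩_ _∪_ : ∀ {N} → VSet N → VSet N → VSet N
  (X ∩ Y) v = X v ∧ Y v
  (X ∪ Y) v = X v ∨ Y v

  -- Checked edge by edge: an edge inside one of the sets lies inside the union, an edge inside both
  -- also lies inside the intersection, and an edge between the two differences counts on the right
  -- only.
  crossing-supermodular : ∀ {N} (E : Edges N) p (X Y : VSet N) →
    crossing E p X + crossing E p Y ≤ crossing E p (X ∪ Y) + crossing E p (X ∩ Y)
  crossing-supermodular []            p X Y = z≤n
  crossing-supermodular ((u , v) ∷ E) p X Y = begin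
      (a + A) + (b + B)  ≡⟨ eq a A b B ⟩
      (a + b) + (A + B)  ≤⟨ +-mono-≤ (edge (X u) (X v) (Y u) (Y v) (not (eqb (p u) (p v))))
                                     (crossing-supermodular E p X Y) ⟩
      (c + d) + (C + D)  ≡⟨ eq c d C D ⟩
      (c + C) + (d + D)  ∎
    where
    open ≤-Reasoning
    a = χ ((X u ∧ X v) ∧ not (eqb (p u) (p v))) ; A = crossing E p X
    b = χ ((Y u ∧ Y v) ∧ not (eqb (p u) (p v))) ; B = crossing E p Y
    c = χ (((X ∪ Y) u ∧ (X ∪ Y) v) ∧ not (eqb (p u) (p v))) ; C = crossing E p (X ∪ Y)
    d = χ (((X ∩ Y) u ∧ (X ∩ Y) v) ∧ not (eqb (p u) (p v))) ; D = crossing E p (X ∩ Y)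
    eq : ∀ a A b B → (a + A) + (b + B) ≡ (a + b) + (A + B)
    eq = solve-∀
    edge : ∀ x x' y y' z → χ ((x ∧ x') ∧ z) + χ ((y ∧ y') ∧ z) ≤
                           χ (((x ∨ y) ∧ (x' ∨ y')) ∧ z) + χ (((x ∧ y) ∧ (x' ∧ y')) ∧ z)
    edge true  true  true  true  true  = ≤-refl
    edge true  true  true  true  false = ≤-refl
    edge true  true  true  false true  = ≤-refl
    edge true  true  true  false false = ≤-refl
    edge true  true  false true  true  = ≤-refl
    edge true  true  false true  false = ≤-refl
    edge true  true  false false true  = ≤-refl
    edge true  true  false false false = ≤-refl
    edge true  false true  true  true  = ≤-refl
    edge true  false true  true  false = ≤-refl
    edge true  false true  false z     = z≤n
    edge true  false false y'    z     = z≤n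
    edge false x'    true  true  z with x' | z
    ... | true  | true  = ≤-refl
    ... | true  | false = ≤-refl
    ... | false | true  = ≤-refl
    ... | false | false = ≤-refl
    edge false x'    true  false z     = z≤n
    edge false x'    false y'    z     = z≤n

  cls : ∀ {N} → VSet N → (Fin N → Fin N) → Fin N → VSet N
  cls U p i v = U v ∧ eqb (p v) i

  cls-true : ∀ {N} (U : VSet N) p {i v} → cls U p i v ≡ true → U v ≡ true × p v ≡ i
  cls-true U p h = let a , b = ∧-true h in a , eqb⇒≡ b

  e-split : ∀ {N} (E : Edges N) p (X : VSet N) →
            e E X ≡ ∑ (λ i → e E (cls X p i)) + crossing E p X
  e-split []            p X = sym (trans (+-identityʳ _) (sum-0 λ _ → refl))
  e-split ((u , v) ∷ E) p X = begin
      χ (X u ∧ X v) + e E X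
        ≡⟨ cong₂ _+_ edge (e-split E p X) ⟩
      ∑ f + c + (∑ g + crossing E p X)
        ≡⟨ eq (∑ f) c (∑ g) (crossing E p X) ⟩
      ∑ f + ∑ g + (c + crossing E p X)
        ≡⟨ cong (_+ (c + crossing E p X)) (sym (sum-+ f g)) ⟩
      ∑ (λ i → f i + g i) + (c + crossing E p X) ∎
    where
    open ≡-Reasoning
    f = λ i → χ (cls X p i u ∧ cls X p i v)
    g = λ i → e E (cls X p i)
    c = χ ((X u ∧ X v) ∧ not (eqb (p u) (p v)))
    eq : ∀ a b c d → a + b + (c + d) ≡ a + c + (b + d)
    eq = solve-∀
    edge : χ (X u ∧ X v) ≡ ∑ f + χ ((X u ∧ X v) ∧ not (eqb (p u) (p v)))
    edge with X u | X v
    ... | false | x     = sym (trans (+-identityʳ _) (sum-0 λ _ → refl))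
    ... | true  | false = sym (trans (+-identityʳ _) (sum-0 λ i → lem (eqb (p u) i)))
      where lem : ∀ b → χ (b ∧ false) ≡ 0
            lem true  = refl
            lem false = refl
    ... | true  | true with p u Fin.≟ p v
    ...   | yes q = sym (trans (+-identityʳ _) (trans (sum-cong λ i →
                      cong χ (trans (cong (λ w → eqb (p u) i ∧ eqb w i) (sym q)) (Bool.∧-idem _))) (sum-pick₁ (p u))))
    ...   | no ¬q = sym (cong (_+ 1) (sum-0 λ i → cong χ (¬true⇒false λ h →
                      let a , b = ∧-true h in ¬q (trans (eqb⇒≡ a) (sym (eqb⇒≡ b))))))

  σ-split : ∀ {N} (m : Fin N → ℕ) p (X : VSet N) → σ m X ≡ ∑ (λ i → σ m (cls X p i))
  σ-split m p X = sym (trans (sum-swap _) (sum-cong λ v → begin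
      ∑ (λ i → χ (X v ∧ eqb (p v) i) * m v)
        ≡⟨ sum-cong (λ i → trans (cong (_* m v) (χ-∧ (X v) _)) (eq (χ (X v)) (χ (eqb (p v) i)) (m v))) ⟩
      ∑ (λ i → χ (eqb (p v) i) * (χ (X v) * m v))
        ≡⟨ sum-pick (λ _ → χ (X v) * m v) (p v) ⟩
      χ (X v) * m v ∎))
    where
    open ≡-Reasoning
    eq : ∀ a b c → a * b * c ≡ b * (a * c)
    eq = solve-∀

  -- Partitions and demands

  -- A partition of U is a labelling that sends each vertex to a representative of its class.
  Canonical : ∀ {N} → VSet N → (Fin N → Fin N) → Set
  Canonical U p = ∀ v → U v ≡ true → U (p v) ≡ true × p (p v) ≡ p v

  -- The sum runs over all vertices as possible labels. A label that is not in use names an empty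
  -- class, where a `SetFunction` vanishes.
  Φ : ∀ {N} → (VSet N → ℕ) → VSet N → (Fin N → Fin N) → ℕ
  Φ F U p = ∑ λ i → F (cls U p i)

  record SetFunction {N} (F : VSet N → ℕ) : Set where
    field
      ext  : ∀ {X Y} → X ≐ Y → F X ≡ F Y
      null : ∀ {X} → (∀ v → X v ≡ false) → F X ≡ 0
  open SetFunction

  canonical-id : ∀ {N} {U : VSet N} → Canonical U (λ v → v)
  canonical-id v Uv = Uv , refl

  module Merge {N} {U : VSet N} {p} (can : Canonical U p) (J : VSet N) {j₀}
               (Uj₀ : U j₀ ≡ true) (pj₀ : p j₀ ≡ j₀) (Jj₀ : J j₀ ≡ true) where
    merged : Fin N → Fin N
    merged v = if J (p v) then j₀ else p v

    merged-in : ∀ {v} → J (p v) ≡ true → merged v ≡ j₀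
    merged-in h = cong (λ b → if b then j₀ else _) h

    merged-out : ∀ {v} → J (p v) ≡ false → merged v ≡ p v
    merged-out h = cong (λ b → if b then j₀ else _) h

    merged-canonical : Canonical U merged
    merged-canonical v Uv with J (p v) in Jpv
    ... | true  = Uj₀ , merged-in (trans (cong J pj₀) Jj₀)
    ... | false = proj₁ (can v Uv) ,
                  trans (merged-out (trans (cong J (proj₂ (can v Uv))) Jpv)) (proj₂ (can v Uv))

    -- Written additively to avoid subtraction. The label `j₀` now names the union, the other labels
    -- in `J` become empty, and labels outside `J` keep their classes.
    Φ-merged : ∀ {F} → SetFunction F →
               Φ F U merged + ∑ (λ i → χ (J i) * F (cls U p i)) ≡ F (U ∩ (J ∘ p)) + Φ F U p
    Φ-merged {F} sf = begin
        Φ F U merged + ∑ (λ i → χ (J i) * F (cls U p i))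
          ≡⟨ sym (sum-+ (λ i → F (cls U merged i)) _) ⟩
        ∑ (λ i → F (cls U merged i) + χ (J i) * F (cls U p i))
          ≡⟨ sum-cong pointwise ⟩
        ∑ (λ i → χ (eqb j₀ i) * F (U ∩ (J ∘ p)) + F (cls U p i))
          ≡⟨ sum-+ (λ i → χ (eqb j₀ i) * F (U ∩ (J ∘ p))) _ ⟩
        ∑ (λ i → χ (eqb j₀ i) * F (U ∩ (J ∘ p))) + Φ F U p
          ≡⟨ cong (_+ Φ F U p) (sum-pick (λ _ → F (U ∩ (J ∘ p))) j₀) ⟩
        F (U ∩ (J ∘ p)) + Φ F U p ∎
      where
      open ≡-Reasoning
      outside : ∀ i → J i ≡ false → cls U merged i ≐ cls U p i
      outside i Ji v with J (p v) in Jpv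
      ... | false = refl
      ... | true  = cong (U v ∧_) (trans (≢⇒eqb λ { refl → true≢false Jj₀ Ji })
                                         (sym (≢⇒eqb λ { refl → true≢false Jpv Ji })))
      base-class : cls U merged j₀ ≐ U ∩ (J ∘ p)
      base-class v with J (p v) in Jpv
      ... | true  = cong (U v ∧_) (eqb-refl j₀)
      ... | false = cong (U v ∧_) (≢⇒eqb λ q → true≢false (trans (cong J q) Jj₀) Jpv)
      absorbed : ∀ i → J i ≡ true → j₀ ≢ i → ∀ v → cls U merged i v ≡ false
      absorbed i Ji j₀≢i v with J (p v) in Jpv
      ... | true  = trans (cong (U v ∧_) (≢⇒eqb j₀≢i)) (Bool.∧-zeroʳ (U v))
      ... | false = trans (cong (U v ∧_) (≢⇒eqb λ q → true≢false (trans (cong J q) Ji) Jpv)) (Bool.∧-zeroʳ (U v))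
      pointwise : ∀ i → F (cls U merged i) + χ (J i) * F (cls U p i) ≡
                        χ (eqb j₀ i) * F (U ∩ (J ∘ p)) + F (cls U p i)
      pointwise i with J i in Ji | j₀ Fin.≟ i
      ... | false | yes refl = true≢false Jj₀ Ji
      ... | false | no _     = trans (+-identityʳ _) (ext sf (outside i Ji))
      ... | true  | yes refl = cong₂ _+_ (trans (ext sf base-class) (sym (+-identityʳ _))) (+-identityʳ _)
      ... | true  | no j₀≢i  = cong₂ _+_ (null sf (absorbed i Ji j₀≢i)) (+-identityʳ _)

  module Refine {N} {U : VSet N} {p} (can : Canonical U p) (i₀ : Fin N)
                {q} (canq : Canonical (cls U p i₀) q) where
    refined : Fin N → Fin N
    refined v = if eqb (p v) i₀ then q v else p v

    refined-in : ∀ {v} → p v ≡ i₀ → refined v ≡ q v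
    refined-in h = cong (λ b → if b then q _ else p _) (≡⇒eqb h)

    refined-out : ∀ {v} → p v ≢ i₀ → refined v ≡ p v
    refined-out h = cong (λ b → if b then q _ else p _) (≢⇒eqb h)

    q-class : ∀ {v} → U v ≡ true → p v ≡ i₀ → (U (q v) ≡ true × p (q v) ≡ i₀) × q (q v) ≡ q v
    q-class Uv pv = let a , b = canq _ (∧-intro Uv (≡⇒eqb pv)) in cls-true U p a , b

    refined-canonical : Canonical U refined
    refined-canonical v Uv with p v Fin.≟ i₀
    ... | yes pv = let (a , b) , c = q-class Uv pv in a , trans (refined-in b) c
    ... | no ¬pv = let a , b = can v Uv in a , trans (refined-out λ r → ¬pv (trans (sym b) r)) b

    -- The labels of `q` lie in the class `i₀`, while the label of any other class is fixed by `p`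
    -- and so lies outside it. New and old labels never collide, and the sums can be compared label
    -- by label.
    Φ-refined : ∀ {F} → SetFunction F →
                Φ F U refined + F (cls U p i₀) ≡ Φ F (cls U p i₀) q + Φ F U p
    Φ-refined {F} sf = begin
        Φ F U refined + F C
          ≡⟨ cong (Φ F U refined +_) (sym (sum-pick (λ _ → F C) i₀)) ⟩
        Φ F U refined + ∑ (λ i → χ (eqb i₀ i) * F C)
          ≡⟨ sym (sum-+ (λ i → F (cls U refined i)) _) ⟩
        ∑ (λ i → F (cls U refined i) + χ (eqb i₀ i) * F C)
          ≡⟨ sum-cong pointwise ⟩
        ∑ (λ i → F (cls C q i) + F (cls U p i))
          ≡⟨ sum-+ (λ i → F (cls C q i)) _ ⟩
        Φ F C q + Φ F U p ∎
      where
      open ≡-Reasoning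
      C = cls U p i₀
      label-in : ∀ i → U i ≡ true → p i ≡ i₀ → cls U refined i ≐ cls C q i
      label-in i Ui pi v with U v in Uv
      ... | false = refl
      ... | true with p v Fin.≟ i₀
      ...   | yes _  = refl
      ...   | no ¬pv = ≢⇒eqb λ r → ¬pv (trans (sym (proj₂ (can v Uv))) (trans (cong p r) pi))
      label-out : ∀ i → ¬ (U i ≡ true × p i ≡ i₀) → i₀ ≢ i → cls U refined i ≐ cls U p i
      label-out i ¬i i₀≢i v with U v in Uv
      ... | false = refl
      ... | true with p v Fin.≟ i₀
      ...   | no _ = refl
      ...   | yes pv = trans (≢⇒eqb λ r → let (a , b) , _ = q-class Uv pv in
                                ¬i (subst (λ x → U x ≡ true) r a , subst (λ x → p x ≡ i₀) r b))
                             (sym (≢⇒eqb λ r → i₀≢i (trans (sym pv) r)))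
      q-out : ∀ i → ¬ (U i ≡ true × p i ≡ i₀) → ∀ v → cls C q i v ≡ false
      q-out i ¬i v = ¬true⇒false λ h →
        let a , b = cls-true C q h
            c , d = cls-true U p a
            (f , g) , _ = q-class c d
        in ¬i (subst (λ x → U x ≡ true) b f , subst (λ x → p x ≡ i₀) b g)
      empty : ∀ i → i₀ ≢ i → U i ≡ true → p i ≡ i₀ → ∀ v → cls U p i v ≡ false
      empty i i₀≢i Ui pi v = ¬true⇒false λ h → let a , b = cls-true U p h in
        i₀≢i (trans (sym pi) (trans (cong p (sym b)) (trans (proj₂ (can v a)) b)))
      -- `i₀` is an arbitrary vertex; if it is not a label in use, its class is empty and nothing is
      -- refined.
      vacuous : ¬ (U i₀ ≡ true × p i₀ ≡ i₀) → ∀ v → cls U p i₀ v ≡ false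
      vacuous ¬i v = ¬true⇒false λ h → let a , b = cls-true U p h ; c , d = can v a in
        ¬i (subst (λ x → U x ≡ true) b c , subst (λ x → p x ≡ x) b d)
      vacuous′ : ¬ (U i₀ ≡ true × p i₀ ≡ i₀) → ∀ v → cls U refined i₀ v ≡ false
      vacuous′ ¬i v = ¬true⇒false λ h → let a , b = cls-true U refined h in case p v Fin.≟ i₀ of λ where
        (yes pv) → true≢false (∧-intro a (≡⇒eqb pv)) (vacuous ¬i v)
        (no ¬pv) → ¬pv (trans (sym (refined-out ¬pv)) b)
      member? : ∀ i → Dec (U i ≡ true × p i ≡ i₀)
      member? i = (U i Bool.≟ true) ×-dec (p i Fin.≟ i₀)
      pointwise : ∀ i → F (cls U refined i) + χ (eqb i₀ i) * F C ≡ F (cls C q i) + F (cls U p i)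
      pointwise i with member? i | i₀ Fin.≟ i
      ... | yes (Ui , pi) | yes refl = cong₂ _+_ (ext sf (label-in i Ui pi)) (+-identityʳ _)
      ... | yes (Ui , pi) | no i₀≢i  = cong₂ _+_ (ext sf (label-in i Ui pi)) (sym (null sf (empty i i₀≢i Ui pi)))
      ... | no ¬i         | yes refl = cong₂ _+_ (trans (null sf (vacuous′ ¬i)) (sym (null sf (q-out i ¬i))))
          (+-identityʳ _)
      ... | no ¬i         | no i₀≢i  = trans (+-identityʳ _)
            (cong₂ _+_ (sym (null sf (q-out i ¬i))) (ext sf (label-out i ¬i i₀≢i)))

  -- Maximisation over all partitions

  allVecs : ∀ {A : Set} → List A → ∀ k → List (Vec.Vec A k)
  allVecs xs zero    = Vec.[] ∷ []
  allVecs xs (suc k) = List.cartesianProductWith Vec._∷_ xs (allVecs xs k)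

  ∈-allVecs : ∀ {A : Set} {xs : List A} → (∀ x → x ∈ xs) → ∀ {k} (v : Vec.Vec A k) → v ∈ allVecs xs k
  ∈-allVecs all Vec.[]      = Any.here refl
  ∈-allVecs all (x Vec.∷ v) = ∈-cartesianProductWith⁺ Vec._∷_ (all x) (∈-allVecs all v)

  canonical? : ∀ {N} (U : VSet N) p → Dec (Canonical U p)
  canonical? U p = Fin.all? λ v → (U v Bool.≟ true) →-dec ((U (p v) Bool.≟ true) ×-dec (p (p v) Fin.≟ p v))

  canonical-cong : ∀ {N} {U : VSet N} {p q} → (∀ v → p v ≡ q v) → Canonical U p → Canonical U q
  canonical-cong {U = U} {p} {q} h can v Uv = let a , b = can v Uv in
    trans (cong U (sym (h v))) a , trans (sym (h (q v))) (trans (cong p (sym (h v))) (trans b (h v)))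

  allMaps : ∀ N → List (Fin N → Fin N)
  allMaps N = List.map Vec.lookup (allVecs (List.allFin N) N)

  -- Maps are listed through their value tables, so a given map occurs only up to pointwise
  -- equality.
  ∈-allMaps : ∀ {N} (q : Fin N → Fin N) → Σ _ λ q′ → q′ ∈ allMaps N × (∀ v → q v ≡ q′ v)
  ∈-allMaps {N} q = Vec.lookup (Vec.tabulate q) ,
    ∈-map⁺ Vec.lookup (∈-allVecs {xs = List.allFin N} ∈-allFin (Vec.tabulate q)) ,
    λ v → sym (Vec.lookup∘tabulate q v)

  opaque
    best : ∀ {N} (F : VSet N → ℕ) (U : VSet N) → Fin N → Fin N
    best {N} F U = Extrema.argmax (Φ F U) (λ v → v) (List.filter (canonical? U) (allMaps N))

    best-canonical : ∀ {N} (F : VSet N → ℕ) U → Canonical U (best F U)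
    best-canonical {N} F U = Extrema.argmax-all (Φ F U) {P = Canonical U} canonical-id
      (All.all-filter (canonical? U) (allMaps N))

    best-max : ∀ {N} {F : VSet N → ℕ} → SetFunction F → ∀ {U q} → Canonical U q → Φ F U q ≤ Φ F U (best F U)
    best-max {N} {F} sf {U} {q} canq with ∈-allMaps q
    ... | q′ , q′∈ , q≗ = ≤-trans
      (≤-reflexive (sum-cong {f = λ i → F (cls U q i)} λ i → ext sf λ v → cong (λ x → U v ∧ eqb x i) (q≗ v)))
      (All.lookup (Extrema.f[xs]≤f[argmax] {f = Φ F U} (λ v → v) (List.filter (canonical? U) (allMaps N)))
         (∈-filter⁺ (canonical? U) q′∈ (canonical-cong q≗ canq)))

  -- Parity, demands and the lexicographic score

  par : ℕ → ℕ
  par 0             = 0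
  par 1             = 1
  par (suc (suc k)) = par k

  par≤1 : ∀ k → par k ≤ 1
  par≤1 0             = z≤n
  par≤1 1             = s≤s z≤n
  par≤1 (suc (suc k)) = par≤1 k

  par-par : ∀ k → par (par k) ≡ par k
  par-par 0             = refl
  par-par 1             = refl
  par-par (suc (suc k)) = par-par k

  par-suc : ∀ k → par (suc (par k)) ≡ par (suc k)
  par-suc 0             = refl
  par-suc 1             = refl
  par-suc (suc (suc k)) = par-suc k

  par-+ : ∀ a b → par (par a + b) ≡ par (a + b)
  par-+ 0             b = refl
  par-+ 1             b = refl
  par-+ (suc (suc a)) b = par-+ a b

  par-cong-+ : ∀ {a b c d} → par a ≡ par c → par b ≡ par d → par (a + b) ≡ par (c + d)
  par-cong-+ {a} {b} {c} {d} h k = begin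
      par (a + b)          ≡⟨ sym (par-+ a b) ⟩
      par (par a + b)      ≡⟨ cong (λ x → par (x + b)) h ⟩
      par (par c + b)      ≡⟨ par-+ c b ⟩
      par (c + b)          ≡⟨ cong par (+-comm c b) ⟩
      par (b + c)          ≡⟨ sym (par-+ b c) ⟩
      par (par b + c)      ≡⟨ cong (λ x → par (x + c)) k ⟩
      par (par d + c)      ≡⟨ par-+ d c ⟩
      par (d + c)          ≡⟨ cong par (+-comm d c) ⟩
      par (c + d)          ∎
    where open ≡-Reasoning

  par-* : ∀ c {a b} → par a ≡ par b → par (c * a) ≡ par (c * b)
  par-* zero    h = refl
  par-* (suc c) {a} {b} h = par-cong-+ {a} {c * a} {b} {c * b} h (par-* c h)

  par-∑ : ∀ {k} {f g : Fin k → ℕ} → (∀ i → par (f i) ≡ par (g i)) → par (∑ f) ≡ par (∑ g)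
  par-∑ {f = f} {g} h = subst₂ (λ a b → par a ≡ par b) (sym (∑-def f)) (sym (∑-def g)) (go h)
    where
    go : ∀ {k} {f g : Fin k → ℕ} → (∀ i → par (f i) ≡ par (g i)) → par (sumFin f) ≡ par (sumFin g)
    go {zero}  h = refl
    go {suc k} {f} {g} h = par-cong-+ {f fz} {sumFin (f ∘ fs)} {g fz} {sumFin (g ∘ fs)} (h fz) (go (h ∘ fs))

  -- This is the correction term in `demand`: with x = e(X) + 1 and s = t(X) it raises x by 0 or 1
  -- to the prescribed parity.
  par-fix : ∀ x s → par (x + par (s + x)) ≡ par s
  par-fix zero          s = trans (par-par (s + 0)) (cong par (+-identityʳ s))
  par-fix (suc zero)    s = trans (cong (λ k → par (suc (par k))) (+-comm s 1)) (par-suc (suc s))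
  par-fix (suc (suc x)) s = trans (cong (λ k → par (x + par k)) (trans (+-suc s (suc x)) (cong suc (+-suc s x))))
      (par-fix x s)

  -- Total demands over partitions of one set share their parity, so strict inequalities between
  -- them become gaps of 2.
  par-< : ∀ {a b} → par a ≡ par b → a < b → 2 + a ≤ b
  par-< {zero}        {suc zero}    () _
  par-< {suc zero}    {suc zero}    h (s≤s ())
  par-< {zero}        {suc (suc b)} h _ = s≤s (s≤s z≤n)
  par-< {suc zero}    {suc (suc zero)} () _
  par-< {suc zero}    {suc (suc (suc b))} h _ = s≤s (s≤s (s≤s z≤n))
  par-< {suc (suc a)} {suc zero}    h (s≤s ())
  par-< {suc (suc a)} {suc (suc b)} h (s≤s (s≤s a<b)) = s≤s (s≤s (par-< h a<b))

  -- The least admissible charge of X: the least integer above e(X) with the parity of t(X), and 0 for X = ∅.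
  demand : ∀ {N} → Edges N → (Fin N → ℕ) → VSet N → ℕ
  demand E t X = χ (anyFin X) * (e E X + 1 + par (σ t X + (e E X + 1)))

  excess : ∀ {N} → Edges N → (Fin N → ℕ) → VSet N → ℕ
  excess E t X = χ (anyFin X) * par (σ t X + (e E X + 1))

  demand-split : ∀ {N} (E : Edges N) t X → demand E t X ≡ e E X + χ (anyFin X) + excess E t X
  demand-split E t X with anyFin X in eq
  ... | true  = trans (+-identityʳ _) (cong (e E X + 1 +_) (sym (+-identityʳ _)))
  ... | false = sym (trans (+-identityʳ _) (trans (+-identityʳ _) (e-empty E (any-none X eq))))

  nonempty : ∀ {N} → SetFunction {N} (λ X → χ (anyFin X))
  nonempty .ext h = cong χ (any-cong h)
  nonempty .null {X} h = cong χ (any-false X h)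

  demand-set : ∀ {N} (E : Edges N) t → SetFunction (demand E t)
  demand-set E t .ext {X} {Y} h =
    cong₂ _*_ (ext nonempty h) (cong₂ (λ a b → a + 1 + par (b + (a + 1))) (e-cong E h) (σ-cong t h))
  demand-set E t .null {X} h = cong (_* (e E X + 1 + par (σ t X + (e E X + 1)))) (null nonempty {X} h)

  -- Maximising this lexicographically prefers, among partitions of maximum total demand, those with most classes.
  score : ∀ {N} → Edges N → (Fin N → ℕ) → VSet N → ℕ
  score {N} E t X = suc N * demand E t X + χ (anyFin X)

  score-set : ∀ {N} (E : Edges N) t → SetFunction (score E t)
  score-set {N} E t .ext h = cong₂ (λ a b → suc N * a + b) (ext (demand-set E t) h) (ext nonempty h)
  score-set {N} E t .null {X} h = trans (cong₂ (λ a b → suc N * a + b) (null (demand-set E t) {X} h)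
      (null nonempty {X} h))
    (trans (+-identityʳ _) (*-zeroʳ N))

  classes : ∀ {N} → VSet N → (Fin N → Fin N) → ℕ
  classes U p = Φ (χ ∘ anyFin) U p

  Φ-score : ∀ {N} (E : Edges N) t U p → Φ (score E t) U p ≡ suc N * Φ (demand E t) U p + classes U p
  Φ-score {N} E t U p = trans (sum-+ (λ i → suc N * demand E t (cls U p i)) _)
    (cong (_+ classes U p) (sum-* (suc N) (λ i → demand E t (cls U p i))))

  classes≤ : ∀ {N} (U : VSet N) p → classes U p ≤ N
  classes≤ {N} U p = ≤-trans (sum-mono λ i → χ≤1 _) (≤-reflexive (trans (sum-const 1) (*-identityʳ N)))

  lex-≤ : ∀ {N a b c d} → d ≤ N → suc N * a + c ≤ suc N * b + d → a ≤ b
  lex-≤ {N} {a} {b} {c} {d} d≤N h with a ≤? b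
  ... | yes a≤b = a≤b
  ... | no a≰b = ⊥-elim (<-irrefl refl (begin-strict
      suc N * b + d      ≤⟨ +-monoʳ-≤ (suc N * b) d≤N ⟩
      suc N * b + N      <⟨ +-monoʳ-< (suc N * b) (n<1+n N) ⟩
      suc N * b + suc N  ≡⟨ trans (+-comm _ (suc N)) (sym (*-suc (suc N) b)) ⟩
      suc N * suc b      ≤⟨ *-monoʳ-≤ (suc N) (≰⇒> a≰b) ⟩
      suc N * a          ≤⟨ m≤m+n _ c ⟩
      suc N * a + c      ≤⟨ h ⟩
      suc N * b + d      ∎))
    where open ≤-Reasoning

  lex-< : ∀ {N a b c} → suc N * a + suc (suc c) ≤ suc N * b + 1 → a < b
  lex-< {N} {a} {b} {c} h with a <? b
  ... | yes a<b = a<b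
  ... | no a≮b = ⊥-elim (<-irrefl refl (begin-strict
      suc N * b + 1           ≤⟨ +-monoˡ-≤ 1 (*-monoʳ-≤ (suc N) (≮⇒≥ a≮b)) ⟩
      suc N * a + 1           <⟨ +-monoʳ-< (suc N * a) (s≤s (s≤s z≤n)) ⟩
      suc N * a + suc (suc c) ≤⟨ h ⟩
      suc N * b + 1           ∎))
    where open ≤-Reasoning

  -- Optimal partitions

  _⊆_ : ∀ {N} → VSet N → VSet N → Set
  X ⊆ Y = ∀ v → X v ≡ true → Y v ≡ true

  two-terms≤sum : ∀ {k} (f : Fin k → ℕ) {i j} → i ≢ j → f i + f j ≤ ∑ f
  two-terms≤sum f {i} {j} i≢j = begin
      f i + f j
        ≡⟨ cong₂ _+_ (sym (sum-pick f i)) (sym (sum-pick f j)) ⟩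
      ∑ (λ k → χ (eqb i k) * f k) + ∑ (λ k → χ (eqb j k) * f k)
        ≡⟨ sym (sum-+ (λ k → χ (eqb i k) * f k) _) ⟩
      ∑ (λ k → χ (eqb i k) * f k + χ (eqb j k) * f k)
        ≤⟨ sum-mono pointwise ⟩
      ∑ f ∎
    where
    open ≤-Reasoning
    pointwise : ∀ k → χ (eqb i k) * f k + χ (eqb j k) * f k ≤ f k
    pointwise k with i Fin.≟ k | j Fin.≟ k
    ... | yes refl | yes refl = ⊥-elim (i≢j refl)
    ... | yes _    | no _     = ≤-reflexive (trans (+-identityʳ _) (+-identityʳ _))
    ... | no _     | yes _    = ≤-reflexive (+-identityʳ _)
    ... | no _     | no _     = z≤n

  σ-+ : ∀ {N} (m t : Fin N → ℕ) X → σ (λ v → m v + t v) X ≡ σ m X + σ t X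
  σ-+ m t X = trans (sum-cong λ v → *-distribˡ-+ (χ (X v)) (m v) (t v)) (sum-+ (λ v → χ (X v) * m v) _)

  σ-point : ∀ {N} c (y : Fin N) X → σ (λ v → c * χ (eqb y v)) X ≡ c * χ (X y)
  σ-point c y X = trans (sum-cong λ v → eq (χ (X v)) c (χ (eqb y v))) (sum-pick (λ v → c * χ (X v)) y)
    where eq : ∀ a b d → a * (b * d) ≡ d * (b * a)
          eq = solve-∀

  par-demand : ∀ {N} (E : Edges N) t X → par (demand E t X) ≡ par (σ t X)
  par-demand E t X with anyFin X in eq
  ... | true  = trans (cong par (+-identityʳ (e E X + 1 + par (σ t X + (e E X + 1))))) (par-fix (e E X + 1) (σ t X))
  ... | false = sym (cong par (sum-0 λ v → cong (λ b → χ b * t v) (any-none X eq v)))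

  par-Φ-demand : ∀ {N} (E : Edges N) t U p → par (Φ (demand E t) U p) ≡ par (σ t U)
  par-Φ-demand E t U p = trans
    (par-∑ {f = λ i → demand E t (cls U p i)} {λ i → σ t (cls U p i)} λ i → par-demand E t (cls U p i))
    (cong par (sym (σ-split t p U)))

  count-mono-< : ∀ {N} {X Y : VSet N} {w} → X ⊆ Y → Y w ≡ true → X w ≡ false → count X < count Y
  count-mono-< {_} {X} {Y} {w} X⊆Y Yw Xw = subst₂ _≤_
      (trans (sum-+ (λ v → χ (eqb w v)) _) (cong₂ _+_ (sum-pick₁ w) (sym (count≡sum X)))) (sym (count≡sum Y))
      (sum-mono pointwise)
    where
    pointwise : ∀ v → χ (eqb w v) + χ (X v) ≤ χ (Y v)
    pointwise v with w Fin.≟ v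
    ... | yes refl rewrite Xw | Yw = ≤-refl
    ... | no _ = χ-mono (X⊆Y v)

  opaque
    finest : ∀ {N} → Edges N → (Fin N → ℕ) → VSet N → Fin N → Fin N
    finest E t U = best (score E t) U

    finest-canonical : ∀ {N} (E : Edges N) t U → Canonical U (finest E t U)
    finest-canonical E t U = best-canonical (score E t) U

    finest-max : ∀ {N} (E : Edges N) t U {q} → Canonical U q → Φ (score E t) U q ≤ Φ (score E t) U (finest E t U)
    finest-max E t U = best-max (score-set E t)

  module Optimum {N} (E : Edges N) (t : Fin N → ℕ) (U : VSet N) where
    p : Fin N → Fin N
    p = finest E t U

    canonical : Canonical U p
    canonical = finest-canonical E t U

    D : VSet N → ℕ
    D = demand E t

    score-max : ∀ {q} → Canonical U q → Φ (score E t) U q ≤ Φ (score E t) U p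
    score-max = finest-max E t U

    -- The tie-break by the number of classes stays below the factor `suc N`, so a maximum of the
    -- score is also a maximum of the demand.
    Φ-max : ∀ {q} → Canonical U q → Φ D U q ≤ Φ D U p
    Φ-max {q} canq = lex-≤ {N} {c = classes U q} (classes≤ U p)
      (subst₂ _≤_ (Φ-score E t U q) (Φ-score E t U p) (score-max canq))

    -- Otherwise merging the classes labelled by `J` would increase the total demand. The vertex `v`
    -- supplies the label of the merged class.
    merge-≤ : ∀ J {v} → U v ≡ true → J (p v) ≡ true → D (U ∩ (J ∘ p)) ≤ ∑ (λ i → χ (J i) * D (cls U p i))
    merge-≤ J {v} Uv Jpv = by-≤ 0 (Φ-max merged-canonical)
        (trans (+-identityʳ _) (trans (sym (Φ-merged (demand-set E t))) (+-comm (Φ D U merged) _)))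
      where open Merge canonical J (proj₁ (canonical v Uv)) (proj₂ (canonical v Uv)) Jpv

    refine-≤ : ∀ i₀ {q} → Canonical (cls U p i₀) q → Φ (score E t) (cls U p i₀) q ≤ score E t (cls U p i₀)
    refine-≤ i₀ {q} canq = by-≤ 0 (score-max refined-canonical)
        (trans (+-identityʳ _) (trans (sym (Φ-refined (score-set E t))) (+-comm (Φ (score E t) U refined) _)))
      where open Refine canonical i₀ canq

    -- A proper refinement has more classes, so it would have a larger score unless it lost demand;
    -- by parity the loss is at least 2.
    refine-strict : ∀ i₀ {q} → Canonical (cls U p i₀) q → ∀ {v w} → cls U p i₀ v ≡ true → cls U p i₀ w ≡ true →
                    q v ≢ q w → 2 + Φ D (cls U p i₀) q ≤ D (cls U p i₀)
    refine-strict i₀ {q} canq {v} {w} Cv Cw qv≢qw = par-<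
        (trans (par-Φ-demand E t C q) (sym (par-demand E t C)))
        (lex-< {N} {c = 0} (begin
          suc N * Φ D C q + 2            ≤⟨ +-monoʳ-≤ (suc N * Φ D C q) two ⟩
          suc N * Φ D C q + classes C q  ≡⟨ sym (Φ-score E t C q) ⟩
          Φ (score E t) C q              ≤⟨ refine-≤ i₀ canq ⟩
          suc N * D C + χ (anyFin C)     ≤⟨ +-monoʳ-≤ (suc N * D C) (χ≤1 _) ⟩
          suc N * D C + 1                ∎))
      where
      open ≤-Reasoning
      C = cls U p i₀
      class-of : ∀ {x} → C x ≡ true → χ (anyFin (cls C q (q x))) ≡ 1
      class-of {x} Cx = cong χ (any-intro (cls C q (q x)) x (∧-intro Cx (eqb-refl (q x))))
      two : 2 ≤ classes C q
      two = subst (_≤ classes C q) (cong₂ _+_ (class-of Cv) (class-of Cw))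
              (two-terms≤sum (λ i → χ (anyFin (cls C q i))) qv≢qw)

    -- This is what permits induction inside a class after its edges or parities have been modified
    -- at `y`. The trivial partition is bounded by assumption. In a proper one only the part that
    -- contains `y` can gain a unit, and the gap of 2 absorbs it.
    class-bound : ∀ i₀ y {D′ B} → SetFunction D′ → (∀ X → D′ X ≤ D X + χ (X y)) →
                  (∃ λ v → cls U p i₀ v ≡ true) → D′ (cls U p i₀) ≤ B → D (cls U p i₀) ≤ suc B →
                  ∀ {q} → Canonical (cls U p i₀) q → Φ D′ (cls U p i₀) q ≤ B
    class-bound i₀ y {D′} {B} sf D′≤ (v , Cv) D′C DC {q} canq
      with search (λ w → cls U p i₀ w ∧ not (eqb (q v) (q w)))
    ... | inj₂ same = ≤-trans (≤-reflexive (trans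
            (sum-single (λ i → D′ (cls C q i)) (q v) λ j j≢ → SetFunction.null sf λ w → ¬true⇒false λ h →
               let Cw , qw = cls-true C q h in j≢ (trans (sym qw) (sym (agree w Cw))))
            (SetFunction.ext sf λ w → whole w))) D′C
      where
      C = cls U p i₀
      agree : ∀ w → C w ≡ true → q v ≡ q w
      agree w Cw with q v Fin.≟ q w in eq
      ... | yes r = r
      ... | no ¬r = true≢false (∧-intro Cw (cong not (≢⇒eqb ¬r))) (same w)
      whole : ∀ w → cls C q (q v) w ≡ C w
      whole w with C w in Cw
      ... | true  = ≡⇒eqb (sym (agree w Cw))
      ... | false = refl
    ... | inj₁ (w , h) = +-cancelˡ-≤ 1 _ _ (begin
        1 + Φ D′ C q           ≤⟨ +-monoʳ-≤ 1 (sum-mono λ i → D′≤ (cls C q i)) ⟩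
        1 + ∑ (λ i → D (cls C q i) + χ (cls C q i y))
                               ≡⟨ cong (1 +_) (sum-+ (λ i → D (cls C q i)) _) ⟩
        1 + (Φ D C q + ∑ (λ i → χ (cls C q i y)))
                               ≤⟨ +-monoʳ-≤ 1 (+-monoʳ-≤ (Φ D C q) (≤-trans
                                    (sum-mono λ i → χ-mono {cls C q i y} {eqb (q y) i} λ r → proj₂ (∧-true {C y} r))
                                    (≤-reflexive (sum-pick₁ (q y))))) ⟩
        1 + (Φ D C q + 1)      ≡⟨ cong suc (+-comm _ 1) ⟩
        2 + Φ D C q            ≤⟨ refine-strict i₀ canq Cv (proj₁ (∧-true h)) differ ⟩
        D C                    ≤⟨ DC ⟩
        suc B                  ∎)
      where
      open ≤-Reasoning
      C = cls U p i₀
      differ : q v ≢ q w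
      differ r = true≢false (proj₂ (∧-true {C w} h)) (cong not (≡⇒eqb r))

    -- Placing the extra units of the classes of excess 1

    b : Fin N → ℕ
    b i = excess E t (cls U p i)

    meets : VSet N → Fin N → ℕ
    meets X i = χ (anyFin (cls X p i))

    meets≤1 : ∀ X i → meets X i ≤ 1
    meets≤1 X i = χ≤1 (anyFin (cls X p i))

    -- A class i of excess 1 must be charged one extra unit at some vertex y i of it; while y i = nothing,
    -- every set meeting the class is credited with that unit.
    θ : (Fin N → Maybe (Fin N)) → Fin N → VSet N → ℕ
    θ y i X with y i
    ... | nothing = meets X i + b i * meets X i
    ... | just w  = meets X i + b i * χ (X w)

    θ-pending : ∀ {y i} → y i ≡ nothing → ∀ X → θ y i X ≡ meets X i + b i * meets X i
    θ-pending {y} {i} h X with y i | h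
    ... | nothing | refl = refl

    θ-resolved : ∀ {y i w} → y i ≡ just w → ∀ X → θ y i X ≡ meets X i + b i * χ (X w)
    θ-resolved {y} {i} h X with y i | h
    ... | just w | refl = refl

    Feasible : (Fin N → Maybe (Fin N)) → Set
    Feasible y = ∀ X → X ⊆ U → ∀ {v} → X v ≡ true → 1 + crossing E p X ≤ ∑ (λ i → θ y i X)

    -- Apply `merge-≤` to the union `W` of the classes that meet X. The demand of `W` exceeds e(W),
    -- which counts the inner edges of these classes and at least the crossing edges of X; the
    -- demand of a class exceeds its inner edges by at most 1 + b. The inner edges cancel.
    feasible₀ : Feasible (λ _ → nothing)
    feasible₀ X X⊆U {v} Xv = +-cancelˡ-≤ (∑ λ i → μ i * e E (Cl i)) _ _ (begin
        ∑ (λ i → μ i * e E (Cl i)) + (1 + crossing E p X)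
          ≤⟨ +-mono-≤ (sum-mono inside) (+-monoʳ-≤ 1 (crossing-mono E p X⊆W)) ⟩
        ∑ (λ i → e E (cls W p i)) + (1 + crossing E p W)
          ≡⟨ trans (+-suc _ _) (trans (cong suc (sym (e-split E p W))) (+-comm 1 _)) ⟩
        e E W + 1
          ≤⟨ e+1≤D ⟩
        D W
          ≤⟨ merge-≤ (anyFin ∘ cls X p) (X⊆U v Xv) (any-intro (cls X p (p v)) v (∧-intro Xv (eqb-refl (p v)))) ⟩
        ∑ (λ i → μ i * D (Cl i))
          ≤⟨ sum-mono (λ i → ≤-trans (*-monoʳ-≤ (μ i) (≤-reflexive (demand-split E t (Cl i))))
               (≤-trans (*-monoʳ-≤ (μ i) (+-monoˡ-≤ (b i) (+-monoʳ-≤ (e E (Cl i)) (χ≤1 (anyFin (Cl i))))))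
                        (≤-reflexive (eq (μ i) (e E (Cl i)) (b i))))) ⟩
        ∑ (λ i → μ i * e E (Cl i) + θ (λ _ → nothing) i X)
          ≡⟨ sum-+ (λ i → μ i * e E (Cl i)) _ ⟩
        ∑ (λ i → μ i * e E (Cl i)) + ∑ (λ i → θ (λ _ → nothing) i X) ∎)
      where
      open ≤-Reasoning
      Cl = cls U p
      μ = meets X
      W : VSet N
      W = U ∩ (λ v → anyFin (cls X p (p v)))
      X⊆W : X ⊆ W
      X⊆W w Xw = ∧-intro (X⊆U w Xw) (any-intro (cls X p (p w)) w (∧-intro Xw (eqb-refl (p w))))
      inside : ∀ i → μ i * e E (Cl i) ≤ e E (cls W p i)
      inside i with anyFin (cls X p i) in eq
      ... | false = z≤n
      ... | true  = ≤-reflexive (trans (+-identityʳ _) (e-cong E λ w → lem w))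
        where
        lem : ∀ w → Cl i w ≡ cls W p i w
        lem w with p w Fin.≟ i
        ... | yes refl rewrite eq = cong (_∧ true) (sym (Bool.∧-identityʳ (U w)))
        ... | no _ = trans (Bool.∧-zeroʳ (U w)) (sym (Bool.∧-zeroʳ (W w)))
      e+1≤D : e E W + 1 ≤ D W
      e+1≤D rewrite any-intro W v (X⊆W v Xv) = ≤-trans (m≤m+n _ _) (≤-reflexive (sym (+-identityʳ _)))
      eq : ∀ j x c → j * (x + 1 + c) ≡ j * x + (j + c * j)
      eq = solve-∀

    meets-cong : ∀ {X Y} → X ≐ Y → ∀ i → meets X i ≡ meets Y i
    meets-cong h i = cong χ (any-cong λ v → cong (_∧ eqb (p v) i) (h v))

    θ-cong : ∀ y {X Y} → X ≐ Y → ∀ i → θ y i X ≡ θ y i Y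
    θ-cong y h i with y i
    ... | nothing = cong₂ _+_ (meets-cong h i) (cong (b i *_) (meets-cong h i))
    ... | just w  = cong₂ _+_ (meets-cong h i) (cong (λ c → b i * χ c) (h w))

    meets-∪∩ : ∀ X Y i → meets (X ∪ Y) i + meets (X ∩ Y) i ≤ meets X i + meets Y i
    meets-∪∩ X Y i with anyFin (cls X p i) in x | anyFin (cls Y p i) in y
    ... | true  | true  = +-mono-≤ (meets≤1 (X ∪ Y) i) (meets≤1 (X ∩ Y) i)
    ... | true  | false = +-mono-≤ (meets≤1 (X ∪ Y) i) (≤-reflexive (cong χ (any-false (cls (X ∩ Y) p i) λ v →
        ¬true⇒false λ h →
          let a , c = ∧-true h in true≢false (∧-intro (proj₂ (∧-true {X v} a)) c) (any-none (cls Y p i) y v))))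
    ... | false | true  = ≤-trans (≤-reflexive (+-comm (meets (X ∪ Y) i) _)) (+-mono-≤
          (≤-reflexive (cong χ (any-false (cls (X ∩ Y) p i) λ v → ¬true⇒false λ h →
          let a , c = ∧-true h in true≢false (∧-intro (proj₁ (∧-true {X v} a)) c) (any-none (cls X p i) x v)))) (meets≤1 (X ∪ Y) i))
    ... | false | false = ≤-reflexive (cong₂ (λ c d → χ c + χ d)
          (any-false (cls (X ∪ Y) p i) λ v → union v)
          (any-false (cls (X ∩ Y) p i) λ v → ¬true⇒false λ h →
          let a , c = ∧-true h in true≢false (∧-intro (proj₁ (∧-true {X v} a)) c) (any-none (cls X p i) x v)))
      where
      union : ∀ v → cls (X ∪ Y) p i v ≡ false
      union v with X v | Y v | any-none (cls X p i) x v | any-none (cls Y p i) y v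
      ... | true  | _     | r | _ = r
      ... | false | true  | _ | r = r
      ... | false | false | _ | _ = refl

    χ-∪∩ : ∀ (a c : Bool) → χ (a ∨ c) + χ (a ∧ c) ≡ χ a + χ c
    χ-∪∩ true  true  = refl
    χ-∪∩ true  false = refl
    χ-∪∩ false c     = +-identityʳ (χ c)

    -- Meeting a class is submodular in the set, and containing a fixed vertex is modular.
    θ-submodular : ∀ y X Y i → θ y i (X ∪ Y) + θ y i (X ∩ Y) ≤ θ y i X + θ y i Y
    θ-submodular y X Y i with y i
    ... | nothing = subst₂ _≤_ (eq (meets (X ∪ Y) i) (meets (X ∩ Y) i) (b i)) (eq (meets X i) (meets Y i) (b i))
                      (*-monoʳ-≤ (1 + b i) (meets-∪∩ X Y i))
      where eq : ∀ m n c → (1 + c) * (m + n) ≡ m + c * m + (n + c * n)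
            eq = solve-∀
    ... | just w  = subst₂ _≤_ (eq (meets (X ∪ Y) i) (meets (X ∩ Y) i) (b i) _ _) (eq (meets X i) (meets Y i)
        (b i) _ _)
                      (+-mono-≤ (meets-∪∩ X Y i) (≤-reflexive (cong (b i *_) (χ-∪∩ (X w) (Y w)))))
      where eq : ∀ m n c x y → m + n + c * (x + y) ≡ m + c * x + (n + c * y)
            eq = solve-∀

    -- The sets that would become infeasible if the pending unit of a class of excess 1 were placed
    -- outside them.
    Tight : (Fin N → Maybe (Fin N)) → Fin N → VSet N → Set
    Tight y i X = X ⊆ U × anyFin (cls X p i) ≡ true × ∑ (λ j → θ y j X) ≤ 1 + crossing E p X

    -- Two tight sets with disjoint traces on the class i would leave a gap of 2 in the submodular inequality at i.
    Tight-∩ : ∀ {y} → Feasible y → ∀ {i} → y i ≡ nothing → b i ≡ 1 → ∀ {X Y} →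
              Tight y i X → Tight y i Y → Tight y i (X ∩ Y)
    Tight-∩ {y} feas {i} yi bi {X} {Y} (X⊆U , Xi , Xt) (Y⊆U , Yi , Yt) = ∩⊆U , traces , tight
      where
      open ≤-Reasoning
      L = λ Z → ∑ (λ j → θ y j Z)
      a = crossing E p
      ∩⊆U : (X ∩ Y) ⊆ U
      ∩⊆U v h = X⊆U v (proj₁ (∧-true h))
      ∪⊆U : (X ∪ Y) ⊆ U
      ∪⊆U v h with X v in Xv
      ... | true  = X⊆U v Xv
      ... | false = Y⊆U v h
      x₀ = any-elim (cls X p i) Xi
      ∪-feas : 1 + a (X ∪ Y) ≤ L (X ∪ Y)
      ∪-feas = feas (X ∪ Y) ∪⊆U {proj₁ x₀} (cong (_∨ Y (proj₁ x₀)) (proj₁ (∧-true {X (proj₁ x₀)} (proj₂ x₀))))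
      -- Without the extra 1 of `Feasible`, because at this point the intersection may be empty.
      ∩-feas : a (X ∩ Y) ≤ L (X ∩ Y)
      ∩-feas with search (X ∩ Y)
      ... | inj₁ (v , h) = ≤-trans (n≤1+n _) (feas (X ∩ Y) ∩⊆U h)
      ... | inj₂ none = ≤-trans (≤-trans (crossing-mono E p {Y = λ _ → false} λ v h → true≢false h (none v))
                          (≤-reflexive (crossing-empty E))) z≤n
        where
        crossing-empty : ∀ (E : Edges N) → crossing E p (λ _ → false) ≡ 0
        crossing-empty []      = refl
        crossing-empty (_ ∷ E) = crossing-empty E
      sum-bound : L X + L Y ≤ 2 + (a (X ∪ Y) + a (X ∩ Y))
      sum-bound = begin
        L X + L Y                      ≤⟨ +-mono-≤ Xt Yt ⟩
        1 + a X + (1 + a Y)            ≡⟨ cong suc (+-suc (a X) (a Y)) ⟩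
        2 + (a X + a Y)                ≤⟨ +-monoʳ-≤ 2 (crossing-supermodular E p X Y) ⟩
        2 + (a (X ∪ Y) + a (X ∩ Y))    ∎
      traces : anyFin (cls (X ∩ Y) p i) ≡ true
      traces with anyFin (cls (X ∩ Y) p i) in eq
      ... | true  = refl
      ... | false = ⊥-elim (<-irrefl refl (begin-strict
          2 + (a (X ∪ Y) + a (X ∩ Y))  <⟨ n<1+n _ ⟩
          3 + (a (X ∪ Y) + a (X ∩ Y))  ≡⟨ +-comm 2 _ ⟩
          1 + a (X ∪ Y) + a (X ∩ Y) + 2 ≤⟨ +-monoˡ-≤ 2 (+-mono-≤ ∪-feas ∩-feas) ⟩
          L (X ∪ Y) + L (X ∩ Y) + 2    ≡⟨ cong₂ _+_ (sym (sum-+ (λ j → θ y j (X ∪ Y)) _)) (sym (sum-pick (λ _ → 2)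
              i)) ⟩
          ∑ (λ j → θ y j (X ∪ Y) + θ y j (X ∩ Y)) + ∑ (λ j → χ (eqb i j) * 2)
                                       ≡⟨ sym (sum-+ (λ j → θ y j (X ∪ Y) + θ y j (X ∩ Y)) _) ⟩
          ∑ (λ j → θ y j (X ∪ Y) + θ y j (X ∩ Y) + χ (eqb i j) * 2)
                                       ≤⟨ sum-mono pointwise ⟩
          ∑ (λ j → θ y j X + θ y j Y)  ≡⟨ sum-+ (λ j → θ y j X) _ ⟩
          L X + L Y                    ≤⟨ sum-bound ⟩
          2 + (a (X ∪ Y) + a (X ∩ Y))  ∎))
        where
        θ-nothing : ∀ Z → θ y i Z ≡ meets Z i + meets Z i
        θ-nothing Z = trans (θ-pending {y} yi Z) (cong (meets Z i +_) (trans (cong (_* meets Z i) bi) (+-identityʳ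
            _)))
        pointwise : ∀ j → θ y j (X ∪ Y) + θ y j (X ∩ Y) + χ (eqb i j) * 2 ≤ θ y j X + θ y j Y
        pointwise j with i Fin.≟ j
        ... | no _ = ≤-trans (≤-reflexive (+-identityʳ _)) (θ-submodular y X Y j)
        ... | yes refl = begin
            θ y i (X ∪ Y) + θ y i (X ∩ Y) + 2
              ≡⟨ cong₂ (λ c d → c + d + 2) (θ-nothing (X ∪ Y)) (trans (θ-nothing (X ∩ Y)) (cong (λ c → χ c + χ c)
                  eq)) ⟩
            meets (X ∪ Y) i + meets (X ∪ Y) i + 0 + 2
              ≤⟨ +-monoˡ-≤ 2 (+-monoˡ-≤ 0 (+-mono-≤ (meets≤1 (X ∪ Y) i) (meets≤1 (X ∪ Y) i))) ⟩
            4
              ≡⟨ sym (cong₂ _+_ (trans (θ-nothing X) (cong (λ c → χ c + χ c) Xi)) (trans (θ-nothing Y)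
                  (cong (λ c → χ c + χ c) Yi))) ⟩
            θ y i X + θ y i Y ∎
      tight : L (X ∩ Y) ≤ 1 + a (X ∩ Y)
      tight = +-cancelˡ-≤ (1 + a (X ∪ Y)) _ _ (begin
          1 + a (X ∪ Y) + L (X ∩ Y)    ≤⟨ +-monoˡ-≤ (L (X ∩ Y)) ∪-feas ⟩
          L (X ∪ Y) + L (X ∩ Y)        ≡⟨ sym (sum-+ (λ j → θ y j (X ∪ Y)) _) ⟩
          ∑ (λ j → θ y j (X ∪ Y) + θ y j (X ∩ Y)) ≤⟨ sum-mono (θ-submodular y X Y) ⟩
          ∑ (λ j → θ y j X + θ y j Y)  ≡⟨ sum-+ (λ j → θ y j X) _ ⟩
          L X + L Y                    ≤⟨ sum-bound ⟩
          2 + (a (X ∪ Y) + a (X ∩ Y))  ≡⟨ cong suc (sym (+-suc (a (X ∪ Y)) (a (X ∩ Y)))) ⟩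
          1 + a (X ∪ Y) + (1 + a (X ∩ Y)) ∎)

    tight? : ∀ y i w X → Dec (Tight y i X × X w ≡ false)
    tight? y i w X = (Fin.all? (λ v → (X v Bool.≟ true) →-dec (U v Bool.≟ true))
                      ×-dec ((anyFin (cls X p i) Bool.≟ true) ×-dec (∑ (λ j → θ y j X) ≤? 1 + crossing E p X)))
                     ×-dec (X w Bool.≟ false)

    Tight-cong : ∀ {y i w X Y} → X ≐ Y → Tight y i X × X w ≡ false → Tight y i Y × Y w ≡ false
    Tight-cong {y} {i} {w} {X} {Y} h ((X⊆U , Xi , Xt) , Xw) =
      ((λ v Yv → X⊆U v (trans (h v) Yv)) ,
       trans (any-cong λ v → cong (_∧ eqb (p v) i) (sym (h v))) Xi ,
       subst₂ _≤_ (sum-cong (θ-cong y h)) (cong suc (crossing-cong E p h)) Xt) ,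
      trans (sym (h w)) Xw

    -- The vertices at which the pending unit can safely be placed.
    Avoiding : (Fin N → Maybe (Fin N)) → Fin N → Fin N → Set
    Avoiding y i w = ∀ X → Tight y i X → X w ≡ true

    avoiding? : ∀ y i w → (∃ λ X → Tight y i X × X w ≡ false) ⊎ Avoiding y i w
    avoiding? y i w with anySubset? (λ S → tight? y i w (Vec.lookup S))
    ... | yes (S , h) = inj₁ (Vec.lookup S , h)
    ... | no none = inj₂ λ X tX → ¬false⇒true λ Xw →
            none (Vec.tabulate X , Tight-cong {y} (λ v → sym (Vec.lookup∘tabulate X v)) (tX , Xw))

    -- A tight set is shrunk as long as possible: if some tight set misses a vertex of the current
    -- trace on the class, intersecting with it gives a smaller tight set, whose trace is still
    -- nonempty by `Tight-∩`.
    pick : ∀ {y} → Feasible y → ∀ {i} → y i ≡ nothing → b i ≡ 1 → (∃ λ v → cls U p i v ≡ true) →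
           ∃ λ w → cls U p i w ≡ true × Avoiding y i w
    pick {y} feas {i} yi bi (v , Cv) with avoiding? y i v
    ... | inj₂ av = v , Cv , av
    ... | inj₁ (X , tX , _) = shrink (count X) X ≤-refl tX
      where
      shrink : ∀ k X → count X ≤ k → Tight y i X → ∃ λ w → cls U p i w ≡ true × Avoiding y i w
      shrink k X X≤k tX@(X⊆U , Xi , _) with any-elim (cls X p i) Xi
      ... | w , h with avoiding? y i w
      ...   | inj₂ av = w , ∧-intro (X⊆U w (proj₁ (∧-true {X w} h))) (proj₂ (∧-true {X w} h)) , av
      ...   | inj₁ (Y , tY , Yw) with k
      ...     | zero  = ⊥-elim (n≮0 (<-≤-trans (count-mono-< {_} {λ _ → false} {X} {w} (λ _ ())
          (proj₁ (∧-true {X w} h)) refl) X≤k))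
      ...     | suc k = shrink k (X ∩ Y)
                  (≤-pred (≤-trans (count-mono-< {_} {X ∩ Y} {X} {w} (λ _ → proj₁ ∘ ∧-true) (proj₁ (∧-true {X w} h))
                            (trans (cong (X w ∧_) Yw) (Bool.∧-zeroʳ (X w)))) X≤k))
                  (Tight-∩ {y} feas yi bi tX tY)

    resolve : (Fin N → Maybe (Fin N)) → Fin N → Fin N → Fin N → Maybe (Fin N)
    resolve y i w j = if eqb i j then just w else y j

    Valid : (Fin N → Maybe (Fin N)) → Set
    Valid y = ∀ {i w} → y i ≡ just w → b i ≡ 1 → cls U p i w ≡ true

    resolve-same : ∀ y i w → resolve y i w i ≡ just w
    resolve-same y i w = cong (λ c → if c then just w else y i) (eqb-refl i)

    resolve-other : ∀ y {i j} w → i ≢ j → resolve y i w j ≡ y j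
    resolve-other y {i} {j} w h = cong (λ c → if c then just w else y j) (≢⇒eqb h)

    -- Placing the unit at `w` costs something only for sets that meet the class but miss `w`, and
    -- there only one unit. Such sets are not tight, so they have a unit to spare.
    feasible-resolve : ∀ {y} → Feasible y → ∀ {i} → y i ≡ nothing → ∀ w →
      (b i ≡ 0 ⊎ (b i ≡ 1 × cls U p i w ≡ true × Avoiding y i w)) → Feasible (resolve y i w)
    feasible-resolve {y} feas {i} yi w ok X X⊆U {v} Xv = go ok
      where
      open ≤-Reasoning
      y′ = resolve y i w
      θ-other : ∀ {j} → i ≢ j → θ y j X ≡ θ y′ j X
      θ-other {j} i≢j with y j | y′ j | resolve-other y {i} {j} w i≢j
      ... | nothing | _ | refl = refl
      ... | just _  | _ | refl = refl
      θ-new : θ y′ i X ≡ meets X i + b i * χ (X w)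
      θ-new = θ-resolved {y′} (resolve-same y i w) X
      at-i : (∀ j → i ≡ j → θ y j X ≤ θ y′ j X) → 1 + crossing E p X ≤ ∑ (λ j → θ y′ j X)
      at-i h = ≤-trans (feas X X⊆U Xv) (sum-mono λ j → case i Fin.≟ j of λ where
        (yes q) → h j q
        (no q)  → ≤-reflexive (θ-other q))
      go : _ → _
      go (inj₁ b0) = at-i λ { _ refl → ≤-reflexive (trans (θ-pending {y} yi X)
             (trans (cong (λ c → meets X i + c * meets X i) b0) (sym (trans θ-new (cong (λ c → meets X i + c * χ
                 (X w)) b0))))) }
      go (inj₂ (b1 , Cw , av)) with X w in Xw
      ... | true = at-i λ { _ refl → begin
             θ y i X                        ≡⟨ θ-pending {y} yi X ⟩
             meets X i + b i * meets X i    ≤⟨ +-monoʳ-≤ (meets X i) (*-monoʳ-≤ (b i) (meets≤1 X i)) ⟩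
             meets X i + b i * 1            ≡⟨ cong (λ c → meets X i + b i * χ c) (sym Xw) ⟩
             meets X i + b i * χ (X w)      ≡⟨ sym θ-new ⟩
             θ y′ i X ∎ }
      ... | false with anyFin (cls X p i) in Xi
      ...   | false = at-i λ { _ refl → begin
             θ y i X                        ≡⟨ θ-pending {y} yi X ⟩
             meets X i + b i * meets X i    ≡⟨ cong (λ c → meets X i + b i * χ c) (trans Xi (sym Xw)) ⟩
             meets X i + b i * χ (X w)      ≡⟨ sym θ-new ⟩
             θ y′ i X ∎ }
      ...   | true = ≤-pred (begin
             2 + crossing E p X             ≤⟨ ≰⇒> (λ tight → true≢false (av X (X⊆U , Xi , tight)) Xw) ⟩
             ∑ (λ j → θ y j X)              ≤⟨ sum-mono pointwise ⟩
             ∑ (λ j → χ (eqb i j) + θ y′ j X) ≡⟨ trans (sum-+ (λ j → χ (eqb i j)) _) (cong (_+ ∑ (λ j → θ y′ j X))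
                 (sum-pick₁ i)) ⟩
             1 + ∑ (λ j → θ y′ j X) ∎)
        where
        pointwise : ∀ j → θ y j X ≤ χ (eqb i j) + θ y′ j X
        pointwise j = case i Fin.≟ j of λ where
          (no i≢j)   → ≤-trans (≤-reflexive (θ-other i≢j)) (m≤n+m _ _)
          (yes refl) → begin
             θ y i X                        ≡⟨ θ-pending {y} yi X ⟩
             meets X i + b i * meets X i    ≡⟨ cong (λ c → meets X i + c * meets X i) b1 ⟩
             meets X i + (meets X i + 0)    ≤⟨ +-monoʳ-≤ (meets X i) (+-monoˡ-≤ 0 (meets≤1 X i)) ⟩
             meets X i + 1                  ≡⟨ +-comm (meets X i) 1 ⟩
             1 + meets X i                  ≤⟨ s≤s (≤-trans (m≤m+n _ _) (≤-reflexive (sym θ-new))) ⟩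
             1 + θ y′ i X                   ≡⟨ cong (λ c → χ c + θ y′ i X) (sym (eqb-refl i)) ⟩
             χ (eqb i i) + θ y′ i X ∎

    b-cases : ∀ i → b i ≡ 0 ⊎ (b i ≡ 1 × ∃ λ v → cls U p i v ≡ true)
    b-cases i with anyFin (cls U p i) in eq
    ... | false = inj₁ refl
    ... | true with par (σ t (cls U p i) + (e E (cls U p i) + 1)) | par≤1 (σ t (cls U p i) + (e E (cls U p i) + 1))
    ...   | 0 | _ = inj₁ refl
    ...   | 1 | _ = inj₂ (refl , any-elim (cls U p i) eq)
    ...   | suc (suc _) | s≤s ()

    resolve-valid : ∀ {y} → Valid y → ∀ i w → (b i ≡ 1 → cls U p i w ≡ true) → Valid (resolve y i w)
    resolve-valid {y} val i w ok {j} {w′} eq bj with i Fin.≟ j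
    resolve-valid {y} val i w ok {j} {w′} refl bj | yes refl = ok bj
    ... | no i≢j = val eq bj

    resolve-all : (is : List (Fin N)) →
                  ∃ λ y → Feasible y × Valid y × (∀ {i} → i ∈ is → ∃ λ w → y i ≡ just w)
    resolve-all [] = (λ _ → nothing) , feasible₀ , (λ ()) , λ ()
    resolve-all (i ∷ is) with resolve-all is
    ... | y , feas , val , done with y i in yi
    ...   | just w = y , feas , val , λ where
              (Any.here refl) → w , yi
              (Any.there h)   → done h
    ...   | nothing = resolve y i w , feasible-resolve {y} feas yi w ok ,
            resolve-valid {y} val i w ok′ , λ where
              (Any.here refl) → w , resolve-same y i w
              (Any.there h)   → still (done h)
      where
      choice : ∃ λ w → b i ≡ 0 ⊎ (b i ≡ 1 × cls U p i w ≡ true × Avoiding y i w)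
      choice with b-cases i
      ... | inj₁ b0 = i , inj₁ b0
      ... | inj₂ (b1 , Ci) = let w , Cw , av = pick {y} feas yi b1 Ci in w , inj₂ (b1 , Cw , av)
      w = proj₁ choice
      ok = proj₂ choice
      ok′ : b i ≡ 1 → cls U p i w ≡ true
      ok′ b1 = case ok of λ where
        (inj₁ b0) → case trans (sym b1) b0 of λ ()
        (inj₂ (_ , Cw , _)) → Cw
      still : ∀ {j} → (∃ λ w → y j ≡ just w) → ∃ λ w′ → resolve y i w j ≡ just w′
      still {j} (w′ , eq) = case i Fin.≟ j of λ where
        (yes refl) → w , resolve-same y i w
        (no i≢j)   → w′ , trans (resolve-other y w i≢j) eq

    -- With all units placed, the classes together pay for the crossing edges of every nonempty set
    -- and keep one unit. This joins the charges of the classes into one of `U`.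
    charges : ∃ λ (y : Fin N → Fin N) → (∀ i → b i ≡ 1 → cls U p i (y i) ≡ true) ×
              (∀ X → X ⊆ U → ∀ {v} → X v ≡ true → 1 + crossing E p X ≤ ∑ (λ i → meets X i + b i * χ (X (y i))))
    charges with resolve-all (List.allFin N)
    ... | y , feas , val , done = (λ i → proj₁ (done (∈-allFin i))) , (λ i → val (proj₂ (done (∈-allFin i)))) ,
        λ X X⊆U Xv → ≤-trans (feas X X⊆U Xv) (≤-reflexive (sum-cong λ i → θ-resolved {y}
            (proj₂ (done (∈-allFin i))) X))

  -- The min-max theorem

  -- Everything is relative to a ground set `U`, so that the classes of a partition can be charged
  -- recursively.
  record Charge {N} (E : Edges N) (t : Fin N → ℕ) (U : VSet N) (B : ℕ) : Set where
    field
      m      : Fin N → ℕ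
      parity : ∀ v → U v ≡ true → par (m v) ≡ par (t v)
      lower  : ∀ X → X ⊆ U → ∀ {v} → X v ≡ true → e E X + 1 ≤ σ m X
      total  : σ m U ≤ B

  optimum : ∀ {N} → Edges N → (Fin N → ℕ) → VSet N → ℕ
  optimum E t U = Φ (demand E t) U (finest E t U)

  Charge-≤ : ∀ {N} {E : Edges N} {t U B B′} → B ≤ B′ → Charge E t U B → Charge E t U B′
  Charge-≤ h c = record { Charge c ; total = ≤-trans (Charge.total c) h }

  -- Each vertex receives its own demand, and the total belongs to the partition into singletons, so
  -- it is at most the optimum.
  charge-[] : ∀ {N} (t : Fin N → ℕ) U → Charge [] t U (optimum [] t U)
  charge-[] t U = record
    { m = m
    ; parity = λ v Uv → trans (par-demand [] t (cls U (λ w → w) v)) (cong par (trans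
        (sum-single _ v λ w w≢v → cong (λ c → χ c * t w) (trans (cong (U w ∧_) (≢⇒eqb w≢v)) (Bool.∧-zeroʳ (U w))))
        (trans (cong (λ c → χ c * t v) (∧-intro Uv (eqb-refl v))) (+-identityʳ _))))
    ; lower = λ X X⊆U {v} Xv → ≤-trans (positive v (X⊆U v Xv)) (≤-trans (≤-reflexive (trans (sym (+-identityʳ _))
        (cong (λ c → χ c * m v) (sym Xv))))
        (term≤sum (λ v → χ (X v) * m v) v))
    ; total = ≤-trans (sum-mono λ v → ≤-trans (*-monoˡ-≤ (m v) (χ≤1 (U v))) (≤-reflexive (+-identityʳ _)))
                      (Optimum.Φ-max [] t U canonical-id)
    }
    where
    m = λ v → demand [] t (cls U (λ w → w) v)
    positive : ∀ v → U v ≡ true → 1 ≤ m v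
    positive v Uv rewrite any-intro (cls U (λ w → w) v) v (∧-intro Uv (eqb-refl v)) = s≤s z≤n

  -- A nonempty set has demand e(X) + 1 or e(X) + 2, so a change of parity costs at most 1, and only
  -- sets containing `y` can change parity.
  demand-flip : ∀ {N} (E : Edges N) t y {c} → c ≤ 1 → ∀ X →
                demand E (λ x → t x + c * χ (eqb y x)) X ≤ demand E t X + χ (X y)
  demand-flip E t y {c} c≤1 X = begin
      demand E t⁺ X
        ≡⟨ cong (λ s → χ (anyFin X) * (e E X + 1 + par (s + (e E X + 1)))) (trans (σ-+ t _ X) (cong (σ t X +_)
            (σ-point c y X))) ⟩
      χ (anyFin X) * (e E X + 1 + par (σ t X + c * χ (X y) + (e E X + 1)))
        ≤⟨ go (true-or-false (X y)) ⟩
      demand E t X + χ (X y) ∎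
    where
    open ≤-Reasoning
    t⁺ = λ x → t x + c * χ (eqb y x)
    go : X y ≡ true ⊎ X y ≡ false →
         χ (anyFin X) * (e E X + 1 + par (σ t X + c * χ (X y) + (e E X + 1))) ≤ demand E t X + χ (X y)
    go (inj₂ Xy) = ≤-trans (≤-reflexive (cong (λ s → χ (anyFin X) * (e E X + 1 + par (s + (e E X + 1))))
      (trans (cong (λ d → σ t X + c * χ d) Xy) (trans (cong (σ t X +_) (*-zeroʳ c)) (+-identityʳ _))))) (m≤m+n _ _)
    go (inj₁ Xy) = begin
      χ (anyFin X) * (e E X + 1 + par (σ t X + c * χ (X y) + (e E X + 1)))
        ≤⟨ *-monoʳ-≤ (χ (anyFin X)) (+-monoʳ-≤ (e E X + 1) (par≤1 (σ t X + c * χ (X y) + (e E X + 1)))) ⟩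
      χ (anyFin X) * (e E X + 1 + 1)
        ≤⟨ *-monoʳ-≤ (χ (anyFin X)) (+-monoˡ-≤ 1 (m≤m+n (e E X + 1) _)) ⟩
      χ (anyFin X) * (e E X + 1 + par (σ t X + (e E X + 1)) + 1)
        ≡⟨ *-distribˡ-+ (χ (anyFin X)) (e E X + 1 + par (σ t X + (e E X + 1))) 1 ⟩
      demand E t X + χ (anyFin X) * 1
        ≡⟨ cong₂ (λ c d → demand E t X + c) (trans (*-identityʳ _) (cong χ (trans (any-intro X y Xy) (sym Xy)))) Xy ⟩
      demand E t X + χ (X y) ∎

  -- Induction on |U| + |E|: an edge is deleted when it leaves `U` or when the finest optimal
  -- partition is trivial; otherwise the recursion enters the classes, which are smaller than `U`.
  charge : ∀ {N} k (E : Edges N) t U → count U + List.length E ≤ k → Charge E t U (optimum E t U)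

  charge-class : ∀ {N} k (E E′ : Edges N) t t′ U i y {B} → let open Optimum E t U using (p; D) in
    count (cls U p i) + List.length E′ ≤ k → (∃ λ v → cls U p i v ≡ true) →
    (∀ X → demand E′ t′ X ≤ D X + χ (X y)) → demand E′ t′ (cls U p i) ≤ B → D (cls U p i) ≤ suc B →
    Charge E′ t′ (cls U p i) B
  charge-class k E E′ t t′ U i y h ne D′≤ D′C DC = Charge-≤
    (class-bound i y (demand-set E′ t′) D′≤ ne D′C DC (finest-canonical E′ t′ C))
    (charge k E′ t′ C h)
    where
    open Optimum E t U
    C = cls U p i

  charge k [] t U h = charge-[] t U
  charge zero (_ ∷ E) t U h = ⊥-elim (n≮0 (≤-trans (m≤n+m (suc (List.length E)) (count U)) h))
  charge {N} (suc k) ((u , v) ∷ E) t U h with U u ∧ U v in Uuv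
  ... | false = record
    { m = m ; parity = parity
    ; lower = λ X X⊆U Xv → ≤-trans (+-monoˡ-≤ 1 (≤-reflexive (edgeless X X⊆U))) (lower X X⊆U Xv)
    ; total = ≤-trans total (≤-trans (≤-reflexive (sum-cong λ i → cong (λ c → χ (anyFin (C i)) * (c + 1 + par
        (σ t (C i) + (c + 1))))
        (sym (edgeless (C i) λ w → proj₁ ∘ ∧-true))))
        (Optimum.Φ-max ((u , v) ∷ E) t U (finest-canonical E t U))) }
    where
    C = cls U (finest E t U)
    open Charge (charge k E t U (≤-pred (≤-trans (≤-reflexive (sym (+-suc (count U) _))) h)))
    edgeless : ∀ X → X ⊆ U → e ((u , v) ∷ E) X ≡ e E X
    edgeless X X⊆U = cong (λ c → χ c + e E X) (¬true⇒false λ r → let a , b = ∧-true r in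
      true≢false (∧-intro (X⊆U u a) (X⊆U v b)) Uuv)
  ... | true with search (λ w → U w ∧ not (eqb (Optimum.p ((u , v) ∷ E) t U u) (Optimum.p ((u , v) ∷ E) t U w)))
  -- One class: the unit at `v` is added both to `t` before the recursion and to the charge after
  -- it, so the parity at `v` changes twice and is preserved.
  ...   | inj₂ same = record
    { m = m′
    ; parity = λ w Uw → trans (par-cong-+ {m w} {1 * χ (eqb v w)} {t′ w} {1 * χ (eqb v w)}
        (parity w (trans (sym (whole w)) Uw)) refl)
                              (trans (cong par (+-assoc (t w) _ _)) (double (t w) (eqb v w)))
    ; lower = λ X X⊆U {w} Xw → begin
        χ (X u ∧ X v) + e E X + 1  ≡⟨ trans (+-assoc (χ (X u ∧ X v)) _ 1) (+-comm (χ (X u ∧ X v)) _) ⟩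
        e E X + 1 + χ (X u ∧ X v)  ≤⟨ +-mono-≤ (lower X (λ x Xx → trans (sym (whole x)) (X⊆U x Xx)) Xw)
                                         (χ-mono {X u ∧ X v} {X v} λ r → proj₂ (∧-true {X u} r)) ⟩
        σ m X + χ (X v)            ≡⟨ cong (σ m X +_) (sym (trans (σ-point 1 v X) (+-identityʳ _))) ⟩
        σ m X + σ (λ w → 1 * χ (eqb v w)) X ≡⟨ sym (σ-+ m (λ w → 1 * χ (eqb v w)) X) ⟩
        σ m′ X ∎
    ; total = begin
        σ m′ U                     ≡⟨ σ-+ m (λ w → 1 * χ (eqb v w)) U ⟩
        σ m U + σ (λ w → 1 * χ (eqb v w)) U
                                   ≡⟨ cong₂ _+_ (σ-cong m whole) (trans (σ-point 1 v U) (trans (+-identityʳ _)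
                                       (cong χ Uv))) ⟩
        σ m C + 1                  ≤⟨ +-monoˡ-≤ 1 total ⟩
        demand E t′ C + 1          ≡⟨ sym drop ⟩
        D C                        ≤⟨ term≤sum (λ i → D (cls U p i)) (p u) ⟩
        optimum ((u , v) ∷ E) t U ∎
    }
    where
    open Optimum ((u , v) ∷ E) t U
    open ≤-Reasoning
    t′ = λ w → t w + 1 * χ (eqb v w)
    C = cls U p (p u)
    Uu = proj₁ (∧-true {U u} Uuv)
    Uv = proj₂ (∧-true {U u} Uuv)
    whole : ∀ w → U w ≡ C w
    whole w with U w in Uw
    ... | false = refl
    ... | true with p u Fin.≟ p w in eq
    ...   | yes q = sym (≡⇒eqb (sym q))
    ...   | no ¬q = true≢false (∧-intro Uw (cong not (≢⇒eqb ¬q))) (same w)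
    σt′ : ∀ X → σ t′ X ≡ σ t X + χ (X v)
    σt′ X = trans (σ-+ t _ X) (cong (σ t X +_) (trans (σ-point 1 v X) (+-identityʳ _)))
    -- Deleting the edge lowers e(X) by 1 while t(X) rises by 1; the argument of `par` is unchanged,
    -- so the demand falls by exactly 1.
    both : ∀ X → X u ≡ true → X v ≡ true → D X ≡ demand E t′ X + 1
    both X Xu Xv rewrite σt′ X | Xu | Xv | any-intro X v Xv =
      trans (cong (λ c → suc (e E X + 1 + par c) + 0) (eq (σ t X) (e E X))) (eq′ (e E X)
          (par (σ t X + 1 + (e E X + 1))))
      where eq : ∀ a b → a + suc (b + 1) ≡ a + 1 + (b + 1)
            eq = solve-∀
            eq′ : ∀ a b → suc (a + 1 + b) + 0 ≡ a + 1 + b + 0 + 1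
            eq′ = solve-∀
    drop : D C ≡ demand E t′ C + 1
    drop = both C (trans (sym (whole u)) Uu) (trans (sym (whole v)) Uv)
    absent : ∀ X → X u ∧ X v ≡ false → demand E t X ≡ D X
    absent X h = cong (λ c → χ (anyFin X) * (c + 1 + par (σ t X + (c + 1)))) (cong (λ c → χ c + e E X) (sym h))
    flip≤ : ∀ X → demand E t′ X ≤ D X + χ (X v)
    flip≤ X with true-or-false (X v) | true-or-false (X u)
    ... | inj₁ Xv | inj₁ Xu = ≤-trans (≤-trans (m≤m+n _ 1) (≤-reflexive (sym (both X Xu Xv)))) (m≤m+n _ (χ (X v)))
    ... | inj₁ Xv | inj₂ Xu = ≤-trans (demand-flip E t v ≤-refl X) (≤-reflexive (cong (_+ χ (X v))
        (absent X (cong (_∧ X v) Xu))))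
    ... | inj₂ Xv | _       = ≤-trans (demand-flip E t v ≤-refl X)
      (≤-reflexive (cong (_+ χ (X v)) (absent X (trans (cong (X u ∧_) Xv) (Bool.∧-zeroʳ (X u))))))
    open Charge (charge-class k ((u , v) ∷ E) E t t′ U (p u) v
      (≤-trans (≤-reflexive (cong (_+ List.length E) (trans (count≡sum C) (trans (sum-cong λ w → cong χ
          (sym (whole w))) (sym (count≡sum U))))))
        (≤-pred (≤-trans (≤-reflexive (sym (+-suc (count U) _))) h)))
      (u , trans (sym (whole u)) Uu) flip≤ ≤-refl (≤-reflexive (trans drop (+-comm _ 1))))
    m′ = λ w → m w + 1 * χ (eqb v w)
    double : ∀ a c → par (a + (1 * χ c + 1 * χ c)) ≡ par a
    double a true  = cong par (+-comm a 2)
    double a false = cong par (+-identityʳ a)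
  -- Several classes: the unit at `y i` is reserved for the crossing edges, and the recursion inside
  -- the class needs a total of only e + 1 for the flipped parity.
  ...   | inj₁ (w , Ww) = record
    { m = m′
    ; parity = λ x Ux → trans (par-cong-+ {m (p x) x} {b (p x) * χ (eqb (y (p x)) x)} {t′ (p x) x} {b (p x) * χ
        (eqb (y (p x)) x)}
                                (parity (p x) x (∧-intro Ux (eqb-refl (p x)))) refl)
                              (trans (cong par (+-assoc (t x) _ _)) (double (t x) (b (p x) * χ (eqb (y (p x)) x))))
    ; lower = λ X X⊆U {x} Xx → begin
        e E⁺ X + 1
          ≡⟨ trans (cong (_+ 1) (e-split E⁺ p X)) (trans (+-assoc (∑ λ i → e E⁺ (cls X p i)) _ 1)
              (cong ((∑ λ i → e E⁺ (cls X p i)) +_) (+-comm (crossing E⁺ p X) 1))) ⟩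
        ∑ (λ i → e E⁺ (cls X p i)) + (1 + crossing E⁺ p X)
          ≤⟨ +-monoʳ-≤ (∑ λ i → e E⁺ (cls X p i)) (y-feasible X X⊆U Xx) ⟩
        ∑ (λ i → e E⁺ (cls X p i)) + ∑ (λ i → meets X i + b i * χ (X (y i)))
          ≡⟨ sym (sum-+ (λ i → e E⁺ (cls X p i)) _) ⟩
        ∑ (λ i → e E⁺ (cls X p i) + (meets X i + b i * χ (X (y i))))
          ≤⟨ sum-mono (λ i → lower-class i X X⊆U) ⟩
        ∑ (λ i → σ m′ (cls X p i))
          ≡⟨ sym (σ-split m′ p X) ⟩
        σ m′ X ∎
    ; total = begin
        σ m′ U                          ≡⟨ σ-split m′ p U ⟩
        ∑ (λ i → σ m′ (cls U p i))      ≤⟨ sum-mono total-class ⟩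
        ∑ (λ i → D (cls U p i))         ∎
    }
    where
    E⁺ = (u , v) ∷ E
    open Optimum E⁺ t U
    open ≤-Reasoning
    y = proj₁ charges
    y-in = proj₁ (proj₂ charges)
    y-feasible = proj₂ (proj₂ charges)
    t′ : Fin _ → Fin _ → ℕ
    t′ i x = t x + b i * χ (eqb (y i) x)
    Uu = proj₁ (∧-true {U u} Uuv)
    Uw = proj₁ (∧-true {U w} Ww)
    double : ∀ a c → par (a + (c + c)) ≡ par a
    double a zero    = cong par (+-identityʳ a)
    double a (suc c) = trans (cong par (trans (+-suc a _) (cong suc (trans (cong (a +_) (+-suc c c))
        (+-suc a (c + c)))))) (double a c)
    distinct : p u ≢ p w
    distinct q = true≢false (proj₂ (∧-true {U w} Ww)) (cong not (≡⇒eqb q))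
    smaller : ∀ i → count (cls U p i) < count U
    smaller i with p u Fin.≟ i
    ... | no ¬q    = count-mono-< {_} {cls U p i} {U} {u} (λ x → proj₁ ∘ ∧-true {U x}) Uu
        (trans (cong (U u ∧_) (≢⇒eqb ¬q)) (Bool.∧-zeroʳ (U u)))
    ... | yes refl = count-mono-< {_} {cls U p i} {U} {w} (λ x → proj₁ ∘ ∧-true {U x}) Uw
        (trans (cong (U w ∧_) (≢⇒eqb (distinct ∘ sym))) (Bool.∧-zeroʳ (U w)))
    σt′ : ∀ i X → σ (t′ i) X ≡ σ t X + b i * χ (X (y i))
    σt′ i X = trans (σ-+ t _ X) (cong (σ t X +_) (σ-point (b i) (y i) X))
    b≤1 : ∀ i → b i ≤ 1
    b≤1 i with b-cases i
    ... | inj₁ q = subst (_≤ 1) (sym q) z≤n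
    ... | inj₂ (q , _) = ≤-reflexive q
    flip≤ : ∀ i X → demand E⁺ (t′ i) X ≤ D X + χ (X (y i))
    flip≤ i = demand-flip E⁺ t (y i) (b≤1 i)
    -- The parity is flipped exactly in the classes of excess 1, so afterwards no class needs a
    -- correction.
    flipped : ∀ i → demand E⁺ (t′ i) (cls U p i) ≤ e E⁺ (cls U p i) + meets U i
    flipped i = begin
        demand E⁺ (t′ i) (cls U p i)
          ≡⟨ demand-split E⁺ (t′ i) (cls U p i) ⟩
        e E⁺ (cls U p i) + meets U i + excess E⁺ (t′ i) (cls U p i)
          ≡⟨ cong (e E⁺ (cls U p i) + meets U i +_) even ⟩
        e E⁺ (cls U p i) + meets U i + 0
          ≡⟨ +-identityʳ _ ⟩
        e E⁺ (cls U p i) + meets U i ∎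
      where
      even : excess E⁺ (t′ i) (cls U p i) ≡ 0
      even with b-cases i
      ... | inj₁ q = trans (cong (λ c → meets U i * par (c + (e E⁺ (cls U p i) + 1)))
                       (trans (σt′ i (cls U p i)) (trans (cong (λ c → σ t (cls U p i) + c * χ (cls U p i (y i)))
                           q) (+-identityʳ _)))) q
      ... | inj₂ (q , _) = trans
            (cong₂ (λ a c → χ a * par (c + (e E⁺ (cls U p i) + 1))) full
               (trans (σt′ i (cls U p i)) (cong₂ (λ a c → σ t (cls U p i) + a * χ c) q (y-in i q))))
            (trans (+-identityʳ _) (odd (σ t (cls U p i)) (e E⁺ (cls U p i) + 1)
              (trans (sym (+-identityʳ _)) (trans (cong (λ a → χ a * par (σ t (cls U p i) + (e E⁺ (cls U p i) +
                  1))) (sym full)) q))))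
        where
        full : anyFin (cls U p i) ≡ true
        full = any-intro (cls U p i) (y i) (y-in i q)
        odd : ∀ a c → par (a + c) ≡ 1 → par (a + 1 + c) ≡ 0
        odd a c h = trans (cong par (trans (cong (_+ c) (+-comm a 1)) refl)) (trans (sym (par-suc (a + c)))
            (cong (par ∘ suc) h))
    class-charge : ∀ i → Charge E⁺ (t′ i) (cls U p i) (e E⁺ (cls U p i) + meets U i)
    class-charge i with true-or-false (anyFin (cls U p i))
    ... | inj₁ q = charge-class k E⁺ E⁺ t (t′ i) U i (y i)
          (≤-pred (≤-trans (+-monoˡ-≤ (List.length E⁺) (smaller i)) h))
          (any-elim (cls U p i) q) (flip≤ i) (flipped i)
          (≤-trans (≤-reflexive (demand-split E⁺ t (cls U p i))) (≤-trans (+-monoʳ-≤ _ (b≤1 i)) (≤-reflexive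
              (+-comm _ 1))))
    ... | inj₂ q = record
          { m = t′ i
          ; parity = λ _ _ → refl
          ; lower = λ X X⊆ {x} Xx → true≢false (X⊆ x Xx) (any-none (cls U p i) q x)
          ; total = ≤-trans (≤-reflexive (sum-0 λ x → cong (λ c → χ c * t′ i x) (any-none (cls U p i) q x))) z≤n }
    module C i = Charge (class-charge i)
    open C
    m′ = λ x → m (p x) x + b (p x) * χ (eqb (y (p x)) x)
    σm′ : ∀ i X → σ m′ (cls X p i) ≡ σ (m i) (cls X p i) + b i * χ (cls X p i (y i))
    σm′ i X = trans (sum-cong pointwise) (trans (σ-+ (m i) _ (cls X p i)) (cong (σ (m i) (cls X p i) +_)
        (σ-point (b i) (y i) (cls X p i))))
      where
      pointwise : ∀ x → χ (cls X p i x) * m′ x ≡ χ (cls X p i x) * (m i x + b i * χ (eqb (y i) x))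
      pointwise x with true-or-false (cls X p i x)
      ... | inj₂ q rewrite q = refl
      ... | inj₁ q rewrite proj₂ (cls-true X p q) = refl
    lower-class : ∀ i X → X ⊆ U → e E⁺ (cls X p i) + (meets X i + b i * χ (X (y i))) ≤ σ m′ (cls X p i)
    lower-class i X X⊆U = begin
        e E⁺ (cls X p i) + (meets X i + b i * χ (X (y i)))
          ≡⟨ sym (+-assoc (e E⁺ (cls X p i)) _ _) ⟩
        e E⁺ (cls X p i) + meets X i + b i * χ (X (y i))
          ≤⟨ +-mono-≤ base-part (≤-reflexive extra) ⟩
        σ (m i) (cls X p i) + b i * χ (cls X p i (y i))
          ≡⟨ sym (σm′ i X) ⟩
        σ m′ (cls X p i) ∎
      where
      base-part : e E⁺ (cls X p i) + meets X i ≤ σ (m i) (cls X p i)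
      base-part with true-or-false (anyFin (cls X p i))
      ... | inj₁ q = ≤-trans (≤-reflexive (cong (λ c → e E⁺ (cls X p i) + χ c) q))
            (lower i (cls X p i) (λ x r → let r₁ , r₂ = ∧-true {X x} r in ∧-intro (X⊆U x r₁) r₂) (proj₂ (any-elim (cls X p i) q)))
      ... | inj₂ q = ≤-trans (≤-reflexive (cong₂ (λ c d → c + χ d) (e-empty E⁺ (any-none (cls X p i) q)) q)) z≤n
      extra : b i * χ (X (y i)) ≡ b i * χ (cls X p i (y i))
      extra with b-cases i
      ... | inj₁ q = trans (cong (_* χ (X (y i))) q) (sym (cong (_* χ (cls X p i (y i))) q))
      ... | inj₂ (q , _) = cong (λ c → b i * χ c) (sym (trans (cong (X (y i) ∧_)
            (≡⇒eqb (proj₂ (cls-true U p (y-in i q))))) (Bool.∧-identityʳ _)))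
    total-class : ∀ i → σ m′ (cls U p i) ≤ D (cls U p i)
    total-class i = begin
        σ m′ (cls U p i)                                    ≡⟨ σm′ i U ⟩
        σ (m i) (cls U p i) + b i * χ (cls U p i (y i))     ≤⟨ +-mono-≤ (total i) (≤-trans (*-monoʳ-≤ (b i)
            (χ≤1 (cls U p i (y i)))) (≤-reflexive (*-identityʳ _))) ⟩
        e E⁺ (cls U p i) + meets U i + b i                  ≡⟨ sym (demand-split E⁺ t (cls U p i)) ⟩
        D (cls U p i)                                       ∎

  -- Feedback vertex sets

  full : ∀ {N} → VSet N
  full _ = true

  ascending : (G : Graph) → V G → V G → Bool
  ascending G u v = adj G u v ∧ (suc (toℕ u) ≤ᵇ toℕ v)

  opaque
    edgesOf : (G : Graph) → Edges (n G)
    edgesOf G = List.concat (List.tabulate λ u → List.concat (List.tabulate λ v →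
      if ascending G u v then (u , v) ∷ [] else []))

  e-++ : ∀ {N} (E F : Edges N) X → e (E ++ F) X ≡ e E X + e F X
  e-++ []            F X = refl
  e-++ ((u , v) ∷ E) F X = trans (cong (χ (X u ∧ X v) +_) (e-++ E F X)) (sym (+-assoc (χ (X u ∧ X v)) _ _))

  e-concat : ∀ {N k} (f : Fin k → Edges N) X → e (List.concat (List.tabulate f)) X ≡ ∑ (λ i → e (f i) X)
  e-concat f X = trans (go f) (sym (∑-def λ i → e (f i) X))
    where
    go : ∀ {k} (f : Fin k → Edges _) → e (List.concat (List.tabulate f)) X ≡ sumFin (λ i → e (f i) X)
    go {zero}  f = refl
    go {suc k} f = trans (e-++ (f fz) _ X) (cong (e (f fz) X +_) (go (f ∘ fs)))

  opaque
    unfolding edgesOf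

    e-edgesOf : ∀ G X → e (edgesOf G) X ≡ ∑ λ u → ∑ λ v → χ (ascending G u v ∧ (X u ∧ X v))
    e-edgesOf G X = trans (e-concat _ X) (sum-cong λ u → trans (e-concat _ X) (sum-cong λ v → at u v))
      where
      at : ∀ u v → e (if ascending G u v then (u , v) ∷ [] else []) X ≡ χ (ascending G u v ∧ (X u ∧ X v))
      at u v with ascending G u v
      ... | true  = +-identityʳ _
      ... | false = refl

  size : Graph → ℕ
  size G = e (edgesOf G) full

  size≡numEdges : ∀ G → size G ≡ numEdges G
  size≡numEdges G = trans (e-edgesOf G full) (trans
    (sum-cong λ u → trans (sum-cong λ v → cong χ (Bool.∧-identityʳ (ascending G u v)))
        (sym (count≡sum (ascending G u))))
    (∑-def _))

  degIn : (G : Graph) → VSet (n G) → V G → ℕ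
  degIn G X u = ∑ λ v → χ (adj G u v ∧ X v)

  <⇒≡true : ∀ {a b} → a < b → (suc a ≤ᵇ b) ≡ true
  <⇒≡true h = T⇒≡ (≤⇒≤ᵇ h)

  ≮⇒≡false : ∀ {a b} → ¬ a < b → (suc a ≤ᵇ b) ≡ false
  ≮⇒≡false {a} h = ¬true⇒false λ q → h (≤ᵇ⇒≤ (suc a) _ (≡⇒T q))

  adj-ascending : ∀ G u v → χ (adj G u v) ≡ χ (ascending G u v) + χ (ascending G v u)
  adj-ascending G u v rewrite adj-sym G v u with <-cmp (toℕ u) (toℕ v)
  ... | tri< a _ b rewrite <⇒≡true a | ≮⇒≡false b with adj G u v
  ...   | true  = refl
  ...   | false = refl
  adj-ascending G u v | tri> b _ a rewrite <⇒≡true a | ≮⇒≡false b with adj G u v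
  ...   | true  = refl
  ...   | false = refl
  adj-ascending G u v | tri≈ _ q _ with Fin.toℕ-injective q
  ... | refl rewrite adj-irr G u = refl

  handshake : ∀ G X → σ (degIn G X) X ≡ 2 * e (edgesOf G) X
  handshake G X = begin
      ∑ (λ u → χ (X u) * ∑ λ v → χ (adj G u v ∧ X v))
        ≡⟨ sum-cong (λ u → sym (sum-* (χ (X u)) _)) ⟩
      ∑ (λ u → ∑ λ v → χ (X u) * χ (adj G u v ∧ X v))
        ≡⟨ sum-cong (λ u → trans (sum-cong λ v → at u v) (sum-+ (λ v → χ (ascending G u v ∧ (X u ∧ X v))) _)) ⟩
      ∑ (λ u → ∑ (λ v → χ (ascending G u v ∧ (X u ∧ X v))) + ∑ (λ v → χ (ascending G v u ∧ (X v ∧ X u))))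
        ≡⟨ sum-+ (λ u → ∑ λ v → χ (ascending G u v ∧ (X u ∧ X v))) _ ⟩
      half + ∑ (λ u → ∑ λ v → χ (ascending G v u ∧ (X v ∧ X u)))
        ≡⟨ cong (half +_) (sum-swap (λ u v → χ (ascending G v u ∧ (X v ∧ X u)))) ⟩
      half + half
        ≡⟨ cong (half +_) (sym (+-identityʳ half)) ⟩
      2 * half
        ≡⟨ cong (2 *_) (sym (e-edgesOf G X)) ⟩
      2 * e (edgesOf G) X ∎
    where
    open ≡-Reasoning
    half = ∑ λ u → ∑ λ v → χ (ascending G u v ∧ (X u ∧ X v))
    at : ∀ u v → χ (X u) * χ (adj G u v ∧ X v) ≡
                 χ (ascending G u v ∧ (X u ∧ X v)) + χ (ascending G v u ∧ (X v ∧ X u))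
    at u v = begin
        χ (X u) * χ (adj G u v ∧ X v)
          ≡⟨ cong (χ (X u) *_) (trans (χ-∧ (adj G u v) (X v)) (cong (_* χ (X v)) (adj-ascending G u v))) ⟩
        χ (X u) * ((χ (ascending G u v) + χ (ascending G v u)) * χ (X v))
          ≡⟨ eq (χ (X u)) (χ (ascending G u v)) (χ (ascending G v u)) (χ (X v)) ⟩
        χ (ascending G u v) * (χ (X u) * χ (X v)) + χ (ascending G v u) * (χ (X v) * χ (X u))
          ≡⟨ sym (cong₂ _+_ (trans (χ-∧ (ascending G u v) _) (cong (χ (ascending G u v) *_) (χ-∧ (X u) (X v))))
                            (trans (χ-∧ (ascending G v u) _) (cong (χ (ascending G v u) *_) (χ-∧ (X v) (X u))))) ⟩
        χ (ascending G u v ∧ (X u ∧ X v)) + χ (ascending G v u ∧ (X v ∧ X u)) ∎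
      where eq : ∀ x a b y → x * ((a + b) * y) ≡ a * (x * y) + b * (y * x)
            eq = solve-∀

  adj⇒≢ : ∀ G {x y} → adj G x y ≡ true → x ≢ y
  adj⇒≢ G {x} h refl = true≢false h (adj-irr G x)

  adj-flip : ∀ G {x y} → adj G x y ≡ true → adj G y x ≡ true
  adj-flip G {x} {y} h = trans (adj-sym G y x) h

  module _ (G : Graph) where
    path-prev : ∀ y ys {v zs} → Path G (y ∷ ys ++ v ∷ zs) → ∃ λ a → a ∈ y ∷ ys × adj G v a ≡ true
    path-prev y []        {v} (h , _) = y , here refl , trans (adj-sym G v y) (T⇒≡ h)
    path-prev y (y′ ∷ ys) (_ , h) = let a , a∈ , q = path-prev y′ ys h in a , there a∈ , q

    path-next : ∀ ys {v z zs} → Path G (ys ++ v ∷ z ∷ zs) → adj G v z ≡ true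
    path-next []            (h , _) = T⇒≡ h
    path-next (y ∷ [])      (_ , h) = path-next [] h
    path-next (y ∷ y′ ∷ ys) (_ , h) = path-next (y′ ∷ ys) h

    unique-++ : ∀ ys {zs} {a b : V G} → Unique (ys ++ zs) → a ∈ ys → b ∈ zs → a ≢ b
    unique-++ (y ∷ ys) (y∉ ∷ _) (here refl) b∈ = All.lookup y∉ (∈-++⁺ʳ ys b∈)
    unique-++ (y ∷ ys) (_ ∷ u)  (there a∈)  b∈ = unique-++ ys u a∈ b∈

    -- The head and the last entry of the list are separate cases, since one of their neighbours is
    -- reached through the closing edge.
    cycle-neighbours : ∀ {c} → IsCycle G c → ∀ {v} → v ∈ c →
      ∃ λ a → ∃ λ b → a ≢ b × (a ∈ c × adj G v a ≡ true) × (b ∈ c × adj G v b ≡ true)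
    cycle-neighbours {x ∷ y ∷ z ∷ ys} (_ , _ ∷ (y∉ ∷ _) , xy , _ , path) (here refl) =
      let a , a∈ , q = path-prev z ys path in
      y , a , All.lookup y∉ a∈ , (there (here refl) , T⇒≡ xy) , (there (there a∈) , q)
    cycle-neighbours {x ∷ []}     (() , _)
    cycle-neighbours {x ∷ y ∷ []} (s≤s () , _)
    cycle-neighbours {x ∷ xs@(_ ∷ _ ∷ _)} (len , uniq , path) {v} (there v∈) with ∈-∃++ v∈
    ... | as , b ∷ bs , eq =
      let path′ = subst (λ l → Path G (x ∷ l)) (trans (cong (_++ x ∷ []) eq) (List.++-assoc as (v ∷ b ∷ bs) (x ∷ []))) path
          uniq′ = subst (λ l → Unique (x ∷ l)) eq uniq
          a , a∈ , q = path-prev x as path′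
      in a , b , unique-++ (x ∷ as) uniq′ a∈ (there (here refl)) ,
         (subst (λ l → a ∈ x ∷ l) (sym eq) (∈-++⁺ˡ a∈) , q) ,
         (subst (λ l → b ∈ x ∷ l) (sym eq) (there (∈-++⁺ʳ as (there (here refl)))) , path-next (x ∷ as) path′)
    ... | [] , [] , ()
    ... | a₀ ∷ as , [] , eq =
      let path′ = subst (λ l → Path G (x ∷ l)) (trans (cong (_++ x ∷ []) eq) (List.++-assoc (a₀ ∷ as) (v ∷ []) (x ∷ []))) path
          uniq′ = subst (λ l → Unique (x ∷ l)) eq uniq
          a , a∈ , q = path-prev a₀ as (proj₂ path′)
      in a , x , (λ r → head-∉ uniq′ (∈-++⁺ˡ (subst (_∈ a₀ ∷ as) r a∈))) ,
         (subst (λ l → a ∈ x ∷ l) (sym eq) (there (∈-++⁺ˡ a∈)) , q) , (here refl , path-next (x ∷ a₀ ∷ as) path′)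
      where
      head-∉ : ∀ {x : V G} {l} → Unique (x ∷ l) → ¬ (x ∈ l)
      head-∉ (x∉ ∷ _) x∈ = All.lookup x∉ x∈ refl

    open import Data.List.Membership.DecPropositional (Fin._≟_ {n G}) using (_∈?_)

    degIn≥2 : ∀ {X u a b} → a ≢ b → adj G u a ≡ true → X a ≡ true → adj G u b ≡ true → X b ≡ true → 2 ≤ degIn G X u
    degIn≥2 {X} {u} a≢b ua Xa ub Xb = subst (_≤ degIn G X u)
      (cong₂ (λ c d → χ c + χ d) (∧-intro ua Xa) (∧-intro ub Xb)) (two-terms≤sum (λ v → χ (adj G u v ∧ X v)) a≢b)

    ∈-tabulate : ∀ {N} {f : VSet N} {v} → f v ≡ true → v Sub.∈ Vec.tabulate f
    ∈-tabulate {f = f} {v} h = Vec.lookup⇒[]= v (Vec.tabulate f) (trans (Vec.lookup∘tabulate f v) h)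

    -- If all vertices of a cycle had weight 1, its vertex set X would satisfy m(X) = |X|; but every
    -- vertex of X has two neighbours in X, so |X| ≤ e(X) < m(X).
    heavy-isFVS : ∀ {B} (c : Charge (edgesOf G) (λ _ → 1) full B) →
                  IsFVS G (Vec.tabulate λ v → 2 ≤ᵇ Charge.m c v)
    heavy-isFVS ch c cyc with Any.any? (λ x → x Sub.∈? Vec.tabulate λ v → 2 ≤ᵇ Charge.m ch v) c
    ... | yes h = h
    ... | no none = ⊥-elim (<-irrefl refl (begin-strict
        2 * σ m X                      ≡⟨ cong (2 *_) (sum-cong light) ⟩
        2 * ∑ (χ ∘ X)                  ≡⟨ sym (sum-* 2 (χ ∘ X)) ⟩
        ∑ (λ v → 2 * χ (X v))          ≤⟨ sum-mono degree≥2 ⟩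
        σ (degIn G X) X                ≡⟨ handshake G X ⟩
        2 * e (edgesOf G) X            <⟨ *-monoʳ-< 2 (≤-trans (≤-reflexive (+-comm 1 _)) (lower X (λ _ _ → refl)
            (proj₂ inhabited))) ⟩
        2 * σ m X                      ∎))
      where
      open ≤-Reasoning
      open Charge ch
      X : VSet (n G)
      X v = ⌊ v ∈? c ⌋
      X⇒∈ : ∀ {v} → X v ≡ true → v ∈ c
      X⇒∈ {v} h with v ∈? c
      ... | yes p = p
      ∈⇒X : ∀ {v} → v ∈ c → X v ≡ true
      ∈⇒X {v} h with v ∈? c
      ... | yes p = refl
      ... | no ¬p = ⊥-elim (¬p h)
      inhabited : ∃ λ v → X v ≡ true
      inhabited = let x , x∈ = head-∈ c cyc in x , ∈⇒X x∈
        where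
        head-∈ : ∀ l → IsCycle G l → ∃ (_∈ l)
        head-∈ (x ∷ _) _ = x , here refl
      one : ∀ k → par k ≡ 1 → (2 ≤ᵇ k) ≢ true → k ≡ 1
      one 1 _ _ = refl
      one (suc (suc k)) _ h = ⊥-elim (h refl)
      light : ∀ v → χ (X v) * m v ≡ χ (X v)
      light v with true-or-false (X v)
      ... | inj₂ q rewrite q = refl
      ... | inj₁ q = trans (cong (χ (X v) *_) (one (m v) (parity v refl) λ h → none
              (Any.map (λ { refl → ∈-tabulate h }) (X⇒∈ q)))) (*-identityʳ _)
      degree≥2 : ∀ v → 2 * χ (X v) ≤ χ (X v) * degIn G X v
      degree≥2 v with true-or-false (X v)
      ... | inj₂ q rewrite q = z≤n
      ... | inj₁ q with cycle-neighbours cyc (X⇒∈ q)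
      ...   | a , b , a≢b , (a∈ , va) , (b∈ , vb) = subst₂ _≤_
              (cong (λ c → 2 * χ c) (sym q)) (trans (sym (+-identityʳ _)) (cong (λ c → χ c * degIn G X v) (sym q)))
              (degIn≥2 {X} a≢b va (∈⇒X a∈) vb (∈⇒X b∈))

    -- An odd weight other than 1 is at least 3, so each vertex of the feedback vertex set
    -- contributes two units beyond the 1 that every vertex has.
    FVS-bound : ∀ {k} → IsPhi G k → 2 * k + n G ≤ optimum (edgesOf G) (λ _ → 1) full
    FVS-bound {k} (_ , minimal) = begin
        2 * k + n G                    ≤⟨ +-monoˡ-≤ (n G) (*-monoʳ-≤ 2 (minimal S (heavy-isFVS ch))) ⟩
        2 * Sub.∣ S ∣ + n G            ≡⟨ cong (λ c → 2 * c + n G) (∣tabulate∣ (λ v → 2 ≤ᵇ m v)) ⟩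
        2 * ∑ (λ v → χ (2 ≤ᵇ m v)) + n G
          ≡⟨ cong₂ _+_ (sym (sum-* 2 (λ v → χ (2 ≤ᵇ m v)))) (sym (trans (sum-const 1) (*-identityʳ (n G)))) ⟩
        ∑ (λ v → 2 * χ (2 ≤ᵇ m v)) + ∑ (λ _ → 1)
          ≡⟨ sym (sum-+ (λ v → 2 * χ (2 ≤ᵇ m v)) _) ⟩
        ∑ (λ v → 2 * χ (2 ≤ᵇ m v) + 1) ≤⟨ sum-mono (λ v → ≤-trans (three (m v) (parity v refl)) (≤-reflexive
            (sym (+-identityʳ (m v))))) ⟩
        σ m full                       ≤⟨ total ⟩
        optimum (edgesOf G) (λ _ → 1) full ∎
      where
      open ≤-Reasoning
      ch : Charge (edgesOf G) (λ _ → 1) full (optimum (edgesOf G) (λ _ → 1) full)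
      ch = charge _ (edgesOf G) (λ _ → 1) full ≤-refl
      open Charge ch
      S = Vec.tabulate λ v → 2 ≤ᵇ m v
      three : ∀ k → par k ≡ 1 → 2 * χ (2 ≤ᵇ k) + 1 ≤ k
      three 1 _ = ≤-refl
      three (suc (suc (suc k))) _ = s≤s (s≤s (s≤s z≤n))
      ∣tabulate∣ : ∀ {N} (f : VSet N) → Sub.∣ Vec.tabulate f ∣ ≡ ∑ (χ ∘ f)
      ∣tabulate∣ f = trans (go f) (count≡sum f)
        where
        go : ∀ {N} (f : VSet N) → Sub.∣ Vec.tabulate f ∣ ≡ count f
        go {zero}  f = refl
        go {suc N} f with f fz
        ... | true  = cong suc (go (f ∘ fs))
        ... | false = go (f ∘ fs)

  -- Cuts and connectivity

  ∁ : ∀ {N} → VSet N → VSet N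
  ∁ Y v = not (Y v)

  _∖_ : ∀ {N} → VSet N → VSet N → VSet N
  X ∖ Y = X ∩ ∁ Y

  -- Counts ordered pairs, so `cut G X X` is twice the number of edges inside X.
  cut : (G : Graph) → VSet (n G) → VSet (n G) → ℕ
  cut G A B = ∑ λ u → χ (A u) * ∑ λ v → χ (B v) * χ (adj G u v)

  cut-degIn : ∀ G A B → cut G A B ≡ σ (degIn G B) A
  cut-degIn G A B = sum-cong λ u → cong (χ (A u) *_) (sum-cong λ v →
    trans (*-comm (χ (B v)) _) (sym (χ-∧ (adj G u v) (B v))))

  cut-sym : ∀ G A B → cut G A B ≡ cut G B A
  cut-sym G A B = begin
      ∑ (λ u → χ (A u) * ∑ λ v → χ (B v) * χ (adj G u v))
        ≡⟨ sum-cong (λ u → sym (sum-* (χ (A u)) _)) ⟩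
      ∑ (λ u → ∑ λ v → χ (A u) * (χ (B v) * χ (adj G u v)))
        ≡⟨ sum-swap (λ u v → χ (A u) * (χ (B v) * χ (adj G u v))) ⟩
      ∑ (λ v → ∑ λ u → χ (A u) * (χ (B v) * χ (adj G u v)))
        ≡⟨ sum-cong (λ v → trans (sum-cong λ u → trans (eq (χ (A u)) (χ (B v)) _)
             (cong (λ b → χ (B v) * (χ (A u) * χ b)) (adj-sym G u v))) (sum-* (χ (B v)) _)) ⟩
      ∑ (λ v → χ (B v) * ∑ λ u → χ (A u) * χ (adj G v u)) ∎
    where
    open ≡-Reasoning
    eq : ∀ a b c → a * (b * c) ≡ b * (a * c)
    eq = solve-∀

  cut-cong : ∀ G {A A′ B B′} → A ≐ A′ → B ≐ B′ → cut G A B ≡ cut G A′ B′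
  cut-cong G h k = sum-cong λ u → cong₂ (λ a s → χ a * s) (h u) (sum-cong λ v → cong (λ b → χ b * χ (adj G u v))
      (k v))

  χ-split : ∀ a b → χ a ≡ χ (a ∧ b) + χ (a ∧ not b)
  χ-split true  true  = refl
  χ-split true  false = refl
  χ-split false b     = refl

  σ-∖ : ∀ {N} (m : Fin N → ℕ) X Y → σ m X ≡ σ m (X ∩ Y) + σ m (X ∖ Y)
  σ-∖ m X Y = trans (sum-cong λ v → trans (cong (_* m v) (χ-split (X v) (Y v))) (*-distribʳ-+ (m v)
      (χ (X v ∧ Y v)) _))
                    (sum-+ (λ v → χ (X v ∧ Y v) * m v) _)

  cut-∖ˡ : ∀ G X Y B → cut G X B ≡ cut G (X ∩ Y) B + cut G (X ∖ Y) B
  cut-∖ˡ G X Y B = σ-∖ (λ u → ∑ λ v → χ (B v) * χ (adj G u v)) X Y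

  cut-∖ʳ : ∀ G A X Y → cut G A X ≡ cut G A (X ∩ Y) + cut G A (X ∖ Y)
  cut-∖ʳ G A X Y = trans (cut-sym G A X) (trans (cut-∖ˡ G X Y A) (cong₂ _+_ (cut-sym G (X ∩ Y) A)
      (cut-sym G (X ∖ Y) A)))

  2e : ∀ G X → cut G X X ≡ 2 * e (edgesOf G) X
  2e G X = trans (cut-degIn G X X) (handshake G X)

  e-cut : ∀ G X Y → e (edgesOf G) X ≡ e (edgesOf G) (X ∩ Y) + e (edgesOf G) (X ∖ Y) + cut G (X ∩ Y) (X ∖ Y)
  e-cut G X Y = *-cancelˡ-≡ _ _ 2 (begin
      2 * e (edgesOf G) X
        ≡⟨ sym (2e G X) ⟩
      cut G X X
        ≡⟨ trans (cut-∖ˡ G X Y X) (cong₂ _+_ (cut-∖ʳ G (X ∩ Y) X Y) (cut-∖ʳ G (X ∖ Y) X Y)) ⟩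
      cut G (X ∩ Y) (X ∩ Y) + c + (cut G (X ∖ Y) (X ∩ Y) + cut G (X ∖ Y) (X ∖ Y))
        ≡⟨ cong₂ (λ a b → a + c + b) (2e G (X ∩ Y)) (cong₂ _+_ (cut-sym G (X ∖ Y) (X ∩ Y)) (2e G (X ∖ Y))) ⟩
      2 * a + c + (c + 2 * b)
        ≡⟨ eq a b c ⟩
      2 * (a + b + c) ∎)
    where
    open ≡-Reasoning
    a = e (edgesOf G) (X ∩ Y)
    b = e (edgesOf G) (X ∖ Y)
    c = cut G (X ∩ Y) (X ∖ Y)
    eq : ∀ a b c → 2 * a + c + (c + 2 * b) ≡ 2 * (a + b + c)
    eq = solve-∀

  -- 2-edge-connectedness of the subgraph induced by X, in terms of cuts; it holds vacuously for a
  -- single vertex.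
  TwoEdge : (G : Graph) → VSet (n G) → Set
  TwoEdge G X = ∀ Y {v w} → X v ≡ true → X w ≡ true → Y v ≡ true → Y w ≡ false → 2 ≤ cut G (X ∩ Y) (X ∖ Y)

  demand≥ : ∀ {N} (E : Edges N) t X {v} → X v ≡ true → e E X + 1 ≤ demand E t X
  demand≥ E t X {v} Xv = ≤-trans (≤-reflexive (cong (λ c → e E X + χ c) (sym (any-intro X v Xv))))
    (≤-trans (m≤m+n _ _) (≤-reflexive (sym (demand-split E t X))))

  demand≤ : ∀ {N} (E : Edges N) t X → demand E t X ≤ e E X + 2
  demand≤ E t X with anyFin X
  ... | true  = ≤-trans (≤-reflexive (+-identityʳ _))
      (≤-trans (+-monoʳ-≤ (e E X + 1) (par≤1 (σ t X + (e E X + 1)))) (≤-reflexive (+-assoc (e E X) 1 1)))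
  ... | false = z≤n

  -- Splitting a class C into A and B loses at least 2, whereas nonempty sets have demand between e
  -- + 1 and e + 2. So e(A) + e(B) + 4 ≤ e(C) + 2, which leaves two edges between A and B.
  class-TwoEdge : ∀ G t U i → TwoEdge G (cls U (Optimum.p (edgesOf G) t U) i)
  class-TwoEdge G t U i Y {v} {w} Cv Cw Yv Yw = +-cancelˡ-≤ (e E A + e E B) _ _ (+-cancelʳ-≤ 2 _ _ (begin
      e E A + e E B + 2 + 2           ≡⟨ eq (e E A) (e E B) ⟩
      2 + (e E A + 1 + (e E B + 1))   ≤⟨ +-monoʳ-≤ 2 (+-mono-≤ (demand≥ E t A (∧-intro Cv Yv)) (demand≥ E t B
          (∧-intro Cw (cong not Yw)))) ⟩
      2 + (D A + D B)                 ≡⟨ cong (2 +_) (sym (cong₂ _+_ (D-ext classA) (D-ext classB))) ⟩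
      2 + (D (cls C q v) + D (cls C q w)) ≤⟨ +-monoʳ-≤ 2 (two-terms≤sum (λ j → D (cls C q j)) v≢w) ⟩
      2 + Φ D C q                     ≤⟨ refine-strict i canq Cv Cw (λ r → v≢w (trans (sym qv) (trans r qw))) ⟩
      D C                             ≤⟨ demand≤ E t C ⟩
      e E C + 2                       ≡⟨ cong (_+ 2) (e-cut G C Y) ⟩
      e E A + e E B + cut G A B + 2   ∎))
    where
    E = edgesOf G
    open Optimum E t U
    open ≤-Reasoning
    C = cls U p i
    A = C ∩ Y
    B = C ∖ Y
    D-ext : ∀ {X X′} → X ≐ X′ → D X ≡ D X′
    D-ext = SetFunction.ext (demand-set E t)
    eq : ∀ a b → a + b + 2 + 2 ≡ 2 + (a + 1 + (b + 1))
    eq = solve-∀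
    q : Fin _ → Fin _
    q x = if Y x then v else w
    v≢w : v ≢ w
    v≢w refl = true≢false Yv Yw
    qv : q v ≡ v
    qv = cong (λ c → if c then v else w) Yv
    qw : q w ≡ w
    qw = cong (λ c → if c then v else w) Yw
    canq : Canonical C q
    canq x _ with Y x
    ... | true  = Cv , qv
    ... | false = Cw , qw
    classA : cls C q v ≐ A
    classA x with Y x
    ... | true  = cong (C x ∧_) (eqb-refl v)
    ... | false = cong (C x ∧_) (≢⇒eqb (v≢w ∘ sym))
    classB : cls C q w ≐ B
    classB x with Y x
    ... | true  = cong (C x ∧_) (≢⇒eqb v≢w)
    ... | false = cong (C x ∧_) (eqb-refl w)

  cut-edge : ∀ G {A B : VSet (n G)} {a b} → A a ≡ true → B b ≡ true → adj G a b ≡ true →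
             1 ≤ χ (A a) * ∑ λ v → χ (B v) * χ (adj G a v)
  cut-edge G {A} {B} {a} {b} Aa Bb ab = begin
      1                                     ≡⟨ sym (cong₂ (λ c d → χ c * χ d) Bb ab) ⟩
      χ (B b) * χ (adj G a b)               ≤⟨ term≤sum (λ v → χ (B v) * χ (adj G a v)) b ⟩
      ∑ (λ v → χ (B v) * χ (adj G a v))     ≡⟨ trans (sym (+-identityʳ _)) (cong (λ c → χ c * ∑ λ v → χ (B v) * χ
          (adj G a v)) (sym Aa)) ⟩
      χ (A a) * ∑ (λ v → χ (B v) * χ (adj G a v)) ∎
    where open ≤-Reasoning

  cut≥1 : ∀ G {A B : VSet (n G)} {a b} → A a ≡ true → B b ≡ true → adj G a b ≡ true → 1 ≤ cut G A B
  cut≥1 G {A} {B} {a} Aa Bb ab = ≤-trans (cut-edge G {A} {B} Aa Bb ab)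
    (term≤sum (λ u → χ (A u) * ∑ λ v → χ (B v) * χ (adj G u v)) a)

  cut≥2 : ∀ G {A B : VSet (n G)} {a b a′ b′} → a ≢ a′ → A a ≡ true → B b ≡ true → adj G a b ≡ true →
          A a′ ≡ true → B b′ ≡ true → adj G a′ b′ ≡ true → 2 ≤ cut G A B
  cut≥2 G {A} {B} {a} {b} {a′} a≢a′ Aa Bb ab Aa′ Bb′ ab′ = ≤-trans
    (+-mono-≤ (cut-edge G {A} {B} {a} Aa Bb ab) (cut-edge G {A} {B} {a′} Aa′ Bb′ ab′))
    (two-terms≤sum (λ u → χ (A u) * ∑ λ v → χ (B v) * χ (adj G u v)) a≢a′)

  walk-crosses : ∀ {G P} {u v : V G} → WalkIn G P u v → ∀ (Y : VSet (n G)) → Y u ≡ true → Y v ≡ false →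
    ∃ λ a → ∃ λ b → (P a × Y a ≡ true) × (P b × Y b ≡ false) × adj G a b ≡ true
  walk-crosses (here _) Y Yu Yv = true≢false Yu Yv
  walk-crosses (step {u = u} {w = w} Pu uw r) Y Yu Yv with true-or-false (Y w)
  ... | inj₁ Yw = walk-crosses r Y Yw Yv
  ... | inj₂ Yw = u , w , (Pu , Yu) , (source r , Yw) , T⇒≡ uw
    where
    source : ∀ {G P u v} → WalkIn G P u v → P u
    source (here p)     = p
    source (step p _ _) = p

  third : ∀ {N} → 3 ≤ N → (v w : Fin N) → ∃ λ z → z ≢ v × z ≢ w
  third (s≤s (s≤s (s≤s _))) v w with fz Fin.≟ v | fz Fin.≟ w
  ... | no a | no b = fz , a , b
  ... | yes refl | _ with fs fz Fin.≟ w
  ...   | no b = fs fz , (λ ()) , b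
  ...   | yes refl = fs (fs fz) , (λ ()) , (λ ())
  third (s≤s (s≤s (s≤s _))) v w | no a | yes refl with fs fz Fin.≟ v
  ...   | no b = fs fz , b , (λ ())
  ...   | yes refl = fs (fs fz) , (λ ()) , (λ ())

  -- Take a third vertex `z`. A walk avoiding `z` crosses the cut in an edge whose end on the side
  -- of `z` differs from `z`; a walk avoiding that end and joining `z` to the other side crosses in
  -- a second edge.
  TwoConnected⇒TwoEdge : ∀ G → TwoConnected G → TwoEdge G full
  TwoConnected⇒TwoEdge G (n≥3 , walks) Y {v} {w} _ _ Yv Yw with third n≥3 v w
  ... | z , z≢v , z≢w with true-or-false (Y z)
  ...   | inj₁ Yz with walk-crosses (walks z v w (z≢v ∘ sym) (z≢w ∘ sym)) Y Yv Yw
  ...     | a , b , (a≢z , Ya) , (_ , Yb) , ab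
            with walk-crosses (walks a z w (a≢z ∘ sym) (λ { refl → true≢false Ya Yw })) Y Yz Yw
  ...       | a′ , b′ , (a′≢a , Ya′) , (_ , Yb′) , ab′ =
              cut≥2 G {full ∩ Y} {full ∖ Y} (a′≢a ∘ sym) Ya (cong not Yb) ab Ya′ (cong not Yb′) ab′
  TwoConnected⇒TwoEdge G (n≥3 , walks) Y {v} {w} _ _ Yv Yw | z , z≢v , z≢w | inj₂ Yz
      with walk-crosses (walks z v w (z≢v ∘ sym) (z≢w ∘ sym)) Y Yv Yw
  ...   | a , b , (_ , Ya) , (b≢z , Yb) , ab
          with walk-crosses (walks b v z (λ { refl → true≢false Yv Yb }) (b≢z ∘ sym)) Y Yv Yz
  ...     | a′ , b′ , (_ , Ya′) , (b′≢b , Yb′) , ab′ =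
            subst (2 ≤_) (cut-sym G (full ∖ Y) (full ∩ Y))
              (cut≥2 G {full ∖ Y} {full ∩ Y} (b′≢b ∘ sym) (cong not Yb) Ya (trans (adj-sym G b a) ab)
                 (cong not Yb′) Ya′ (trans (adj-sym G b′ a′) ab′))

  module Reach (G : Graph) (x : V G) {u : V G} (u≢x : u ≢ x) where
    Reached : VSet (n G) → Set
    Reached R = ∀ v → R v ≡ true → WalkIn G (λ w → w ≢ x) u v

    Closed : VSet (n G) → Set
    Closed R = ∀ a b → R a ≡ true → adj G a b ≡ true → b ≢ x → R b ≡ true

    extend : ∀ {u a b} → WalkIn G (λ w → w ≢ x) u a → adj G a b ≡ true → b ≢ x → WalkIn G (λ w → w ≢ x) u b
    extend (here p)     ab b≢x = step p (≡⇒T ab) (here b≢x)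
    extend (step p q r) ab b≢x = step p q (extend r ab b≢x)

    grow : ∀ k R → count (∁ R) ≤ k → R u ≡ true → Reached R → ∃ λ R′ → R′ u ≡ true × Reached R′ × Closed R′
    grow k R h Ru reach with Fin.any? (λ a → Fin.any? λ b →
           (R a Bool.≟ true) ×-dec ((adj G a b Bool.≟ true) ×-dec ((b Fin.≟ x) ×?no (R b))))
      where
      _×?no_ : ∀ {b} → Dec (b ≡ x) → ∀ c → Dec (b ≢ x × c ≡ false)
      d ×?no c = ¬? d ×-dec (c Bool.≟ false)
    ... | no none = R , Ru , reach , λ a b Ra ab b≢x → ¬false⇒true λ Rb → none (a , b , Ra , ab , b≢x , Rb)
    ... | yes (a , b , Ra , ab , b≢x , Rb) with k
    ...   | zero  = ⊥-elim (n≮0 (<-≤-trans (count-mono-< {_} {λ _ → false} {∁ R} {b} (λ _ ()) (cong not Rb) refl) h))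
    ...   | suc k = grow k R⁺
              (≤-pred (≤-trans (count-mono-< {_} {∁ R⁺} {∁ R} {b} shrinks (cong not Rb)
                  (cong not (trans (cong (R b ∨_) (eqb-refl b)) (Bool.∨-zeroʳ (R b))))) h))
              (cong (_∨ eqb b u) Ru)
              λ v R⁺v → case true-or-false (R v) of λ where
                (inj₁ Rv) → reach v Rv
                (inj₂ Rv) → subst (WalkIn G (λ w → w ≢ x) u) (eqb⇒≡ (trans (cong (_∨ eqb b v) (sym Rv)) R⁺v))
                    (extend (reach a Ra) ab b≢x)
      where
      R⁺ : VSet (n G)
      R⁺ v = R v ∨ eqb b v
      shrinks : ∀ v → ∁ R⁺ v ≡ true → ∁ R v ≡ true
      shrinks v h′ with R v
      ... | false = refl

    reachable : ∃ λ R → R u ≡ true × Reached R × Closed R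
    reachable = grow (count (∁ (eqb u))) (eqb u) ≤-refl (eqb-refl u)
      λ v q → subst (WalkIn G (λ w → w ≢ x) u) (eqb⇒≡ q) (here u≢x)

  degree≡ : ∀ G v → degree G v ≡ ∑ λ w → χ (adj G v w)
  degree≡ G v = count≡sum (adj G v)

  -- In a subcubic graph a cut vertex x would send at least two edges to each of two sides.
  TwoEdge⇒TwoConnected : ∀ G → 3 ≤ n G → Subcubic G → TwoEdge G full → TwoConnected G
  TwoEdge⇒TwoConnected G n≥3 cubic two = n≥3 , walks
    where
    walks : ∀ x u v → u ≢ x → v ≢ x → WalkIn G (λ w → w ≢ x) u v
    walks x u v u≢x v≢x with Reach.reachable G x u≢x
    ... | R , Ru , reach , closed with true-or-false (R v)
    ...   | inj₁ Rv = reach v Rv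
    ...   | inj₂ Rv with true-or-false (R x)
    ...     | inj₁ Rx = ⊥-elim (target (reach x Rx) refl)
      where
      target : ∀ {P u v} → WalkIn G P u v → P v
      target (here p)     = p
      target (step _ _ r) = target r
    ...     | inj₂ Rx = ⊥-elim (<⇒≱ {3} {4} ≤-refl (begin
        2 + 2                                        ≤⟨ +-mono-≤ (side R Ru Rx closed) (side S Sv Sx closedS) ⟩
        degIn G R x + degIn G S x                    ≡⟨ sym (sum-+ (λ w → χ (adj G x w ∧ R w)) _) ⟩
        ∑ (λ w → χ (adj G x w ∧ R w) + χ (adj G x w ∧ S w)) ≤⟨ sum-mono disjoint ⟩
        ∑ (λ w → χ (adj G x w))                      ≡⟨ sym (degree≡ G x) ⟩
        degree G x                                   ≤⟨ cubic x ⟩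
        3 ∎))
      where
      open ≤-Reasoning
      S : VSet (n G)
      S w = not (R w) ∧ not (eqb w x)
      Sv = ∧-intro (cong not Rv) (cong not (≢⇒eqb v≢x))
      Sx : S x ≡ false
      Sx = trans (cong (λ c → not (R x) ∧ not c) (eqb-refl x)) (Bool.∧-zeroʳ (not (R x)))
      closedS : ∀ a b → S a ≡ true → adj G a b ≡ true → b ≢ x → S b ≡ true
      closedS a b Sa ab b≢x = ∧-intro (cong not (¬true⇒false λ Rb →
          true≢false (closed b a Rb (trans (adj-sym G b a) ab) λ { refl → true≢false Sa Sx })
            (not-true (proj₁ (∧-true {not (R a)} Sa))))) (cong not (≢⇒eqb b≢x))
      disjoint : ∀ w → χ (adj G x w ∧ R w) + χ (adj G x w ∧ S w) ≤ χ (adj G x w)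
      disjoint w with adj G x w | R w
      ... | true  | true  = ≤-refl
      ... | true  | false = χ≤1 _
      ... | false | _     = z≤n
      -- Edges leave `R` only towards `x`, so the at least two edges of its cut all end at `x`.
      side : ∀ R {u} → R u ≡ true → R x ≡ false → (∀ a b → R a ≡ true → adj G a b ≡ true → b ≢ x → R b ≡ true) → 2
          ≤ degIn G R x
      side R {u} Ru Rx closed = begin
          2                               ≤⟨ two R {u} {x} refl refl Ru Rx ⟩
          cut G (full ∩ R) (full ∖ R)     ≡⟨ trans (cut-sym G (full ∩ R) (full ∖ R)) (cut-degIn G (full ∖ R)
              (full ∩ R)) ⟩
          σ (degIn G R) (∁ R)             ≡⟨ sum-single (λ a → χ (∁ R a) * degIn G R a) x elsewhere ⟩
          χ (not (R x)) * degIn G R x     ≡⟨ trans (cong (λ c → χ (not c) * degIn G R x) Rx) (+-identityʳ _) ⟩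
          degIn G R x ∎
        where
        elsewhere : ∀ b → b ≢ x → χ (∁ R b) * degIn G R b ≡ 0
        elsewhere b b≢x with true-or-false (R b)
        ... | inj₁ Rb rewrite Rb = refl
        ... | inj₂ Rb = trans (cong (χ (∁ R b) *_) (sum-0 λ a → cong χ (¬true⇒false λ h →
                let ba , Ra = ∧-true {adj G b a} h in
                true≢false (closed a b Ra (trans (adj-sym G a b) ba) b≢x) Rb))) (*-zeroʳ (χ (∁ R b)))

  -- The excluded graphs

  -- The field `sums` stands in for surjectivity: it carries every count over X to one over `Fin k`.
  record Enumeration {N} (X : VSet N) : Set where
    field
      k    : ℕ
      ι    : Fin k → Fin N
      inj  : Injective _≡_ _≡_ ι
      ι-in : ∀ i → X (ι i) ≡ true
      sums : ∀ f → sumFin (f ∘ ι) ≡ sumFin (λ v → χ (X v) * f v)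

  enumerate : ∀ {N} (X : VSet N) → Enumeration X
  enumerate {zero} X = record { k = 0 ; ι = λ () ; inj = λ { {()} } ; ι-in = λ () ; sums = λ _ → refl }
  enumerate {suc N} X with enumerate (X ∘ fs) | true-or-false (X fz)
  ... | en | inj₂ q = record
    { k = k ; ι = fs ∘ ι ; inj = inj ∘ Fin.suc-injective ; ι-in = ι-in
    ; sums = λ f → trans (sums (f ∘ fs)) (cong (λ c → χ c * f fz + sumFin (λ v → χ (X (fs v)) * f (fs v))) (sym q)) }
    where open Enumeration en
  ... | en | inj₁ q = record
    { k = suc k ; ι = ι⁺ ; inj = inj⁺ ; ι-in = λ { fz → q ; (fs i) → ι-in i }
    ; sums = λ f → cong₂ _+_ (trans (sym (+-identityʳ (f fz))) (cong (λ c → χ c * f fz) (sym q))) (sums (f ∘ fs)) }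
    where
    open Enumeration en
    ι⁺ : Fin (suc k) → Fin (suc N)
    ι⁺ fz     = fz
    ι⁺ (fs i) = fs (ι i)
    inj⁺ : Injective _≡_ _≡_ ι⁺
    inj⁺ {fz}   {fz}   _ = refl
    inj⁺ {fs i} {fs j} h = cong fs (inj (Fin.suc-injective h))

  -- Only the diagonals of a square have to be declared distinct; its other pairs are adjacent.
  Triangle Square Short : (G : Graph) → VSet (n G) → Set
  Triangle G X = ∃ λ a → ∃ λ b → ∃ λ c → (X a ≡ true × X b ≡ true × X c ≡ true) ×
    (adj G a b ≡ true × adj G b c ≡ true × adj G a c ≡ true)
  Square G X = ∃ λ a → ∃ λ b → ∃ λ c → ∃ λ d → (X a ≡ true × X b ≡ true × X c ≡ true × X d ≡ true) ×
    (a ≢ c × b ≢ d) × (adj G a b ≡ true × adj G b c ≡ true × adj G c d ≡ true × adj G d a ≡ true)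
  Short G X = Triangle G X ⊎ Square G X

  infix 4 _≟ᵇ_
  _≟ᵇ_ = Bool._≟_

  triangle? : ∀ G X → Dec (Triangle G X)
  triangle? G X = Fin.any? λ a → Fin.any? λ b → Fin.any? λ c →
    (X a ≟ᵇ true ×-dec X b ≟ᵇ true ×-dec X c ≟ᵇ true) ×-dec
    (adj G a b ≟ᵇ true ×-dec adj G b c ≟ᵇ true ×-dec adj G a c ≟ᵇ true)

  square? : ∀ G X → Dec (Square G X)
  square? G X = Fin.any? λ a → Fin.any? λ b → Fin.any? λ c → Fin.any? λ d →
    (X a ≟ᵇ true ×-dec X b ≟ᵇ true ×-dec X c ≟ᵇ true ×-dec X d ≟ᵇ true) ×-dec
    (¬? (a Fin.≟ c) ×-dec ¬? (b Fin.≟ d)) ×-dec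
    (adj G a b ≟ᵇ true ×-dec adj G b c ≟ᵇ true ×-dec adj G c d ≟ᵇ true ×-dec adj G d a ≟ᵇ true)

  short? : ∀ G X → Dec (Short G X)
  short? G X = triangle? G X ⊎-dec square? G X

  Splits : (G : Graph) (X Y : VSet (n G)) → Set
  Splits G X Y = ∃ λ v → ∃ λ w → X v ≡ true × X w ≡ true × Y v ≡ true × Y w ≡ false × ¬ (2 ≤ cut G (X ∩ Y) (X ∖ Y))

  TwoEdge? : ∀ G X → Dec (TwoEdge G X)
  TwoEdge? G X with anySubset? (λ S → splits? (Vec.lookup S))
    where
    splits? : ∀ Y → Dec (Splits G X Y)
    splits? Y = Fin.any? λ v → Fin.any? λ w →
      X v ≟ᵇ true ×-dec X w ≟ᵇ true ×-dec Y v ≟ᵇ true ×-dec Y w ≟ᵇ false ×-dec ¬? (2 ≤? cut G (X ∩ Y) (X ∖ Y))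
  ... | yes (S , v , w , Xv , Xw , Yv , Yw , small) = no λ two → small (two (Vec.lookup S) Xv Xw Yv Yw)
  ... | no none = yes λ Y {v} {w} Xv Xw Yv Yw → let
          Y′ = Vec.lookup (Vec.tabulate Y)
          Y≐ : Y ≐ Y′
          Y≐ x = sym (Vec.lookup∘tabulate Y x)
        in case 2 ≤? cut G (X ∩ Y) (X ∖ Y) of λ where
          (yes h) → h
          (no h)  → ⊥-elim (none (Vec.tabulate Y , v , w , Xv , Xw , trans (sym (Y≐ v)) Yv , trans (sym (Y≐ w)) Yw ,
            λ h′ → h (≤-trans h′ (≤-reflexive (cut-cong G (λ x → cong (X x ∧_) (sym (Y≐ x))) (λ x → cong
                (λ c → X x ∧ not c) (sym (Y≐ x))))))))

  -- The last inequality plays two parts: it violates Euler's bound for graphs without faces shorter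
  -- than 5, and it expresses the positive weight of a class whose parity needs a correction.
  Forbidden : Graph → Set
  Forbidden H = 3 ≤ n H × Subcubic H × TwoEdge H full × ¬ Short H full × 5 * n H < 3 * size H + 10

  forbidden? : ∀ H → Dec (Forbidden H)
  forbidden? H = 3 ≤? n H ×-dec Fin.all? (λ v → degree H v ≤? 3) ×-dec TwoEdge? H full ×-dec
    ¬? (short? H full) ×-dec 5 * n H <? 3 * size H + 10

  -- Any matrix yields a graph once it is symmetrised and its diagonal removed, so listing matrices
  -- suffices. `induced` is built in the same way, so that it occurs in the list literally and not
  -- merely up to isomorphism.
  tableGraph : ∀ k → Vec.Vec (Vec.Vec Bool k) k → Graph
  tableGraph k M = mkGraph k (λ a b → (entry a b ∧ entry b a) ∧ not (eqb a b))
      (λ a b → cong₂ (λ c d → c ∧ not d) (Bool.∧-comm (entry a b) (entry b a)) (eqb-sym a b))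
      (λ a → trans (cong (λ c → (entry a a ∧ entry a a) ∧ not c) (eqb-refl a)) (Bool.∧-zeroʳ (entry a a ∧ entry a a)))
    where
    entry : Fin k → Fin k → Bool
    entry a b = Vec.lookup (Vec.lookup M a) b

  allTables : ∀ k → List (Vec.Vec (Vec.Vec Bool k) k)
  allTables k = allVecs (allVecs (true ∷ false ∷ []) k) k

  ∈-allTables : ∀ {k} (M : Vec.Vec (Vec.Vec Bool k) k) → M ∈ allTables k
  ∈-allTables = ∈-allVecs (∈-allVecs λ { true → Any.here refl ; false → Any.there (Any.here refl) })

  graphsOn : ℕ → List Graph
  graphsOn k = List.map (tableGraph k) (allTables k)

  opaque
    -- Opaque, because the list is far too long to be evaluated; only membership in it matters.
    graphsBelow : ℕ → List Graph
    graphsBelow K = List.concat (List.map graphsOn (List.upTo K))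

    ∈-graphsBelow : ∀ {K k} M → k < K → tableGraph k M ∈ graphsBelow K
    ∈-graphsBelow {K} {k} M k<K = ∈-concat⁺′ {vs = graphsOn k} {xss = List.map graphsOn (List.upTo K)}
      (∈-map⁺ (tableGraph k) (∈-allTables M)) (∈-map⁺ graphsOn (∈-upTo⁺ k<K))

  -- A subcubic set of at least 20 vertices has weight 0, so small obstructions suffice.
  opaque
    family : List Graph
    family = List.filter forbidden? (graphsBelow 20)

    family-forbidden : All.All Forbidden family
    family-forbidden = All.all-filter forbidden? (graphsBelow 20)

    ∈-family : ∀ {H} → H ∈ graphsBelow 20 → Forbidden H → H ∈ family
    ∈-family {H} = ∈-filter⁺ forbidden? {H} {graphsBelow 20}

  vertices : ∀ {N} → VSet N → ℕ
  vertices X = σ (λ _ → 1) X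

  InducedCopy : (G : Graph) → VSet (n G) → Graph → Set
  InducedCopy G X H = Σ (V H → V G) λ f → Injective _≡_ _≡_ f × (∀ a → X (f a) ≡ true) × (∀ a b → adj H a b ≡ adj
      G (f a) (f b))

  module Induced (G : Graph) (X : VSet (n G)) where
    open Enumeration (enumerate X)

    table : Vec.Vec (Vec.Vec Bool k) k
    table = Vec.tabulate λ a → Vec.tabulate λ b → adj G (ι a) (ι b)

    induced : Graph
    induced = tableGraph k table

    adj-induced : ∀ a b → adj induced a b ≡ adj G (ι a) (ι b)
    adj-induced a b = trans (cong₂ (λ c d → (c ∧ d) ∧ not (eqb a b)) (entry a b) (trans (entry b a)
        (adj-sym G (ι b) (ι a))))
        (trans (cong (_∧ not (eqb a b)) (Bool.∧-idem (adj G (ι a) (ι b)))) loopless)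
      where
      entry : ∀ a b → Vec.lookup (Vec.lookup table a) b ≡ adj G (ι a) (ι b)
      entry a b = trans (cong (λ r → Vec.lookup r b) (Vec.lookup∘tabulate (λ a → Vec.tabulate λ b → adj G (ι a)
          (ι b)) a))
                        (Vec.lookup∘tabulate (λ b → adj G (ι a) (ι b)) b)
      loopless : adj G (ι a) (ι b) ∧ not (eqb a b) ≡ adj G (ι a) (ι b)
      loopless with a Fin.≟ b
      ... | yes refl = trans (Bool.∧-zeroʳ _) (sym (adj-irr G (ι a)))
      ... | no _     = Bool.∧-identityʳ _

    ∑-ι : ∀ f → ∑ (f ∘ ι) ≡ σ f X
    ∑-ι f = trans (∑-def (f ∘ ι)) (trans (sums f) (sym (∑-def λ v → χ (X v) * f v)))

    k≡ : k ≡ vertices X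
    k≡ = trans (sym (trans (sum-const {k} 1) (*-identityʳ k))) (∑-ι λ _ → 1)

    image : VSet k → VSet (n G)
    image A v = anyFin λ i → A i ∧ eqb (ι i) v

    image-ι : ∀ A i → image A (ι i) ≡ A i
    image-ι A i with true-or-false (A i)
    ... | inj₁ q = trans (any-intro (λ j → A j ∧ eqb (ι j) (ι i)) i (∧-intro q (eqb-refl (ι i)))) (sym q)
    ... | inj₂ q = trans (any-false (λ j → A j ∧ eqb (ι j) (ι i)) λ j → ¬true⇒false λ h → let a , b = ∧-true {A j} h in
            true≢false (subst (λ x → A x ≡ true) (inj (eqb⇒≡ b)) a) q) (sym q)

    image⊆ : ∀ A v → image A v ≡ true → X v ≡ true
    image⊆ A v h = let i , q = any-elim (λ i → A i ∧ eqb (ι i) v) h in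
      subst (λ x → X x ≡ true) (eqb⇒≡ (proj₂ (∧-true {A i} q))) (ι-in i)

    -- If no index were sent to `v`, the indicator of `v` would sum to 0 over the indices and to 1
    -- over X.
    onto : ∀ v → X v ≡ true → ∃ λ i → ι i ≡ v
    onto v Xv with search (λ i → eqb v (ι i))
    ... | inj₁ (i , h) = i , sym (eqb⇒≡ h)
    ... | inj₂ none = case trans (sym (sum-0 λ i → cong χ (none i))) (trans (∑-ι (λ w → χ (eqb v w)))
            (trans (sum-cong λ w → *-comm (χ (X w)) _) (trans (sum-pick (χ ∘ X) v) (cong χ Xv)))) of λ ()

    ∑-image : ∀ A f → ∑ (λ i → χ (A i) * f (ι i)) ≡ σ f (image A)
    ∑-image A f = trans (sum-cong λ i → cong (λ c → χ c * f (ι i)) (sym (image-ι A i)))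
      (trans (∑-ι (λ v → χ (image A v) * f v)) (sum-cong inside))
      where
      inside : ∀ v → χ (X v) * (χ (image A v) * f v) ≡ χ (image A v) * f v
      inside v with true-or-false (image A v)
      ... | inj₁ q = trans (cong (λ c → χ c * (χ (image A v) * f v)) (image⊆ A v q)) (+-identityʳ _)
      ... | inj₂ q rewrite q = *-zeroʳ (χ (X v))

    cut-induced : ∀ A B → cut induced A B ≡ cut G (image A) (image B)
    cut-induced A B = trans
      (sum-cong λ i → cong (χ (A i) *_) (trans (sum-cong λ j → cong (λ c → χ (B j) * χ c) (adj-induced i j))
         (∑-image B (λ v → χ (adj G (ι i) v)))))
      (∑-image A (λ u → σ (λ v → χ (adj G u v)) (image B)))

    image-full : image full ≐ X
    image-full v with true-or-false (X v)
    ... | inj₁ q = let i , ιi = onto v q in trans (any-intro (λ i → eqb (ι i) v) i (≡⇒eqb ιi)) (sym q)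
    ... | inj₂ q = trans (¬true⇒false λ h → true≢false (image⊆ full v h) q) (sym q)

    size-induced : size induced ≡ e (edgesOf G) X
    size-induced = *-cancelˡ-≡ _ _ 2 (trans (sym (2e induced full))
      (trans (cut-induced full full) (trans (cut-cong G image-full image-full) (2e G X))))

    TwoEdge-induced : TwoEdge G X → TwoEdge induced full
    TwoEdge-induced two Y {v} {w} _ _ Yv Yw = subst (2 ≤_)
        (sym (trans (cut-induced Y (∁ Y)) (cut-cong G inside outside)))
        (two (image Y) (ι-in v) (ι-in w) (trans (image-ι Y v) Yv) (trans (image-ι Y w) Yw))
      where
      inside : image Y ≐ X ∩ image Y
      inside x with true-or-false (image Y x)
      ... | inj₁ q = trans q (sym (∧-intro (image⊆ Y x q) q))
      ... | inj₂ q = trans q (sym (trans (cong (X x ∧_) q) (Bool.∧-zeroʳ (X x))))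
      outside : image (∁ Y) ≐ X ∖ image Y
      outside x with true-or-false (X x)
      ... | inj₂ q = trans (¬true⇒false λ h → true≢false (image⊆ (∁ Y) x h) q) (sym (cong (_∧ not (image Y x)) q))
      ... | inj₁ q with onto x q
      ...   | i , refl = trans (image-ι (∁ Y) i) (sym (trans (cong (_∧ not (image Y (ι i))) q)
          (cong not (image-ι Y i))))

    subcubic-induced : Subcubic G → Subcubic induced
    subcubic-induced cubic i = begin
        degree induced i                       ≡⟨ degree≡ induced i ⟩
        ∑ (λ j → χ (adj induced i j))          ≡⟨ sum-cong (λ j → cong χ (adj-induced i j)) ⟩
        ∑ (λ j → χ (adj G (ι i) (ι j)))        ≡⟨ ∑-ι (λ v → χ (adj G (ι i) v)) ⟩
        σ (λ v → χ (adj G (ι i) v)) X          ≤⟨ sum-mono (λ v → ≤-trans (*-monoˡ-≤ _ (χ≤1 (X v))) (≤-reflexive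
            (+-identityʳ _))) ⟩
        ∑ (λ v → χ (adj G (ι i) v))            ≡⟨ sym (degree≡ G (ι i)) ⟩
        degree G (ι i)                         ≤⟨ cubic (ι i) ⟩
        3 ∎
      where open ≤-Reasoning

    adj⇒ : ∀ {a b} → adj induced a b ≡ true → adj G (ι a) (ι b) ≡ true
    adj⇒ {a} {b} h = trans (sym (adj-induced a b)) h

    triangle-induced : Triangle induced full → Triangle G X
    triangle-induced (a , b , c , _ , ab , bc , ac) = ι a , ι b , ι c , (ι-in a , ι-in b , ι-in c) , adj⇒ ab ,
        adj⇒ bc , adj⇒ ac

    square-induced : Square induced full → Square G X
    square-induced (a , b , c , d , _ , (a≢c , b≢d) , ab , bc , cd , da) =
      ι a , ι b , ι c , ι d , (ι-in a , ι-in b , ι-in c , ι-in d) , (a≢c ∘ inj , b≢d ∘ inj) , adj⇒ ab , adj⇒ bc ,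
          adj⇒ cd , adj⇒ da

    copy : InducedCopy G X induced
    copy = ι , inj , ι-in , adj-induced

    -- The subgraph induced by X is itself the member of the family.
    forbidden-copy : Subcubic G → TwoEdge G X → ¬ Short G X → 3 ≤ vertices X → vertices X < 20 →
                     5 * vertices X < 3 * e (edgesOf G) X + 10 → ∃ λ H → H ∈ family × InducedCopy G X H
    forbidden-copy cubic two ¬short X≥3 X<20 dense = induced ,
      ∈-family (∈-graphsBelow table (subst (_< 20) (sym k≡) X<20))
        (subst (3 ≤_) (sym k≡) X≥3 , subcubic-induced cubic , TwoEdge-induced two ,
         (λ { (inj₁ t) → ¬short (inj₁ (triangle-induced t)) ; (inj₂ s) → ¬short (inj₂ (square-induced s)) }) ,
         subst₂ (λ a b → 5 * a < 3 * b + 10) (sym k≡) (sym size-induced) dense) ,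
      copy

  -- Euler's formula

  1≤∑ : ∀ {k} (f : Fin k → ℕ) → 1 ≤ ∑ f → ∃ λ i → 1 ≤ f i
  1≤∑ f h with Fin.any? (λ i → 1 ≤? f i)
  ... | yes p = p
  ... | no none = ⊥-elim (<⇒≱ h (≤-reflexive (sum-0 λ i → n<1⇒n≡0 (≰⇒> λ q → none (i , q)))))

  injection≤ : ∀ {k N} (f : Fin k → Fin N) → Injective _≡_ _≡_ f → (D : VSet N) → (∀ i → D (f i) ≡ true) → k ≤ ∑
      (χ ∘ D)
  injection≤ {k} f f-inj D f∈D = begin
      k                                        ≡⟨ sym (*-identityʳ k) ⟩
      k * 1                                    ≡⟨ sym (sum-const 1) ⟩
      ∑ (λ (i : Fin k) → 1)                    ≡⟨ sum-cong (λ i → sym (sum-pick₁ (f i))) ⟩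
      ∑ (λ i → ∑ λ x → χ (eqb (f i) x))        ≡⟨ sum-swap (λ i x → χ (eqb (f i) x)) ⟩
      ∑ (λ x → ∑ λ i → χ (eqb (f i) x))        ≤⟨ sum-mono fibre ⟩
      ∑ (χ ∘ D)                                ∎
    where
    open ≤-Reasoning
    fibre : ∀ x → ∑ (λ i → χ (eqb (f i) x)) ≤ χ (D x)
    fibre x with Fin.any? (λ i → f i Fin.≟ x)
    ... | no none = ≤-trans (≤-reflexive (sum-0 λ i → cong χ (≢⇒eqb λ q → none (i , q)))) z≤n
    ... | yes (i , refl) = ≤-trans (≤-reflexive (sum-single _ i λ j j≢i → cong χ (≢⇒eqb (j≢i ∘ f-inj))))
          (≤-reflexive (cong χ (trans (eqb-refl (f i)) (sym (f∈D i)))))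

  ∑-combine : ∀ {k l} (f : Fin (k * l) → ℕ) → ∑ f ≡ ∑ (λ i → ∑ λ j → f (Fin.combine {k} {l} i j))
  ∑-combine {k} {l} f = trans (∑-def f) (trans (go k f) (sym (trans (∑-def λ i → ∑ λ j → f (Fin.combine {k} {l} i j))
      (sumFin-cong {k} λ i → ∑-def λ j → f (Fin.combine {k} {l} i j)))))
    where
    sumFin-cong : ∀ {k} {f g : Fin k → ℕ} → (∀ i → f i ≡ g i) → sumFin f ≡ sumFin g
    sumFin-cong {zero}  h = refl
    sumFin-cong {suc k} h = cong₂ _+_ (h fz) (sumFin-cong (h ∘ fs))
    append : ∀ a {b} (f : Fin (a + b) → ℕ) → sumFin f ≡ sumFin (λ i → f (i Fin.↑ˡ b)) + sumFin (λ i → f (a Fin.↑ʳ i))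
    append zero    f = refl
    append (suc a) f = trans (cong (f fz +_) (append a (f ∘ fs))) (sym (+-assoc (f fz) _ _))
    go : ∀ k (f : Fin (k * l) → ℕ) → sumFin f ≡ sumFin (λ i → sumFin λ j → f (Fin.combine {k} {l} i j))
    go zero    f = refl
    go (suc k) f = trans (append l f) (cong (sumFin (λ j → f (j Fin.↑ˡ (k * l))) +_) (go k (λ i → f (l Fin.↑ʳ i))))

  allBelow-elim : ∀ N p {k} → allBelow N p ≡ true → k < N → p k ≡ true
  allBelow-elim (suc N) p {k} h (s≤s k≤N) with k ≟ N
  ... | yes refl = proj₁ (∧-true {p k} h)
  ... | no k≢N   = allBelow-elim N p (proj₂ (∧-true {p N} h)) (≤∧≢⇒< k≤N k≢N)

  module _ {A : Set} (f : A → A) where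
    iterate-+ : ∀ a b x → iterate f (a + b) x ≡ iterate f a (iterate f b x)
    iterate-+ zero    b x = refl
    iterate-+ (suc a) b x = cong f (iterate-+ a b x)

    iterate-* : ∀ j {q x} → iterate f q x ≡ x → iterate f (j * q) x ≡ x
    iterate-* zero    h = refl
    iterate-* (suc j) {q} {x} h = trans (iterate-+ q (j * q) x) (trans (cong (iterate f q) (iterate-* j h)) h)

    -- Both a and a′ are c moved k k′ + k + k′ steps along its cycle.
    cyclic-injective : ∀ {a a′ c k k′} → f a ≡ c → f a′ ≡ c → iterate f k c ≡ a → iterate f k′ c ≡ a′ → a ≡ a′
    cyclic-injective {a} {a′} {c} {k} {k′} fa fa′ ka ka′ = begin
        a                                     ≡⟨ sym ka ⟩
        iterate f k c                         ≡⟨ cong (iterate f k) (sym (iterate-* k′ (trans (cong f ka) fa))) ⟩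
        iterate f k (iterate f (k′ * suc k) c) ≡⟨ sym (iterate-+ k (k′ * suc k) c) ⟩
        iterate f (k + k′ * suc k) c          ≡⟨ cong (λ j → iterate f j c) (eq k k′) ⟩
        iterate f (k′ + k * suc k′) c         ≡⟨ iterate-+ k′ (k * suc k′) c ⟩
        iterate f k′ (iterate f (k * suc k′) c) ≡⟨ cong (iterate f k′) (iterate-* k (trans (cong f ka′) fa′)) ⟩
        iterate f k′ c                        ≡⟨ ka′ ⟩
        a′ ∎
      where
      open ≡-Reasoning
      eq : ∀ k k′ → k + k′ * (1 + k) ≡ k′ + k * (1 + k′)
      eq = solve-∀

  module Faces (G : Graph) (n≥3 : 3 ≤ n G) (two : TwoEdge G full) (¬short : ¬ Short G full)
               (ρ : V G → V G → V G) (rot : IsRotationSystem G ρ) where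
    min-degree : ∀ v → 2 ≤ ∑ λ w → χ (adj G v w)
    min-degree v with third n≥3 v v
    ... | w , w≢v , _ = begin
        2                                    ≤⟨ two (eqb v) {v} {w} refl refl (eqb-refl v) (≢⇒eqb (w≢v ∘ sym)) ⟩
        cut G (eqb v) (∁ (eqb v))            ≡⟨ sum-pick (λ u → ∑ λ x → χ (∁ (eqb v) x) * χ (adj G u x)) v ⟩
        ∑ (λ x → χ (∁ (eqb v) x) * χ (adj G v x)) ≤⟨ sum-mono (λ x → ≤-trans (*-monoˡ-≤ _ (χ≤1 (∁ (eqb v) x)))
            (≤-reflexive (+-identityʳ _))) ⟩
        ∑ (λ x → χ (adj G v x)) ∎
      where open ≤-Reasoning

    another : ∀ v u → ∃ λ w → adj G v w ≡ true × w ≢ u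
    another v u with search (λ w → adj G v w ∧ not (eqb w u))
    ... | inj₁ (w , h) = w , proj₁ (∧-true {adj G v w} h) , λ { refl → true≢false (proj₂ (∧-true {adj G v w} h))
        (cong not (eqb-refl w)) }
    ... | inj₂ none = ⊥-elim (<⇒≱ (min-degree v) (≤-trans (≤-reflexive (sum-single _ u λ w w≢u → cong χ
        (¬true⇒false λ h →
            true≢false (∧-intro h (cong not (≢⇒eqb w≢u))) (none w)))) (χ≤1 (adj G v u))))

    ρ-adj : ∀ {v u} → adj G v u ≡ true → adj G v (ρ v u) ≡ true
    ρ-adj {v} {u} h = T⇒≡ (proj₁ (rot v u (≡⇒T h)))

    -- The rotation at `v` reaches every neighbour from `u`, and there are at least two of them.
    ρ-moves : ∀ {v u} → adj G v u ≡ true → ρ v u ≢ u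
    ρ-moves {v} {u} h fixed with another v u
    ... | w , vw , w≢u with proj₂ (rot v u (≡⇒T h)) w (≡⇒T vw)
    ...   | k , eq = w≢u (trans (sym eq) (stuck k))
      where
      stuck : ∀ k → iterate (ρ v) k u ≡ u
      stuck zero    = refl
      stuck (suc k) = trans (cong (ρ v) (stuck k)) fixed

    ρ-injective : ∀ {v u u′} → adj G v u ≡ true → adj G v u′ ≡ true → ρ v u ≡ ρ v u′ → u ≡ u′
    ρ-injective {v} {u} {u′} h h′ eq =
      let back = proj₂ (rot v (ρ v u) (≡⇒T (ρ-adj h)))
          k , ka = back u (≡⇒T h)
          k′ , ka′ = back u′ (≡⇒T h′)
      in cyclic-injective (ρ v) {k = k} {k′} refl (sym eq) ka ka′

    Dart : V G × V G → Set
    Dart (a , b) = adj G a b ≡ true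

    next : V G × V G → V G × V G
    next = faceStep G ρ

    next-dart : ∀ {d} → Dart d → Dart (next d)
    next-dart {a , b} h = ρ-adj (trans (adj-sym G b a) h)

    next-injective : ∀ {d d′} → Dart d → Dart d′ → next d ≡ next d′ → d ≡ d′
    next-injective {a , b} {a′ , b′} h h′ eq with cong proj₁ eq
    ... | refl = cong (_, b) (ρ-injective (trans (adj-sym G b a) h) (trans (adj-sym G b a′) h′) (cong proj₂ eq))

    iterate-dart : ∀ k {d} → Dart d → Dart (iterate next k d)
    iterate-dart zero    h = h
    iterate-dart (suc k) h = next-dart (iterate-dart k h)

    cancel : ∀ k {d d′} → Dart d → Dart d′ → iterate next k d ≡ iterate next k d′ → d ≡ d′
    cancel zero    h h′ eq = eq
    cancel (suc k) h h′ eq = cancel k h h′ (next-injective (iterate-dart k h) (iterate-dart k h′) eq)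

    -- A facial walk that closes after one step gives a loop, after two a fixed point of a rotation,
    -- after three a triangle and after four a square, whose diagonals are distinct by `ρ-moves`.
    long-faces : ∀ {d} → Dart d → ∀ k → 1 ≤ k → k ≤ 4 → iterate next k d ≢ d
    long-faces {a , b} ab = λ where
        1 _ _ eq → true≢false ab (trans (cong (λ x → adj G x b) (sym (cong proj₁ eq))) (adj-irr G b))
        2 _ _ eq → c≢a (cong proj₁ eq)
        3 _ _ eq → ¬short (inj₁ (a , b , c , (refl , refl , refl) , (ab , bc , trans (adj-sym G a c)
            (subst (λ y → adj G c y ≡ true) (cong proj₁ eq) cx))))
        4 _ _ eq → ¬short (inj₂ (a , b , c , x , (refl , refl , refl , refl) , ((c≢a ∘ sym) , (x≢b ∘ sym)) , ab ,
            bc , cx ,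
                     subst (λ z → adj G x z ≡ true) (cong proj₁ eq) (ρ-adj (adj-flip G cx))))
        (suc (suc (suc (suc (suc _))))) _ (s≤s (s≤s (s≤s (s≤s ()))))
      where
      c = ρ b a
      x = ρ c b
      bc = ρ-adj (adj-flip G ab)
      cx = ρ-adj (adj-flip G bc)
      c≢a = ρ-moves (adj-flip G ab)
      x≢b = ρ-moves (adj-flip G bc)

    code : V G × V G → Fin (n G * n G)
    code (a , b) = Fin.combine a b

    code-injective : ∀ {d d′} → code d ≡ code d′ → d ≡ d′
    code-injective {a , b} {a′ , b′} h = let p , q = Fin.combine-injective a b a′ b′ h in cong₂ _,_ p q

    key-injective : ∀ {d d′} → dartKey G d ≡ dartKey G d′ → d ≡ d′
    key-injective {d} {d′} h = code-injective (Fin.toℕ-injective (trans (key d) (trans h (sym (key d′)))))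
      where
      key : ∀ d → toℕ (code d) ≡ dartKey G d
      key (a , b) = trans (Fin.toℕ-combine a b) (cong (_+ toℕ b) (*-comm (n G) (toℕ a)))

    period : ∀ {d} → Dart d → ∃ λ q → 1 ≤ q × q ≤ n G * n G × iterate next q d ≡ d
    period {d} h with Fin.pigeonhole (n<1+n (n G * n G)) (λ i → code (iterate next (toℕ i) d))
    ... | i , j , i<j , eq = toℕ j ∸ toℕ i , m<n⇒0<n∸m i<j ,
          ≤-trans (m∸n≤m (toℕ j) (toℕ i)) (≤-pred (Fin.toℕ<n j)) ,
          sym (cancel (toℕ i) h (iterate-dart (toℕ j ∸ toℕ i) h) (trans (code-injective eq)
            (trans (cong (λ k → iterate next k d) (sym (m+[n∸m]≡n (<⇒≤ i<j)))) (iterate-+ next (toℕ i)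
                (toℕ j ∸ toℕ i) d))))

    Minimal : V G × V G → Set
    Minimal d = ∀ k → k < n G * n G → dartKey G d ≤ dartKey G (iterate next k d)

    4<n² : 4 < n G * n G
    4<n² = ≤-trans (s≤s (s≤s (s≤s (s≤s (s≤s z≤n))))) (*-mono-≤ n≥3 n≥3)

    -- Two darts of one face that are both least have the same key, hence are equal. Then `δ` steps
    -- lead back to the start, which `long-faces` excludes for 1 ≤ δ ≤ 4.
    minimal-unique : ∀ {d d′ δ} → Dart d → Dart d′ → Minimal d → Minimal d′ → δ ≤ 4 → d ≡ iterate next δ d′ → d ≡
        d′ × δ ≡ 0
    minimal-unique {δ = zero} _ _ _ _ _ eq = eq , refl
    minimal-unique {d} {d′} {suc δ} h h′ min min′ δ≤4 eq = ⊥-elim (long-faces h′ (suc δ) (s≤s z≤n) δ≤4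
        (trans (sym eq) same))
      where
      per = period h′
      q = proj₁ per
      δ<q : suc δ ≤ q
      δ<q with suc δ ≤? q
      ... | yes r = r
      ... | no r  = ⊥-elim (long-faces h′ q (proj₁ (proj₂ per)) (≤-trans (<⇒≤ (≰⇒> r)) δ≤4)
          (proj₂ (proj₂ (proj₂ per))))
      -- The rest of the period `q` leads from `d` back to `d′`, so each dart lies ahead of the
      -- other.
      back : iterate next (q ∸ suc δ) d ≡ d′
      back = trans (cong (iterate next (q ∸ suc δ)) eq) (trans (sym (iterate-+ next (q ∸ suc δ) (suc δ) d′))
        (trans (cong (λ k → iterate next k d′) (m∸n+n≡m δ<q)) (proj₂ (proj₂ (proj₂ per)))))
      same : d ≡ d′
      same = key-injective (≤-antisym
        (subst (λ x → dartKey G d ≤ dartKey G x) back (min (q ∸ suc δ)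
          (<-≤-trans (∸-monoʳ-< {q} {suc δ} {0} (s≤s z≤n) δ<q) (proj₁ (proj₂ (proj₂ per))))))
        (subst (λ x → dartKey G d′ ≤ dartKey G x) (sym eq) (min′ (suc δ) (≤-<-trans δ≤4 4<n²))))

    leaders : VSet (n G * n G)
    leaders x = let u , v = Fin.remQuot {n G} (n G) x in adj G u v ∧ minInFace G ρ (u , v)

    darts : VSet (n G * n G)
    darts x = let u , v = Fin.remQuot {n G} (n G) x in adj G u v

    open Enumeration (enumerate leaders)

    dart-of : Fin k → V G × V G
    dart-of j = Fin.remQuot {n G} (n G) (ι j)

    dart-of-dart : ∀ j → Dart (dart-of j)
    dart-of-dart j = proj₁ (∧-true {darts (ι j)} (ι-in j))

    dart-of-minimal : ∀ j → Minimal (dart-of j)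
    dart-of-minimal j i i< = ≤ᵇ⇒≤ _ _ (≡⇒T (allBelow-elim (n G * n G) _ (proj₂ (∧-true {darts (ι j)} (ι-in j))) i<))

    dart-of-injective : ∀ {j j′} → dart-of j ≡ dart-of j′ → j ≡ j′
    dart-of-injective {j} {j′} h = inj (trans (sym (Fin.combine-remQuot {n G} (n G) (ι j)))
      (trans (cong code h) (Fin.combine-remQuot {n G} (n G) (ι j′))))

    -- The first five darts of every face, starting at its least dart. Their distinctness gives 5 F
    -- ≤ 2 |E|.
    spread : Fin (k * 5) → Fin (n G * n G)
    spread c = let j , i = Fin.remQuot {k} 5 c in code (iterate next (toℕ i) (dart-of j))

    spread-injective : Injective _≡_ _≡_ spread
    spread-injective {c} {c′} h = trans (sym (Fin.combine-remQuot {k} 5 c))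
        (trans (cong₂ Fin.combine (proj₁ same) (proj₂ same)) (Fin.combine-remQuot {k} 5 c′))
      where
      le : ∀ {j j′ : Fin k} {i i′ : Fin 5} → toℕ i ≤ toℕ i′ →
           iterate next (toℕ i) (dart-of j) ≡ iterate next (toℕ i′) (dart-of j′) → j ≡ j′ × i ≡ i′
      le {j} {j′} {i} {i′} i≤i′ eq =
        let δ = toℕ i′ ∸ toℕ i
            d≡ , δ≡0 = minimal-unique {δ = δ} (dart-of-dart j) (dart-of-dart j′) (dart-of-minimal j)
                (dart-of-minimal j′)
              (≤-trans (m∸n≤m (toℕ i′) (toℕ i)) (≤-pred (Fin.toℕ<n i′)))
              (cancel (toℕ i) (dart-of-dart j) (iterate-dart δ (dart-of-dart j′))
                (trans eq (trans (cong (λ k → iterate next k (dart-of j′)) (sym (m+[n∸m]≡n i≤i′))) (iterate-+ next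
                    (toℕ i) δ (dart-of j′)))))
        in dart-of-injective d≡ , Fin.toℕ-injective (≤-antisym i≤i′ (m∸n≡0⇒m≤n δ≡0))
      same : proj₁ (Fin.remQuot {k} 5 c) ≡ proj₁ (Fin.remQuot {k} 5 c′) × proj₂ (Fin.remQuot {k} 5 c) ≡ proj₂
          (Fin.remQuot {k} 5 c′)
      same with ≤-total (toℕ (proj₂ (Fin.remQuot {k} 5 c))) (toℕ (proj₂ (Fin.remQuot {k} 5 c′)))
      ... | inj₁ i≤i′ = le i≤i′ (code-injective h)
      ... | inj₂ i′≤i = let a , b = le i′≤i (sym (code-injective h)) in sym a , sym b

    ∑-pairs : ∀ (f : V G → V G → ℕ) → ∑ {n G * n G} (λ x → f (proj₁ (Fin.remQuot {n G} (n G) x))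
        (proj₂ (Fin.remQuot {n G} (n G) x))) ≡ ∑ λ u → ∑ (f u)
    ∑-pairs f = trans (∑-combine {n G} {n G} _) (sum-cong λ u → sum-cong λ v →
      cong (λ d → f (proj₁ d) (proj₂ d)) (Fin.remQuot-combine {n G} {n G} u v))

    k≡faces : k ≡ numFaces G ρ
    k≡faces = begin
        k                                   ≡⟨ sym (trans (sum-const {k} 1) (*-identityʳ k)) ⟩
        ∑ (λ (_ : Fin k) → 1)               ≡⟨ ∑-def (λ _ → 1) ⟩
        sumFin (λ (_ : Fin k) → 1)          ≡⟨ sums (λ _ → 1) ⟩
        sumFin (λ x → χ (leaders x) * 1)    ≡⟨ sym (∑-def (λ x → χ (leaders x) * 1)) ⟩
        ∑ (λ x → χ (leaders x) * 1)         ≡⟨ sum-cong (λ x → *-identityʳ (χ (leaders x))) ⟩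
        ∑ (χ ∘ leaders)                     ≡⟨ ∑-pairs (λ u v → χ (adj G u v ∧ minInFace G ρ (u , v))) ⟩
        ∑ (λ u → ∑ λ v → χ (adj G u v ∧ minInFace G ρ (u , v)))
          ≡⟨ trans (sum-cong λ u → sym (count≡sum λ v → adj G u v ∧ minInFace G ρ (u , v))) (∑-def _) ⟩
        numFaces G ρ ∎
      where open ≡-Reasoning

    faces-bound : numFaces G ρ * 5 ≤ 2 * size G
    faces-bound = begin
        numFaces G ρ * 5    ≡⟨ cong (_* 5) (sym k≡faces) ⟩
        k * 5               ≤⟨ injection≤ spread spread-injective darts in-darts ⟩
        ∑ (χ ∘ darts)       ≡⟨ ∑-pairs (λ u v → χ (adj G u v)) ⟩
        ∑ (λ u → ∑ λ v → χ (adj G u v))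
          ≡⟨ sum-cong (λ u → sym (trans (+-identityʳ _) (sum-cong λ v → +-identityʳ _))) ⟩
        cut G full full     ≡⟨ 2e G full ⟩
        2 * size G          ∎
      where
      open ≤-Reasoning
      in-darts : ∀ c → darts (spread c) ≡ true
      in-darts c = let j , i = Fin.remQuot {k} 5 c ; u , v = iterate next (toℕ i) (dart-of j) in
        trans (cong (λ d → adj G (proj₁ d) (proj₂ d)) (Fin.remQuot-combine {n G} {n G} u v)) (iterate-dart (toℕ i)
            (dart-of-dart j))

    no-isolated : numIsolated G ≡ 0
    no-isolated = trans (count≡sum _) (sum-0 λ v → cong χ (positive v))
      where
      positive : ∀ v → (degree G v ≡ᵇ 0) ≡ false
      positive v with degree G v | subst (2 ≤_) (sym (degree≡ G v)) (min-degree v)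
      ... | suc _ | _ = refl

    -- The vertex numbered 0 has no smaller vertex in its component.
    has-component : 1 ≤ numComponents G
    has-component = subst (1 ≤_) (sym (count≡sum rep)) (≤-trans (≤-reflexive (cong χ (sym first)))
        (term≤sum (χ ∘ rep) z))
      where
      rep : V G → Bool
      rep v = not (anyFin λ u → reachB G (n G) u v ∧ (suc (toℕ u) ≤ᵇ toℕ v))
      z = Fin.fromℕ< (≤-trans (s≤s z≤n) n≥3)
      first : rep z ≡ true
      first = cong not (any-false (λ u → reachB G (n G) u z ∧ (suc (toℕ u) ≤ᵇ toℕ z)) λ u →
        trans (cong (λ k → reachB G (n G) u z ∧ (suc (toℕ u) ≤ᵇ k)) (Fin.toℕ-fromℕ< (≤-trans (s≤s z≤n) n≥3)))
            (Bool.∧-zeroʳ _))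

  -- Five times Euler's formula, together with 5 F ≤ 2 |E| and at least one component, gives 3 |E| +
  -- 10 ≤ 5 |V|.
  forbidden-nonplanar : ∀ {H} → Forbidden H → ¬ Planar H
  forbidden-nonplanar {H} (n≥3 , _ , two , ¬short , dense) (ρ , rot , euler) = <⇒≱ dense (begin
      3 * m + 10             ≤⟨ by-≤ 0 combined (eq m N F c) ⟩
      5 * N                  ∎)
    where
    open Faces H n≥3 two ¬short ρ rot
    open ≤-Reasoning
    m = size H
    N = n H
    F = numFaces H ρ
    c = numComponents H
    euler′ : m + 2 * c ≤ N + F
    euler′ = ≤-reflexive (trans (cong (_+ 2 * c) (size≡numEdges H)) (trans (sym euler)
      (trans (cong (N + F +_) no-isolated) (+-identityʳ _))))
    combined : 5 * (m + 2 * c) + (F * 5 + 10 * 1) ≤ 5 * (N + F) + (2 * m + 10 * c)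
    combined = +-mono-≤ (*-monoʳ-≤ 5 euler′) (+-mono-≤ faces-bound (*-monoʳ-≤ 10 has-component))
    eq : ∀ m N F c → 3 * m + 10 + (5 * (N + F) + (2 * m + 10 * c)) + 0 ≡ 5 * N + (5 * (m + 2 * c) + (F * 5 + 10 * 1))
    eq = solve-∀

  -- Quotients and degrees

  Separates : Graph → Set
  Separates G = ∀ (Y : VSet (n G)) {v w : V G} → Y v ≡ true → Y w ≡ false → ∃ λ (a : V G) → ∃ λ (b : V G) → Y a ≡
      true × Y b ≡ false × adj G a b ≡ true

  Connected⇒Separates : ∀ G → Connected G → Separates G
  Connected⇒Separates G (_ , walks) Y {v} {w} Yv Yw with walk-crosses (walks v w) Y Yv Yw
  ... | a , b , (_ , Ya) , (_ , Yb) , ab = a , b , Ya , Yb , ab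

  opaque
    unfolding edgesOf

    ∈-edgesOf : ∀ G {a b} → ascending G a b ≡ true → (a , b) ∈ edgesOf G
    ∈-edgesOf G {a} {b} h = ∈-concat⁺′ (∈-concat⁺′ entry (∈-tabulate⁺ {f = row a} b)) (∈-tabulate⁺
        {f = λ u → List.concat (List.tabulate (row u))} a)
      where
      row : V G → V G → Edges (n G)
      row u v = if ascending G u v then (u , v) ∷ [] else []
      entry : (a , b) ∈ row a b
      entry rewrite h = Any.here refl

  crossing-strict : ∀ {N} (E : Edges N) {p q a b} → (∀ {x y} → p x ≡ p y → q x ≡ q y) →
                    (a , b) ∈ E → p a ≢ p b → q a ≡ q b → crossing E q full < crossing E p full
  crossing-coarser : ∀ {N} (E : Edges N) {p q} → (∀ {x y} → p x ≡ p y → q x ≡ q y) →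
                     crossing E q full ≤ crossing E p full
  crossing-coarser []            h = z≤n
  crossing-coarser ((x , y) ∷ E) {p} {q} h = +-mono-≤
    (χ-mono {not (eqb (q x) (q y))} {not (eqb (p x) (p y))} λ r → cong not (≢⇒eqb λ s → true≢false r
        (cong not (≡⇒eqb (h s)))))
    (crossing-coarser E h)
  crossing-strict ((x , y) ∷ E) {p} {q} h (Any.here refl) pa≢pb qa≡qb = subst₂ (λ c d → χ (not c) + crossing E q
      full < χ (not d) + crossing E p full)
    (sym (≡⇒eqb qa≡qb)) (sym (≢⇒eqb pa≢pb)) (s≤s (crossing-coarser E h))
  crossing-strict ((x , y) ∷ E) {p} {q} h (Any.there ab∈) pa≢pb qa≡qb = +-mono-≤-<
    (χ-mono {not (eqb (q x) (q y))} {not (eqb (p x) (p y))} λ r → cong not (≢⇒eqb λ s → true≢false r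
        (cong not (≡⇒eqb (h s)))))
    (crossing-strict E h ab∈ pa≢pb qa≡qb)

  -- Since `Y` is a union of classes, each edge of its cut joins two different classes.
  crossing-cut : ∀ G p Y → (∀ {x y} → p x ≡ p y → Y x ≡ Y y) → cut G (full ∩ Y) (full ∖ Y) ≤ crossing (edgesOf G)
      p full
  crossing-cut G p Y sat = +-cancelˡ-≤ (e E Y + e E (∁ Y)) _ _ (begin
      e E Y + e E (∁ Y) + cut G (full ∩ Y) (full ∖ Y)  ≡⟨ sym (e-cut G full Y) ⟩
      e E full                                         ≤⟨ go E ⟩
      e E Y + e E (∁ Y) + crossing E p full            ∎)
    where
    open ≤-Reasoning
    E = edgesOf G
    go : ∀ F → e F full ≤ e F Y + e F (∁ Y) + crossing F p full
    go [] = z≤n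
    go ((x , y) ∷ F) = begin
        1 + e F full
          ≤⟨ +-mono-≤ (edge (Y x) (Y y) refl refl) (go F) ⟩
        χ (Y x ∧ Y y) + χ (∁ Y x ∧ ∁ Y y) + χ (not (eqb (p x) (p y))) + (e F Y + e F (∁ Y) + crossing F p full)
          ≡⟨ eq (χ (Y x ∧ Y y)) (χ (∁ Y x ∧ ∁ Y y)) (χ (not (eqb (p x) (p y)))) (e F Y) (e F (∁ Y)) (crossing F p
              full) ⟩
        χ (Y x ∧ Y y) + e F Y + (χ (∁ Y x ∧ ∁ Y y) + e F (∁ Y)) + (χ (not (eqb (p x) (p y))) + crossing F p full) ∎
      where
      eq : ∀ a b c a′ b′ c′ → a + b + c + (a′ + b′ + c′) ≡ a + a′ + (b + b′) + (c + c′)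
      eq = solve-∀
      edge : ∀ s t → Y x ≡ s → Y y ≡ t → 1 ≤ χ (s ∧ t) + χ (not s ∧ not t) + χ (not (eqb (p x) (p y)))
      edge true  true  _ _ = s≤s z≤n
      edge false false _ _ = s≤s z≤n
      edge true  false Yx Yy = ≤-reflexive (cong (χ ∘ not) (sym (≢⇒eqb λ q → true≢false (trans (sym (sat q)) Yx) Yy)))
      edge false true  Yx Yy = ≤-reflexive (cong (χ ∘ not) (sym (≢⇒eqb λ q → true≢false (trans (sat q) Yy) Yx)))

  module Quotient (G : Graph) (sep : Separates G) where
    private E = edgesOf G

    glue : (p : V G → V G) → V G → V G → V G → V G
    glue p a b v = if eqb (p v) (p a) then p b else p v

    glue-coarser : ∀ p a b {x y} → p x ≡ p y → glue p a b x ≡ glue p a b y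
    glue-coarser p a b h = cong (λ l → if eqb l (p a) then p b else l) h

    glue-joins : ∀ p a b → glue p a b a ≡ glue p a b b
    glue-joins p a b = trans (cong (λ c → if c then p b else p a) (eqb-refl (p a))) (sym other)
      where
      other : glue p a b b ≡ p b
      other with eqb (p b) (p a)
      ... | true  = refl
      ... | false = refl

    classes-glue : ∀ p a b → classes full p ≤ suc (classes full (glue p a b))
    classes-glue p a b = begin
        classes full p
          ≤⟨ sum-mono pointwise ⟩
        ∑ (λ i → χ (eqb (p a) i) + χ (anyFin (cls full (glue p a b) i)))
          ≡⟨ trans (sum-+ (λ i → χ (eqb (p a) i)) _) (cong (_+ classes full (glue p a b)) (sum-pick₁ (p a))) ⟩
        suc (classes full (glue p a b)) ∎
      where
      open ≤-Reasoning
      pointwise : ∀ i → χ (anyFin (cls full p i)) ≤ χ (eqb (p a) i) + χ (anyFin (cls full (glue p a b) i))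
      pointwise i with p a Fin.≟ i
      ... | yes _ = ≤-trans (χ≤1 _) (m≤m+n 1 _)
      ... | no pa≢i = χ-mono λ h → let x , px = any-elim (cls full p i) h ; px≡i = eqb⇒≡ px in
              any-intro (cls full (glue p a b) i) x (≡⇒eqb (trans
                (cong (λ c → if c then p b else p x) (≢⇒eqb λ q → pa≢i (trans (sym q) px≡i))) px≡i))

    crossing-glue : ∀ p {a b} → adj G a b ≡ true → p a ≢ p b → crossing E (glue p a b) full < crossing E p full
    crossing-glue p {a} {b} ab pa≢pb with true-or-false (ascending G a b)
    ... | inj₁ asc = crossing-strict E {p} (glue-coarser p a b) (∈-edgesOf G asc) pa≢pb (glue-joins p a b)
    ... | inj₂ ¬asc = crossing-strict E {p} (glue-coarser p a b) (∈-edgesOf G desc) (pa≢pb ∘ sym)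
        (sym (glue-joins p a b))
      where
      desc : ascending G b a ≡ true
      desc with true-or-false (ascending G b a)
      ... | inj₁ q = q
      ... | inj₂ q = case trans (sym (cong χ ab)) (trans (adj-ascending G a b) (cong₂ (λ c d → χ c + χ d) ¬asc q)) of λ ()

    step? : ∀ p → (∃ λ a → ∃ λ b → adj G a b ≡ true × p a ≢ p b) ⊎ classes full p ≤ 1
    step? p with Fin.any? (λ x → Fin.any? λ y → ¬? (p x Fin.≟ p y))
    ... | yes (x , y , px≢py) with sep (λ v → eqb (p x) (p v)) {x} {y} (eqb-refl (p x)) (≢⇒eqb px≢py)
    ...   | a , b , Ya , Yb , ab = inj₁ (a , b , ab , λ q → true≢false (≡⇒eqb (trans (eqb⇒≡ Ya) q)) Yb)
    step? p | no same = inj₂ (one (search full))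
      where
      one : (∃ λ x → full {n G} x ≡ true) ⊎ (∀ x → full {n G} x ≡ false) → classes full p ≤ 1
      one (inj₁ (x , _)) = ≤-trans (≤-reflexive (sum-single _ (p x) λ i i≢px → cong χ (any-false (cls full p i) λ y →
        ≢⇒eqb λ q → case p x Fin.≟ p y of λ where
          (yes r) → i≢px (sym (trans r q))
          (no r)  → same (x , y , r)))) (χ≤1 _)
      one (inj₂ none) = ≤-trans (≤-reflexive (sum-0 λ i → cong χ (any-false (cls full p i) λ y → true≢false refl
          (none y)))) z≤n

    -- Contract crossing edges one by one: each step loses at most one class and at least one
    -- crossing edge, and connectedness supplies a crossing edge until one class is left.
    classes≤crossing+1 : ∀ p → classes full p ≤ suc (crossing E p full)
    classes≤crossing+1 p = go (crossing E p full) p ≤-refl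
      where
      go : ∀ k p → crossing E p full ≤ k → classes full p ≤ suc (crossing E p full)
      go k p h with step? p
      ... | inj₂ one = ≤-trans one (s≤s z≤n)
      ... | inj₁ (a , b , ab , pa≢pb) with k | crossing-glue p ab pa≢pb
      ...   | zero  | lt = ⊥-elim (n≮0 (<-≤-trans lt h))
      ...   | suc k | lt = ≤-trans (classes-glue p a b) (s≤s (≤-trans (go k (glue p a b) (≤-pred (≤-trans lt h))) lt))

    -- The same contraction, stopped at two classes: 2-edge-connectedness then provides two crossing
    -- edges instead of one.
    classes≤crossing : TwoEdge G full → ∀ p → 2 ≤ classes full p → classes full p ≤ crossing E p full
    classes≤crossing two p = go (crossing E p full) p ≤-refl
      where
      go : ∀ k p → crossing E p full ≤ k → 2 ≤ classes full p → classes full p ≤ crossing E p full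
      go k p h κ≥2 with step? p
      ... | inj₂ one = ⊥-elim (<⇒≱ κ≥2 one)
      ... | inj₁ (a , b , ab , pa≢pb) with 2 ≤? classes full (glue p a b)
      ...   | no small = ≤-trans (≤-trans (classes-glue p a b) (≰⇒> small))
                (≤-trans (two (λ v → eqb (p a) (p v)) {a} {b} refl refl (eqb-refl (p a)) (≢⇒eqb pa≢pb))
                   (crossing-cut G p (λ v → eqb (p a) (p v)) λ q → cong (eqb (p a)) q))
      ...   | yes big with k | crossing-glue p ab pa≢pb
      ...     | zero  | lt = ⊥-elim (n≮0 (<-≤-trans lt h))
      ...     | suc k | lt = ≤-trans (classes-glue p a b) (≤-trans (s≤s (go k (glue p a b) (≤-pred (≤-trans lt h))
          big)) lt)

  vertices≡ : ∀ {N} (X : VSet N) → vertices X ≡ ∑ (χ ∘ X)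
  vertices≡ X = sum-cong λ v → *-identityʳ (χ (X v))

  module Degrees (G : Graph) (X : VSet (n G)) where
    private
      E = edgesOf G
      s = vertices X
      m = e E X

    degIn-∁ : ∀ v → degIn G X v + degIn G (∁ X) v ≡ degree G v
    degIn-∁ v = trans (sym (sum-+ (λ w → χ (adj G v w ∧ X w)) _))
      (trans (sum-cong λ w → sym (χ-split (adj G v w) (X w))) (sym (degree≡ G v)))

    handshake-cut : Subcubic G → 2 * m + cut G X (∁ X) ≤ 3 * s
    handshake-cut cubic = begin
        2 * m + cut G X (∁ X)                        ≡⟨ cong₂ _+_ (sym (handshake G X)) (cut-degIn G X (∁ X)) ⟩
        σ (degIn G X) X + σ (degIn G (∁ X)) X        ≡⟨ sym (σ-+ (degIn G X) (degIn G (∁ X)) X) ⟩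
        σ (λ v → degIn G X v + degIn G (∁ X) v) X
          ≤⟨ sum-mono (λ v → ≤-trans (*-monoʳ-≤ (χ (X v)) (≤-trans (≤-reflexive (degIn-∁ v)) (cubic v)))
              (≤-reflexive (eq (χ (X v))))) ⟩
        ∑ (λ v → 3 * (χ (X v) * 1))                  ≡⟨ sum-* 3 (λ v → χ (X v) * 1) ⟩
        3 * s ∎
      where
      open ≤-Reasoning
      eq : ∀ x → x * 3 ≡ 3 * (x * 1)
      eq = solve-∀

    degree-sum : Subcubic G → 2 * m ≤ 3 * s
    degree-sum cubic = ≤-trans (m≤m+n _ _) (handshake-cut cubic)

    degIn≤ : Subcubic G → ∀ v → degIn G X v ≤ 3
    degIn≤ cubic v = ≤-trans (≤-trans (m≤m+n _ _) (≤-reflexive (degIn-∁ v))) (cubic v)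

    simple : 2 * m + s ≤ s * s
    simple = begin
        2 * m + s                                  ≡⟨ cong (_+ s) (sym (handshake G X)) ⟩
        σ (degIn G X) X + s                        ≡⟨ sym (σ-+ (degIn G X) (λ _ → 1) X) ⟩
        σ (λ v → degIn G X v + 1) X                ≤⟨ sum-mono pointwise ⟩
        ∑ (λ v → s * (χ (X v) * 1))                ≡⟨ sum-* s (λ v → χ (X v) * 1) ⟩
        s * s ∎
      where
      open ≤-Reasoning
      pointwise : ∀ v → χ (X v) * (degIn G X v + 1) ≤ s * (χ (X v) * 1)
      pointwise v with true-or-false (X v)
      ... | inj₂ q rewrite q = z≤n
      ... | inj₁ q = subst (λ c → χ c * (degIn G X v + 1) ≤ s * (χ c * 1)) (sym q) (begin
          degIn G X v + 1 + 0                      ≡⟨ +-identityʳ _ ⟩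
          degIn G X v + 1                          ≡⟨ cong (degIn G X v +_) (sym (sum-pick₁ v)) ⟩
          degIn G X v + ∑ (λ w → χ (eqb v w))      ≡⟨ sym (sum-+ (λ w → χ (adj G v w ∧ X w)) _) ⟩
          ∑ (λ w → χ (adj G v w ∧ X w) + χ (eqb v w)) ≤⟨ sum-mono one ⟩
          ∑ (χ ∘ X)                                ≡⟨ sym (vertices≡ X) ⟩
          s                                        ≡⟨ sym (*-identityʳ s) ⟩
          s * 1 ∎)
        where
        one : ∀ w → χ (adj G v w ∧ X w) + χ (eqb v w) ≤ χ (X w)
        one w with v Fin.≟ w
        ... | yes refl rewrite adj-irr G v | q = ≤-refl
        ... | no _ = ≤-trans (≤-reflexive (+-identityʳ _)) (χ-mono {adj G v w ∧ X w} λ h → proj₂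
            (∧-true {adj G v w} h))

    other-vertex : 2 ≤ s → ∀ v → ∃ λ w → X w ≡ true × w ≢ v
    other-vertex s≥2 v with search (λ w → X w ∧ not (eqb w v))
    ... | inj₁ (w , h) = w , proj₁ (∧-true {X w} h) , λ { refl → true≢false (proj₂ (∧-true {X w} h))
        (cong not (eqb-refl w)) }
    ... | inj₂ none = ⊥-elim (<⇒≱ s≥2 (≤-trans (≤-reflexive (trans (vertices≡ X) (sum-single _ v λ w w≢v → cong χ
        (¬true⇒false λ h →
            true≢false (∧-intro h (cong not (≢⇒eqb w≢v))) (none w))))) (χ≤1 (X v))))

    TwoEdge-degree : TwoEdge G X → 2 ≤ s → ∀ {v} → X v ≡ true → 2 ≤ degIn G X v
    TwoEdge-degree two s≥2 {v} Xv with other-vertex s≥2 v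
    ... | w , Xw , w≢v = begin
        2                                     ≤⟨ two (eqb v) {v} {w} Xv Xw (eqb-refl v) (≢⇒eqb (w≢v ∘ sym)) ⟩
        cut G (X ∩ eqb v) (X ∖ eqb v)         ≡⟨ cut-degIn G (X ∩ eqb v) (X ∖ eqb v) ⟩
        σ (degIn G (X ∖ eqb v)) (X ∩ eqb v)   ≡⟨ sum-single _ v (λ u u≢v → cong (λ c → χ c * degIn G (X ∖ eqb v) u)
                                                   (trans (cong (X u ∧_) (≢⇒eqb (u≢v ∘ sym))) (Bool.∧-zeroʳ (X u)))) ⟩
        χ (X v ∧ eqb v v) * degIn G (X ∖ eqb v) v ≤⟨ *-monoˡ-≤ _ (χ≤1 (X v ∧ eqb v v)) ⟩
        1 * degIn G (X ∖ eqb v) v             ≡⟨ +-identityʳ _ ⟩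
        degIn G (X ∖ eqb v) v                 ≤⟨ sum-mono (λ u → χ-mono {adj G v u ∧ (X ∖ eqb v) u} λ h → let a , b = ∧-true {adj G v u} h in ∧-intro a (proj₁ (∧-true {X u} b))) ⟩
        degIn G X v ∎
      where open ≤-Reasoning

    TwoEdge-edges : TwoEdge G X → 2 ≤ s → s ≤ m
    TwoEdge-edges two s≥2 = *-cancelˡ-≤ 2 (begin
        2 * s                          ≡⟨ sym (sum-* 2 (λ v → χ (X v) * 1)) ⟩
        ∑ (λ v → 2 * (χ (X v) * 1))    ≤⟨ sum-mono pointwise ⟩
        σ (degIn G X) X                ≡⟨ handshake G X ⟩
        2 * m ∎)
      where
      open ≤-Reasoning
      pointwise : ∀ v → 2 * (χ (X v) * 1) ≤ χ (X v) * degIn G X v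
      pointwise v with true-or-false (X v)
      ... | inj₂ q rewrite q = z≤n
      ... | inj₁ q = subst (λ c → 2 * (χ c * 1) ≤ χ c * degIn G X v) (sym q)
                       (≤-trans (TwoEdge-degree two s≥2 q) (≤-reflexive (sym (+-identityʳ _))))

    deficient : Subcubic G → ∀ {x y} → X x ≡ true → X y ≡ true → x ≢ y →
                degIn G X x ≤ 2 → degIn G X y ≤ 2 → 2 * m + 2 ≤ 3 * s
    deficient cubic {x} {y} Xx Xy x≢y dx dy = begin
        2 * m + 2
          ≡⟨ cong₂ _+_ (sym (handshake G X)) (sym (cong₂ _+_ (sum-pick₁ x) (sum-pick₁ y))) ⟩
        σ (degIn G X) X + (∑ (λ v → χ (eqb x v)) + ∑ (λ v → χ (eqb y v)))
          ≡⟨ trans (cong (σ (degIn G X) X +_) (sym (sum-+ (λ v → χ (eqb x v)) _)))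
              (sym (sum-+ (λ v → χ (X v) * degIn G X v) _)) ⟩
        ∑ (λ v → χ (X v) * degIn G X v + (χ (eqb x v) + χ (eqb y v)))
          ≤⟨ sum-mono pointwise ⟩
        ∑ (λ v → 3 * (χ (X v) * 1))
          ≡⟨ sum-* 3 (λ v → χ (X v) * 1) ⟩
        3 * s ∎
      where
      open ≤-Reasoning
      pointwise : ∀ v → χ (X v) * degIn G X v + (χ (eqb x v) + χ (eqb y v)) ≤ 3 * (χ (X v) * 1)
      pointwise v with x Fin.≟ v | y Fin.≟ v
      ... | yes refl | yes refl = ⊥-elim (x≢y refl)
      ... | yes refl | no _ rewrite Xx = ≤-trans (+-monoˡ-≤ 1 (≤-trans (≤-reflexive (+-identityʳ _)) dx)) ≤-refl
      ... | no _ | yes refl rewrite Xy = ≤-trans (+-monoˡ-≤ 1 (≤-trans (≤-reflexive (+-identityʳ _)) dy)) ≤-refl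
      ... | no _ | no _ = ≤-trans (≤-reflexive (+-identityʳ _)) (≤-trans (*-monoʳ-≤ (χ (X v)) (degIn≤ cubic v))
          (≤-reflexive (eq (χ (X v)))))
        where eq : ∀ x → x * 3 ≡ 3 * (x * 1)
              eq = solve-∀

    neighbours : ∀ {v} → 2 ≤ degIn G X v → ∃ λ a → ∃ λ b → a ≢ b × (adj G v a ≡ true × X a ≡ true) × (adj G v b ≡
        true × X b ≡ true)
    neighbours {v} d with 1≤∑ _ (≤-trans (s≤s z≤n) d)
    ... | a , 1≤a with search (λ b → (adj G v b ∧ X b) ∧ not (eqb b a))
    ...   | inj₁ (b , h) = a , b , (λ { refl → true≢false (proj₂ (∧-true {adj G v b ∧ X b} h))
        (cong not (eqb-refl b)) }) ,
              ∧-true (χ-true 1≤a) , ∧-true (proj₁ (∧-true {adj G v b ∧ X b} h))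
      where
      χ-true : ∀ {c} → 1 ≤ χ c → c ≡ true
      χ-true {true} _ = refl
    ...   | inj₂ none = ⊥-elim (<⇒≱ d (≤-trans (≤-reflexive (sum-single _ a λ b b≢a → cong χ (¬true⇒false λ h →
              true≢false (∧-intro h (cong not (≢⇒eqb b≢a))) (none b)))) (χ≤1 _)))

    -- Without a common neighbour the two neighbourhoods would be disjoint subsets of X.
    common-neighbour : ∀ {u v} → X u ≡ true → X v ≡ true → adj G u v ≡ true → s < degIn G X u + degIn G X v →
        Triangle G X
    common-neighbour {u} {v} Xu Xv uv h with search (λ w → X w ∧ (adj G u w ∧ adj G v w))
    ... | inj₁ (w , q) = let Xw , r = ∧-true {X w} q ; uw , vw = ∧-true {adj G u w} r in u , v , w , (Xu , Xv , Xw) , uv , vw , uw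
    ... | inj₂ none = ⊥-elim (<⇒≱ h (begin
        degIn G X u + degIn G X v                               ≡⟨ sym (sum-+ (λ w → χ (adj G u w ∧ X w)) _) ⟩
        ∑ (λ w → χ (adj G u w ∧ X w) + χ (adj G v w ∧ X w))     ≤⟨ sum-mono (λ w → pointwise (X w) (adj G u w)
            (adj G v w) (none w)) ⟩
        ∑ (χ ∘ X)                                               ≡⟨ sym (vertices≡ X) ⟩
        s ∎))
      where
      open ≤-Reasoning
      pointwise : ∀ x a b → x ∧ (a ∧ b) ≡ false → χ (a ∧ x) + χ (b ∧ x) ≤ χ x
      pointwise true  true  false _ = ≤-refl
      pointwise true  false b     _ = χ≤1 _
      pointwise false true  true  _ = z≤n
      pointwise false true  false _ = z≤n
      pointwise false false true  _ = z≤n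
      pointwise false false false _ = z≤n

    -- By `deficient`, at most one vertex of X has fewer than three neighbours in X. Hence some
    -- adjacent pair has three neighbours each, and six exceeds the size of X.
    dense-triangle : Subcubic G → TwoEdge G X → ∀ {v} → X v ≡ true → 2 ≤ s → s ≤ 5 → 3 * s ≤ 2 * m + 1 → Triangle G X
    dense-triangle cubic two {v₀} Xv₀ s≥2 s≤5 dense = go (3 ≤? degIn G X v₀)
      where
      two-of : ∀ {x y} → X x ≡ true → X y ≡ true → x ≢ y → ¬ (3 ≤ degIn G X x) → 3 ≤ degIn G X y
      two-of {x} {y} Xx Xy x≢y dx with 3 ≤? degIn G X y
      ... | yes dy = dy
      ... | no dy  = ⊥-elim (<-irrefl refl (<-≤-trans (s≤s dense)
              (≤-trans (≤-reflexive (sym (+-suc (2 * m) 1))) (deficient cubic Xx Xy x≢y (≤-pred (≰⇒> dx))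
                  (≤-pred (≰⇒> dy))))))
      cubic-vertex : ∀ {v} → X v ≡ true → 3 ≤ degIn G X v → Triangle G X
      cubic-vertex {v} Xv dv with neighbours (≤-trans (n≤1+n 2) dv)
      ... | a , b , a≢b , (va , Xa) , (vb , Xb) with 3 ≤? degIn G X a
      ...   | yes da = common-neighbour Xv Xa va (≤-trans (s≤s s≤5) (+-mono-≤ dv da))
      ...   | no da  = common-neighbour Xv Xb vb (≤-trans (s≤s s≤5) (+-mono-≤ dv (two-of Xa Xb a≢b da)))
      go : Dec (3 ≤ degIn G X v₀) → Triangle G X
      go (yes d) = cubic-vertex Xv₀ d
      go (no d) with neighbours (TwoEdge-degree two s≥2 Xv₀)
      ... | a , _ , _ , (va , Xa) , _ = cubic-vertex Xa (two-of Xv₀ Xa (adj⇒≢ G va) d)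

  -- Weights of classes

  -- What is needed about s = |X| and m = e(X). Where parity needs no correction, the weight
  -- vanishes. Otherwise 3 m + 10 - 5 s is the excess over the bound: its maximum 8 belongs to K4,
  -- the value 6 is attained by two further pairs, and two missing units of degree force it down to
  -- 4.
  Small : ℕ → ℕ → Set
  Small s m = 2 * m ≤ 3 * s → 2 * m + s ≤ s * s → (2 ≤ s → s ≤ m) → 1 ≤ s →
    (par (s + (m + 1)) ≡ 0 → 3 * m + 3 ≤ 5 * s) ×
    (par (s + (m + 1)) ≡ 1 → 3 ≤ s × 3 * m + 10 ≤ 5 * s + 8 ×
      (5 * s + 6 ≤ 3 * m + 10 → (s ≡ 4 × m ≡ 6) ⊎ (s ≡ 5 × m ≡ 7) ⊎ (s ≡ 8 × m ≡ 12)) ×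
      (5 * s + 7 ≤ 3 * m + 10 → s ≡ 4 × m ≡ 6) ×
      (2 * m + 2 ≤ 3 * s → 3 * m + 10 ≤ 5 * s + 4))

  small? : ∀ s m → Dec (Small s m)
  small? s m = (2 * m ≤? 3 * s) →-dec ((2 * m + s ≤? s * s) →-dec (((2 ≤? s) →-dec (s ≤? m)) →-dec ((1 ≤? s) →-dec
    (((par (s + (m + 1)) ≟ 0) →-dec (3 * m + 3 ≤? 5 * s)) ×-dec
     ((par (s + (m + 1)) ≟ 1) →-dec ((3 ≤? s) ×-dec ((3 * m + 10 ≤? 5 * s + 8) ×-dec
      (((5 * s + 6 ≤? 3 * m + 10) →-dec (((s ≟ 4) ×-dec (m ≟ 6)) ⊎-dec (((s ≟ 5) ×-dec (m ≟ 7)) ⊎-dec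
          ((s ≟ 8) ×-dec (m ≟ 12))))) ×-dec
      (((5 * s + 7 ≤? 3 * m + 10) →-dec ((s ≟ 4) ×-dec (m ≟ 6))) ×-dec
      ((2 * m + 2 ≤? 3 * s) →-dec (3 * m + 10 ≤? 5 * s + 4)))))))))))

  opaque
    small-all : ∀ {s} → s < 20 → ∀ {m} → m < 29 → Small s m
    -- A finite check: 2 m ≤ 3 s with s at most 19 leaves m at most 28.
    small-all = toWitness {a? = allUpTo? (λ s → allUpTo? (small? s) 29) 20} _

  small : ∀ {s} m → s < 20 → Small s m
  small {s} m s<20 d = small-all s<20 (*-cancelˡ-< 2 m 29 (s≤s (≤-trans d (≤-trans (*-monoʳ-≤ 3 (≤-pred s<20))
      ≤-refl)))) d

  -- The origin of the bound 20: with 2 m ≤ 3 s, twice the left side is at most 9 s + 20, and this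
  -- is at most 10 s from s = 20 on.
  large : ∀ {s m} → 20 ≤ s → 2 * m ≤ 3 * s → 3 * m + 10 ≤ 5 * s
  large {s} {m} s≥20 d = *-cancelˡ-≤ 2 (by-≤ 0 (+-mono-≤ (*-monoʳ-≤ 3 d) s≥20) (eq s m))
    where eq : ∀ s m → 2 * (3 * m + 10) + (3 * (3 * s) + s) + 0 ≡ 2 * (5 * s) + (3 * (2 * m) + 20)
          eq = solve-∀

  -- Over a partition with connected quotient the bounds 4 e + 5 |X| + 4 sum up to at most 4 |E| + 5 |V| + 4, so the
  -- weights bound 14 times the excess of φ over (2 |E| − |V| + 2) / 7. Truncated: classes within the bound weigh 0.
  weight : ∀ G → VSet (n G) → ℕ
  weight G X = 7 * demand (edgesOf G) (λ _ → 1) X ∸ (4 * e (edgesOf G) X + 5 * vertices X + 4 * χ (anyFin X))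

  record Dense (G : Graph) (X : VSet (n G)) : Set where
    private
      s = vertices X
      m = e (edgesOf G) X
    field
      inhabited : anyFin X ≡ true
      odd       : par (s + (m + 1)) ≡ 1
      bounded   : s < 20
      dense     : 5 * s < 3 * m + 10
      weighs    : weight G X + 5 * s ≡ 3 * m + 10
      numbers   : 3 ≤ s × 3 * m + 10 ≤ 5 * s + 8 ×
        (5 * s + 6 ≤ 3 * m + 10 → (s ≡ 4 × m ≡ 6) ⊎ (s ≡ 5 × m ≡ 7) ⊎ (s ≡ 8 × m ≡ 12)) ×
        (5 * s + 7 ≤ 3 * m + 10 → s ≡ 4 × m ≡ 6) ×
        (2 * m + 2 ≤ 3 * s → 3 * m + 10 ≤ 5 * s + 4)

  weight-dense : ∀ G → Subcubic G → ∀ X → TwoEdge G X → 0 < weight G X → Dense G X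
  weight-dense G cubic X two w>0 = record
      { inhabited = ne ; odd = odd ; bounded = bounded ; dense = dense ; weighs = weighs ; numbers = proj₂ numbers
          odd }
    where
    s = vertices X
    m = e (edgesOf G) X
    P = par (s + (m + 1))
    open Degrees G X
    ne : anyFin X ≡ true
    ne with true-or-false (anyFin X)
    ... | inj₁ q = q
    ... | inj₂ q = ⊥-elim (n≮0 (≤-trans w>0 (≤-reflexive (trans
          (cong (λ c → 7 * (χ c * (m + 1 + P)) ∸ (4 * m + 5 * s + 4 * χ (anyFin X))) q) (0∸n≡0 (4 * m + 5 * s + 4
              * χ (anyFin X)))))))
    w≡ : weight G X ≡ 7 * (m + 1 + P) ∸ (4 * m + 5 * s + 4)
    w≡ = trans (cong (λ c → 7 * (χ c * (m + 1 + P)) ∸ (4 * m + 5 * s + 4 * χ c)) ne)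
      (cong (λ c → 7 * c ∸ (4 * m + 5 * s + 4)) (+-identityʳ (m + 1 + P)))
    exceeds : 4 * m + 5 * s + 4 < 7 * (m + 1 + P)
    exceeds with 4 * m + 5 * s + 4 <? 7 * (m + 1 + P)
    ... | yes q = q
    ... | no q  = ⊥-elim (n≮0 (≤-trans w>0 (≤-reflexive (trans w≡ (m≤n⇒m∸n≡0 (≮⇒≥ q))))))
    s≥1 : 1 ≤ s
    s≥1 = let v , Xv = any-elim X ne in ≤-trans (≤-reflexive (sym (cong (λ c → χ c * 1) Xv))) (term≤sum (λ v → χ (X v) * 1) v)
    dense′ : 5 * s < 3 * m + 10
    dense′ = +-cancelˡ-< (4 * m + 4) _ _ (begin-strict
        4 * m + 4 + 5 * s      ≡⟨ eq₁ m s ⟩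
        4 * m + 5 * s + 4      <⟨ exceeds ⟩
        7 * (m + 1 + P)        ≤⟨ *-monoʳ-≤ 7 (+-monoʳ-≤ (m + 1) (par≤1 (s + (m + 1)))) ⟩
        7 * (m + 1 + 1)        ≡⟨ eq₂ m ⟩
        4 * m + 4 + (3 * m + 10) ∎)
      where
      open ≤-Reasoning
      eq₁ : ∀ m s → 4 * m + 4 + 5 * s ≡ 4 * m + 5 * s + 4
      eq₁ = solve-∀
      eq₂ : ∀ m → 7 * (m + 1 + 1) ≡ 4 * m + 4 + (3 * m + 10)
      eq₂ = solve-∀
    bounded : s < 20
    bounded with s <? 20
    ... | yes q = q
    ... | no q  = ⊥-elim (<⇒≱ dense′ (large {s} {m} (≮⇒≥ q) (degree-sum cubic)))
    numbers = small {s} m bounded (degree-sum cubic) simple (TwoEdge-edges two) s≥1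
    odd : P ≡ 1
    odd = cases P refl (par≤1 (s + (m + 1)))
      where
      cases : ∀ k → P ≡ k → k ≤ 1 → P ≡ 1
      -- Without a parity correction the demand is only e + 1, and the first clause of `Small` puts
      -- it within the bound.
      cases 0 q _ = ⊥-elim (<⇒≱ exceeds (≤-trans (≤-reflexive (trans (cong (λ k → 7 * (m + 1 + k)) q) (eq m)))
          (≤-trans (+-monoʳ-≤ (4 * m + 4) (proj₁ numbers q)) (≤-reflexive (eq′ m s)))))
        where eq : ∀ m → 7 * (m + 1 + 0) ≡ 4 * m + 4 + (3 * m + 3)
              eq = solve-∀
              eq′ : ∀ m s → 4 * m + 4 + 5 * s ≡ 4 * m + 5 * s + 4
              eq′ = solve-∀
      cases 1 q _ = q
      cases (suc (suc _)) _ (s≤s ())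
    dense = dense′
    weighs : weight G X + 5 * s ≡ 3 * m + 10
    weighs = +-cancelˡ-≡ (4 * m + 4) _ _ (begin
        4 * m + 4 + (weight G X + 5 * s)          ≡⟨ eq₁ m s (weight G X) ⟩
        weight G X + (4 * m + 5 * s + 4)          ≡⟨ cong (_+ (4 * m + 5 * s + 4)) w≡ ⟩
        7 * (m + 1 + P) ∸ (4 * m + 5 * s + 4) + (4 * m + 5 * s + 4) ≡⟨ m∸n+n≡m (<⇒≤ exceeds) ⟩
        7 * (m + 1 + P)                           ≡⟨ cong (λ k → 7 * (m + 1 + k)) odd ⟩
        7 * (m + 1 + 1)                           ≡⟨ eq₂ m ⟩
        4 * m + 4 + (3 * m + 10)                  ∎)
      where
      open ≡-Reasoning
      eq₁ : ∀ m s w → 4 * m + 4 + (w + 5 * s) ≡ w + (4 * m + 5 * s + 4)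
      eq₁ = solve-∀
      eq₂ : ∀ m → 7 * (m + 1 + 1) ≡ 4 * m + 4 + (3 * m + 10)
      eq₂ = solve-∀

  module Partition (G : Graph) where
    private E = edgesOf G

    p : V G → V G
    p = finest E (λ _ → 1) full

    C : V G → VSet (n G)
    C = cls full p

    Γ : ℕ
    Γ = Φ (demand E (λ _ → 1)) full p

    ω : V G → ℕ
    ω i = weight G (C i)

    C-disjoint : ∀ {i j v} → i ≢ j → C i v ≡ true → C j v ≡ true → ⊥
    C-disjoint i≢j a b = i≢j (trans (sym (eqb⇒≡ a)) (eqb⇒≡ b))

    C-TwoEdge : ∀ i → TwoEdge G (C i)
    C-TwoEdge = class-TwoEdge G (λ _ → 1) full

    -- Crossing edges are added on the left so that on the right they complete the inner edges of
    -- the classes to all edges of G.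
    Γ-bound : 7 * Γ + 4 * crossing E p full ≤ 4 * size G + 5 * n G + 4 * classes full p + ∑ ω
    Γ-bound = begin
        7 * Γ + 4 * A
          ≡⟨ cong (_+ 4 * A) (sym (sum-* 7 (λ i → demand E (λ _ → 1) (C i)))) ⟩
        ∑ (λ i → 7 * demand E (λ _ → 1) (C i)) + 4 * A
          ≤⟨ +-monoˡ-≤ (4 * A) (sum-mono λ i → m≤n+m∸n _ (4 * e E (C i) + 5 * vertices (C i) + 4 * χ
              (anyFin (C i)))) ⟩
        ∑ (λ i → 4 * e E (C i) + 5 * vertices (C i) + 4 * χ (anyFin (C i)) + ω i) + 4 * A
          ≡⟨ cong (_+ 4 * A) sums ⟩
        4 * ∑ (λ i → e E (C i)) + 5 * n G + 4 * classes full p + ∑ ω + 4 * A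
          ≡⟨ eq (∑ (λ i → e E (C i))) A (5 * n G) (4 * classes full p) (∑ ω) ⟩
        4 * (∑ (λ i → e E (C i)) + A) + 5 * n G + 4 * classes full p + ∑ ω
          ≡⟨ cong (λ m → 4 * m + 5 * n G + 4 * classes full p + ∑ ω) (sym (e-split E p full)) ⟩
        4 * size G + 5 * n G + 4 * classes full p + ∑ ω ∎
      where
      open ≤-Reasoning
      A = crossing E p full
      eq : ∀ m A x y w → 4 * m + x + y + w + 4 * A ≡ 4 * (m + A) + x + y + w
      eq = solve-∀
      total-vertices : ∑ (λ i → vertices (C i)) ≡ n G
      total-vertices = trans (sym (σ-split (λ _ → 1) p full)) (trans (sum-const 1) (*-identityʳ (n G)))
      sums : ∑ (λ i → 4 * e E (C i) + 5 * vertices (C i) + 4 * χ (anyFin (C i)) + ω i) ≡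
             4 * ∑ (λ i → e E (C i)) + 5 * n G + 4 * classes full p + ∑ ω
      sums = trans (sum-+ (λ i → 4 * e E (C i) + 5 * vertices (C i) + 4 * χ (anyFin (C i))) ω) (cong (_+ ∑ ω)
        (trans (sum-+ (λ i → 4 * e E (C i) + 5 * vertices (C i)) (λ i → 4 * χ (anyFin (C i)))) (cong₂ _+_
          (trans (sum-+ (λ i → 4 * e E (C i)) (λ i → 5 * vertices (C i))) (cong₂ _+_ (sum-* 4 (λ i → e E (C i)))
            (trans (sum-* 5 (λ i → vertices (C i))) (cong (5 *_) total-vertices))))
          (sum-* 4 (λ i → χ (anyFin (C i)))))))

  -- Short cycles and the classes of largest weight

  ∑-unique : ∀ {k} (f : Fin k → ℕ) → (∀ {i j} → 0 < f i → 0 < f j → i ≡ j) →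
             ∑ f ≡ 0 ⊎ ∃ λ i → 0 < f i × ∑ f ≡ f i
  ∑-unique f uniq with Fin.any? (λ i → 0 <? f i)
  ... | no none = inj₁ (sum-0 λ i → n<1⇒n≡0 (≰⇒> λ q → none (i , q)))
  ... | yes (i , fi) = inj₂ (i , fi , sum-single f i λ j j≢i → n<1⇒n≡0 (≰⇒> λ q → j≢i (uniq q fi)))

  Short-cycle : ∀ G X → Short G X → ∃ λ c → IsCycle G c × List.length c < 5 × (∀ v → v ∈ c → X v ≡ true)
  Short-cycle G X (inj₁ (a , b , c , (Xa , Xb , Xc) , (ab , bc , ac))) =
      a ∷ b ∷ c ∷ [] ,
      (s≤s (s≤s z≤n) , ((adj⇒≢ G ab ∷ adj⇒≢ G ac ∷ []) ∷ (adj⇒≢ G bc ∷ []) ∷ [] ∷ []) , ≡⇒T ab , ≡⇒T bc , ≡⇒T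
          (trans (adj-sym G c a) ac) , _) ,
      ≤-refl-suc , λ { _ (here refl) → Xa ; _ (there (here refl)) → Xb ; _ (there (there (here refl))) → Xc }
    where
    ≤-refl-suc : 3 < 5
    ≤-refl-suc = n≤1+n 4
  Short-cycle G X (inj₂ (a , b , c , d , (Xa , Xb , Xc , Xd) , (a≢c , b≢d) , (ab , bc , cd , da))) =
      a ∷ b ∷ c ∷ d ∷ [] ,
      (s≤s (s≤s z≤n) , ((adj⇒≢ G ab ∷ a≢c ∷ (adj⇒≢ G da ∘ sym) ∷ []) ∷ (adj⇒≢ G bc ∷ b≢d ∷ []) ∷ (adj⇒≢ G cd ∷ [])
          ∷ [] ∷ []) ,
       ≡⇒T ab , ≡⇒T bc , ≡⇒T cd , ≡⇒T da , _) ,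
      ≤-refl , λ { _ (here refl) → Xa ; _ (there (here refl)) → Xb ; _ (there (there (here refl))) → Xc ; _
          (there (there (there (here refl)))) → Xd }

  disjoint-Short : ∀ G {X Y} → Short G X → Short G Y → (∀ {v} → X v ≡ true → Y v ≡ true → ⊥) →
      TwoDisjointShortCycles G
  disjoint-Short G {X} {Y} sX sY disj with Short-cycle G X sX | Short-cycle G Y sY
  ... | c , cyc , len , c⊆X | d , cyd , len′ , d⊆Y = c , d , cyc , cyd , len , len′ , λ x x∈c x∈d → disj
      (c⊆X x x∈c) (d⊆Y x x∈d)

  girth⇒¬Short : ∀ G → GirthAtLeast5 G → ∀ X → ¬ Short G X
  girth⇒¬Short G girth X s with Short-cycle G X s
  ... | c , cyc , len , _ = <⇒≱ len (girth c cyc)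

  allB : (Bool → Bool) → Bool
  allB P = P true ∧ P false

  allB-elim : ∀ P → allB P ≡ true → ∀ b → P b ≡ true
  allB-elim P h true  = proj₁ (∧-true h)
  allB-elim P h false = proj₂ (∧-true {P true} h)

  ∨-true : ∀ a {b} → a ∨ b ≡ true → a ≡ true ⊎ b ≡ true
  ∨-true true  _ = inj₁ refl
  ∨-true false h = inj₂ h

  -- The arguments are the edges 01, 02, 03, 12, 13, 23 of K4; the disjuncts are its four triangles
  -- and three squares.
  four-cycle : Bool → Bool → Bool → Bool → Bool → Bool → Bool
  four-cycle a b c d f g =
    (a ∧ (d ∧ b)) ∨ ((a ∧ (f ∧ c)) ∨ ((b ∧ (g ∧ c)) ∨ ((d ∧ (g ∧ f)) ∨
    ((a ∧ (d ∧ (g ∧ c))) ∨ ((a ∧ (f ∧ (g ∧ b))) ∨ (b ∧ (d ∧ (f ∧ c))))))))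

  four-edges : ∀ a b c d f g → 4 ≤ χ a + χ b + χ c + χ d + χ f + χ g → four-cycle a b c d f g ≡ true
  -- The `refl` evaluates all 64 cases.
  four-edges a b c d f g h = use (allB-elim (P a b c d f)
      (allB-elim (λ f → allB (P a b c d f)) (allB-elim (λ d → allB λ f → allB (P a b c d f))
      (allB-elim (λ c → allB λ d → allB λ f → allB (P a b c d f)) (allB-elim (λ b → allB λ c → allB λ d → allB λ f
          → allB (P a b c d f))
      (allB-elim (λ a → allB λ b → allB λ c → allB λ d → allB λ f → allB (P a b c d f)) refl a) b) c) d) f) g)
    where
    P : Bool → Bool → Bool → Bool → Bool → Bool → Bool
    P a b c d f g = not (4 ≤ᵇ χ a + χ b + χ c + χ d + χ f + χ g) ∨ four-cycle a b c d f g
    use : P a b c d f g ≡ true → four-cycle a b c d f g ≡ true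
    use q with ∨-true (not (4 ≤ᵇ χ a + χ b + χ c + χ d + χ f + χ g)) q
    ... | inj₂ r = r
    ... | inj₁ r = true≢false (T⇒≡ (≤⇒≤ᵇ h)) (not-true r)

  four-vertices : ∀ H → n H ≡ 4 → 4 ≤ size H → Short H full
  four-vertices H@(mkGraph .4 adj sy ir) refl h = go (four-edges x01 x02 x03 x12 x13 x23 (subst (4 ≤_)
      (trans (size≡numEdges H) edges) h))
    where
    v0 v1 v2 v3 : Fin 4
    v0 = fz ; v1 = fs fz ; v2 = fs (fs fz) ; v3 = fs (fs (fs fz))
    x01 = adj v0 v1 ; x02 = adj v0 v2 ; x03 = adj v0 v3 ; x12 = adj v1 v2 ; x13 = adj v1 v3 ; x23 = adj v2 v3
    edges : numEdges H ≡ χ x01 + χ x02 + χ x03 + χ x12 + χ x13 + χ x23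
    edges rewrite Bool.∧-zeroʳ (adj v0 v0) | Bool.∧-zeroʳ (adj v1 v0) | Bool.∧-zeroʳ (adj v2 v0) | Bool.∧-zeroʳ
        (adj v3 v0)
                | Bool.∧-zeroʳ (adj v1 v1) | Bool.∧-zeroʳ (adj v2 v1) | Bool.∧-zeroʳ (adj v3 v1)
                | Bool.∧-zeroʳ (adj v2 v2) | Bool.∧-zeroʳ (adj v3 v2) | Bool.∧-zeroʳ (adj v3 v3)
                | Bool.∧-identityʳ x01 | Bool.∧-identityʳ x02 | Bool.∧-identityʳ x03
                | Bool.∧-identityʳ x12 | Bool.∧-identityʳ x13 | Bool.∧-identityʳ x23 = eq (χ x01) (χ x02) (χ x03)
                    (χ x12) (χ x13) (χ x23)
      where eq : ∀ a b c d f g → a + (b + (c + 0)) + (d + (f + 0) + (g + 0 + 0)) ≡ a + b + c + d + f + g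
            eq = solve-∀
    tri : ∀ {a b c} → adj a b ∧ (adj b c ∧ adj a c) ≡ true → Short H full
    tri {a} {b} {c} q = let ab , r = ∧-true {adj a b} q ; bc , ac = ∧-true {adj b c} r in
      inj₁ (a , b , c , (refl , refl , refl) , ab , bc , ac)
    sq : ∀ {a b c d} → a ≢ c → b ≢ d → adj a b ∧ (adj b c ∧ (adj c d ∧ adj d a)) ≡ true → Short H full
    sq {a} {b} {c} {d} a≢c b≢d q = let ab , r = ∧-true {adj a b} q ; bc , t = ∧-true {adj b c} r ; cd , da = ∧-true {adj c d} t in
      inj₂ (a , b , c , d , (refl , refl , refl , refl) , (a≢c , b≢d) , ab , bc , cd , da)
    go : four-cycle x01 x02 x03 x12 x13 x23 ≡ true → Short H full
    go q with ∨-true (x01 ∧ (x12 ∧ x02)) q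
    ... | inj₁ r = tri {v0} {v1} {v2} r
    ... | inj₂ q with ∨-true (x01 ∧ (x13 ∧ x03)) q
    ... | inj₁ r = tri {v0} {v1} {v3} r
    ... | inj₂ q with ∨-true (x02 ∧ (x23 ∧ x03)) q
    ... | inj₁ r = tri {v0} {v2} {v3} r
    ... | inj₂ q with ∨-true (x12 ∧ (x23 ∧ x13)) q
    ... | inj₁ r = tri {v1} {v2} {v3} r
    ... | inj₂ q with ∨-true (x01 ∧ (x12 ∧ (x23 ∧ x03))) q
    ... | inj₁ r = sq {v0} {v1} {v2} {v3} (λ ()) (λ ()) (subst (λ c → x01 ∧ (x12 ∧ (x23 ∧ c)) ≡ true) (sy v0 v3) r)
    ... | inj₂ q with ∨-true (x01 ∧ (x13 ∧ (x23 ∧ x02))) q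
    ... | inj₁ r = sq {v0} {v1} {v3} {v2} (λ ()) (λ ()) (subst₂ (λ c d → x01 ∧ (x13 ∧ (c ∧ d)) ≡ true) (sy v2 v3)
        (sy v0 v2) r)
    ... | inj₂ r = sq {v0} {v2} {v1} {v3} (λ ()) (λ ()) (subst₂ (λ c d → x02 ∧ (c ∧ (x13 ∧ d)) ≡ true) (sy v1 v2)
        (sy v0 v3) r)

  whole-component : ∀ G X → Separates G → anyFin X ≡ true → cut G X (∁ X) ≡ 0 → ∀ v → X v ≡ true
  whole-component G X sep ne cut≡0 v = ¬false⇒true λ Xv → let
      u , Xu = any-elim X ne
      a , b , Xa , Xb , ab = sep X Xu Xv
    in <⇒≱ (cut≥1 G {X} {∁ X} Xa (cong not Xb) ab) (≤-reflexive cut≡0)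

  vertices-full : ∀ {N} {X : VSet N} → (∀ v → X v ≡ true) → N ≡ vertices X
  vertices-full {N} {X} all = sym (trans (sum-cong λ v → cong (λ c → χ c * 1) (all v)) (trans (sum-const 1)
      (*-identityʳ N)))

  complete⇒K4 : ∀ G → n G ≡ 4 → (∀ x y → x ≢ y → adj G x y ≡ true) → Isomorphic G K4
  complete⇒K4 (mkGraph .4 adj _ irr) refl complete = ⤖-id (Fin 4) , same
    where
    same : ∀ x y → adj x y ≡ not (eqb x y)
    same x y with x Fin.≟ y
    ... | yes refl = irr x
    ... | no x≢y   = complete x y x≢y

  -- Six edges use up all degrees of four subcubic vertices, so no edge leaves X and by
  -- connectedness X is everything. Every vertex then has degree 3 among three possible neighbours.
  dense⇒K4 : ∀ G X → Subcubic G → Separates G → anyFin X ≡ true → vertices X ≡ 4 → e (edgesOf G) X ≡ 6 →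
      Isomorphic G K4
  dense⇒K4 G X cubic sep ne s≡4 m≡6 = complete⇒K4 G n≡4 λ x y x≢y → ¬false⇒true (missing x y x≢y)
    where
    open Degrees G X
    cut≡0 : cut G X (∁ X) ≡ 0
    cut≡0 = n≤0⇒n≡0 (+-cancelˡ-≤ 12 _ _ (subst₂ (λ m s → 2 * m + cut G X (∁ X) ≤ 3 * s) m≡6 s≡4 (handshake-cut
        cubic)))
    all = whole-component G X sep ne cut≡0
    n≡4 = trans (vertices-full all) s≡4
    missing : ∀ x y → x ≢ y → ¬ (adj G x y ≡ false)
    missing x y x≢y xy = <⇒≱ {4} {5} ≤-refl (begin
        3 + 2
          ≤⟨ +-monoˡ-≤ 2 (≮⇒≥ λ d → <⇒≱ {12} {13} ≤-refl
               (subst₂ (λ m s → 2 * m + 1 ≤ 3 * s) m≡6 s≡4 (deficient₁ x (≤-pred d)))) ⟩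
        degIn G X x + 2
          ≡⟨ cong (degIn G X x +_) (sym (cong₂ _+_ (sum-pick₁ x) (sum-pick₁ y))) ⟩
        degIn G X x + (∑ (λ w → χ (eqb x w)) + ∑ (λ w → χ (eqb y w)))
          ≡⟨ trans (cong (degIn G X x +_) (sym (sum-+ (λ w → χ (eqb x w)) _)))
              (sym (sum-+ (λ w → χ (adj G x w ∧ X w)) _)) ⟩
        ∑ (λ w → χ (adj G x w ∧ X w) + (χ (eqb x w) + χ (eqb y w)))
          ≤⟨ sum-mono pointwise ⟩
        ∑ (λ _ → 1)
          ≡⟨ trans (sum-const 1) (trans (*-identityʳ (n G)) n≡4) ⟩
        4 ∎)
      where
      open ≤-Reasoning
      pointwise : ∀ w → χ (adj G x w ∧ X w) + (χ (eqb x w) + χ (eqb y w)) ≤ 1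
      pointwise w with x Fin.≟ w | y Fin.≟ w
      ... | yes refl | yes refl = ⊥-elim (x≢y refl)
      ... | yes refl | no _ rewrite adj-irr G x = ≤-refl
      ... | no _ | yes refl rewrite xy = ≤-refl
      ... | no _ | no _ = ≤-trans (≤-reflexive (+-identityʳ _)) (χ≤1 _)
      deficient₁ : ∀ x → degIn G X x ≤ 2 → 2 * e (edgesOf G) X + 1 ≤ 3 * vertices X
      deficient₁ x d = begin
        2 * e (edgesOf G) X + 1
          ≡⟨ cong₂ _+_ (sym (handshake G X)) (sym (sum-pick₁ x)) ⟩
        σ (degIn G X) X + ∑ (λ v → χ (eqb x v))
          ≡⟨ sym (sum-+ (λ v → χ (X v) * degIn G X v) _) ⟩
        ∑ (λ v → χ (X v) * degIn G X v + χ (eqb x v))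
          ≤⟨ sum-mono at ⟩
        ∑ (λ v → 3 * (χ (X v) * 1))
          ≡⟨ sum-* 3 (λ v → χ (X v) * 1) ⟩
        3 * vertices X ∎
        where
        at : ∀ v → χ (X v) * degIn G X v + χ (eqb x v) ≤ 3 * (χ (X v) * 1)
        at v rewrite all v with x Fin.≟ v
        ... | yes refl = ≤-trans (+-monoˡ-≤ 1 (≤-trans (≤-reflexive (+-identityʳ _)) d)) ≤-refl
        ... | no _ = ≤-trans (≤-reflexive (trans (+-identityʳ _) (+-identityʳ _))) (degIn≤ cubic v)

  four-edges-Short : ∀ G Y → vertices Y ≡ 4 → 4 ≤ e (edgesOf G) Y → Short G Y
  four-edges-Short G Y s≡4 m≥4 = Sum.map triangle-induced square-induced
      (four-vertices induced (trans k≡ s≡4) (≤-trans m≥4 (≤-reflexive (sym size-induced))))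
    where
    open Induced G Y

  -- The four vertices off a square of such a set span as many edges as the square, hence a second short cycle.
  cube-triangle : ∀ G X → Subcubic G → ¬ TwoDisjointShortCycles G → vertices X ≡ 8 → e (edgesOf G) X ≡ 12 → Short
      G X → Triangle G X
  cube-triangle G X cubic noTwo s≡8 m≡12 (inj₁ t) = t
  cube-triangle G X cubic noTwo s≡8 m≡12 (inj₂ sqr@(a , b , c , d , (Xa , Xb , Xc , Xd) , (a≢c , b≢d) , ab , bc ,
      cd , da)) =
    ⊥-elim (noTwo (disjoint-Short G {Tq} {Y} square-T short-Y λ {v} Tv Yv → true≢false Tv
        (not-true (proj₂ (∧-true {X v} Yv)))))
    where
    open ≤-Reasoning
    E = edgesOf G
    Tq : VSet (n G)
    Tq v = eqb a v ∨ (eqb b v ∨ (eqb c v ∨ eqb d v))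
    Y = X ∖ Tq
    Ta : Tq a ≡ true
    Ta = cong (λ x → x ∨ (eqb b a ∨ (eqb c a ∨ eqb d a))) (eqb-refl a)
    Tb : Tq b ≡ true
    Tb = trans (cong (λ x → eqb a b ∨ (x ∨ (eqb c b ∨ eqb d b))) (eqb-refl b)) (Bool.∨-zeroʳ (eqb a b))
    Tc : Tq c ≡ true
    Tc = trans (cong (λ x → eqb a c ∨ (eqb b c ∨ (x ∨ eqb d c))) (eqb-refl c)) (trans (cong (eqb a c ∨_)
        (Bool.∨-zeroʳ (eqb b c))) (Bool.∨-zeroʳ (eqb a c)))
    Td : Tq d ≡ true
    Td = trans (cong (λ x → eqb a d ∨ (eqb b d ∨ (eqb c d ∨ x))) (eqb-refl d))
      (trans (cong (λ x → eqb a d ∨ (eqb b d ∨ x)) (Bool.∨-zeroʳ (eqb c d))) (trans (cong (eqb a d ∨_)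
          (Bool.∨-zeroʳ (eqb b d))) (Bool.∨-zeroʳ (eqb a d))))
    square-T : Short G Tq
    square-T = inj₂ (a , b , c , d , (Ta , Tb , Tc , Td) , (a≢c , b≢d) , ab , bc , cd , da)
    indicator : ∀ v → χ (Tq v) ≡ χ (eqb a v) + (χ (eqb b v) + (χ (eqb c v) + χ (eqb d v)))
    indicator v with a Fin.≟ v | b Fin.≟ v | c Fin.≟ v | d Fin.≟ v
    ... | yes refl | yes refl | _ | _ = ⊥-elim (adj⇒≢ G ab refl)
    ... | yes refl | no _ | yes refl | _ = ⊥-elim (a≢c refl)
    ... | yes refl | no _ | no _ | yes refl = ⊥-elim (adj⇒≢ G da refl)
    ... | yes _ | no _ | no _ | no _ = refl
    ... | no _ | yes refl | yes refl | _ = ⊥-elim (adj⇒≢ G bc refl)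
    ... | no _ | yes refl | no _ | yes refl = ⊥-elim (b≢d refl)
    ... | no _ | yes _ | no _ | no _ = refl
    ... | no _ | no _ | yes refl | yes refl = ⊥-elim (adj⇒≢ G cd refl)
    ... | no _ | no _ | yes _ | no _ = refl
    ... | no _ | no _ | no _ | yes _ = refl
    ... | no _ | no _ | no _ | no _ = refl
    weighted : ∀ f → σ f Tq ≡ f a + (f b + (f c + f d))
    weighted f = trans (sum-cong λ v → trans (cong (_* f v) (indicator v)) (eq (χ (eqb a v)) (χ (eqb b v))
        (χ (eqb c v)) (χ (eqb d v)) (f v)))
      (trans (sum-+ (λ v → χ (eqb a v) * f v) _) (cong₂ _+_ (sum-pick f a)
      (trans (sum-+ (λ v → χ (eqb b v) * f v) _) (cong₂ _+_ (sum-pick f b)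
      (trans (sum-+ (λ v → χ (eqb c v) * f v) _) (cong₂ _+_ (sum-pick f c) (sum-pick f d)))))))
      where eq : ∀ a b c d f → (a + (b + (c + d))) * f ≡ a * f + (b * f + (c * f + d * f))
            eq = solve-∀
    T⊆X : ∀ v → Tq v ≡ true → X v ≡ true
    T⊆X v h with ∨-true (eqb a v) h
    ... | inj₁ q = subst (λ x → X x ≡ true) (eqb⇒≡ q) Xa
    ... | inj₂ h with ∨-true (eqb b v) h
    ... | inj₁ q = subst (λ x → X x ≡ true) (eqb⇒≡ q) Xb
    ... | inj₂ h with ∨-true (eqb c v) h
    ... | inj₁ q = subst (λ x → X x ≡ true) (eqb⇒≡ q) Xc
    ... | inj₂ q = subst (λ x → X x ≡ true) (eqb⇒≡ q) Xd
    X∩T : X ∩ Tq ≐ Tq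
    X∩T v with true-or-false (Tq v)
    ... | inj₁ q = trans (∧-intro (T⊆X v q) q) (sym q)
    ... | inj₂ q = trans (trans (cong (X v ∧_) q) (Bool.∧-zeroʳ (X v))) (sym q)
    |T| : vertices Tq ≡ 4
    |T| = weighted (λ _ → 1)
    |Y| : vertices Y ≡ 4
    |Y| = +-cancelˡ-≡ 4 _ _ (trans (cong (_+ vertices Y) (sym (trans (σ-cong (λ _ → 1) X∩T) |T|)))
        (trans (sym (σ-∖ (λ _ → 1) X Tq)) s≡8))
    eT = e E Tq
    eT≥4 : 4 ≤ eT
    eT≥4 = *-cancelˡ-≤ 2 (begin
        2 + (2 + (2 + 2))
          ≤⟨ +-mono-≤ (degIn≥2 G {Tq} b≢d ab Tb (adj-flip G da) Td) (+-mono-≤ (degIn≥2 G {Tq} a≢c (adj-flip G ab)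
              Ta bc Tc)
               (+-mono-≤ (degIn≥2 G {Tq} b≢d (adj-flip G bc) Tb cd Td) (degIn≥2 G {Tq} a≢c da Ta (adj-flip G cd)
                   Tc))) ⟩
        degIn G Tq a + (degIn G Tq b + (degIn G Tq c + degIn G Tq d))  ≡⟨ sym (weighted (degIn G Tq)) ⟩
        σ (degIn G Tq) Tq                                              ≡⟨ handshake G Tq ⟩
        2 * eT ∎)
    outward : cut G Tq Y ≤ cut G Tq (∁ Tq)
    outward = sum-mono λ u → *-monoʳ-≤ (χ (Tq u)) (sum-mono λ v → *-monoˡ-≤ (χ (adj G u v)) (χ-mono {Y v} {∁ Tq v}
        λ h → proj₂ (∧-true {X v} h)))
    -- Degrees leave at most 12 - 2 `eT` edges from the square to `Y`; subtracting these and the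
    -- `eT` edges on the square from the 12 edges of X leaves at least `eT` edges inside `Y`.
    eY≥4 : 4 ≤ e E Y
    eY≥4 = ≤-trans eT≥4 (by-≤ 0 (+-mono-≤ (subst (λ s → 2 * eT + cut G Tq (∁ Tq) ≤ 3 * s) |T|
        (Degrees.handshake-cut G Tq cubic))
        (+-mono-≤ outward (≤-reflexive total))) (eq eT (e E Y) (cut G Tq Y) (cut G Tq (∁ Tq))))
      where
      total : 12 ≡ eT + e E Y + cut G Tq Y
      total = trans (sym m≡12) (trans (e-cut G X Tq) (cong₂ (λ x y → x + e E Y + y) (e-cong E X∩T) (cut-cong G
          {X ∩ Tq} {Tq} {Y} {Y} X∩T (λ _ → refl))))
      eq : ∀ t y c d → t + (12 + (d + (t + y + c))) + 0 ≡ y + (2 * t + d + (c + 12))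
      eq = solve-∀
    short-Y : Short G Y
    short-Y = four-edges-Short G Y |Y| eY≥4

  -- The excess and edge deletion

  FamilyFree : Graph → Set
  FamilyFree G = ∀ H → H ∈ family → ¬ ContainsInducedSubdivision G H

  -- 14 r(G): the demand Γ of the partition bounds 2 φ(G) + |V(G)|.
  excessOf : Graph → ℕ
  excessOf G = 7 * Partition.Γ G ∸ (5 * n G + 4 * size G + 4)

  -- A class of positive weight satisfies every condition of `Forbidden` except perhaps the absence
  -- of short cycles.
  weight-short : ∀ G X → Subcubic G → TwoEdge G X → 0 < weight G X →
                 Short G X ⊎ ∃ λ H → H ∈ family × InducedCopy G X H
  weight-short G X cubic two w with short? G X
  ... | yes s = inj₁ s
  ... | no ¬s = inj₂ (Induced.forbidden-copy G X cubic two ¬s (proj₁ numbers) bounded dense)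
    where open Dense (weight-dense G cubic X two w)

  module Critical (G : Graph) (sep : Separates G) (cubic : Subcubic G) (noTwo : ¬ TwoDisjointShortCycles G) (free : FamilyFree G) where
    open Partition G

    ω-short : ∀ {i} → 0 < ω i → Short G (C i)
    ω-short {i} w = [ id , contained ]′ (weight-short G (C i) cubic (C-TwoEdge i) w)
      where
      contained : (∃ λ H → H ∈ family × InducedCopy G (C i) H) → Short G (C i)
      contained (H , H∈ , f , f-inj , _ , f-adj) = ⊥-elim (free H H∈ (H , base , f , f-inj , f-adj))

    -- Two such classes would contain two disjoint short cycles.
    ω-unique : ∀ {i j} → 0 < ω i → 0 < ω j → i ≡ j
    ω-unique {i} {j} wi wj with i Fin.≟ j
    ... | yes q = q
    ... | no i≢j = ⊥-elim (noTwo (disjoint-Short G (ω-short wi) (ω-short wj) (C-disjoint i≢j)))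

    -- Connectedness of the quotient turns the 4 per class, less the 4 per crossing edge, into a
    -- single constant 4.
    excess≤∑ω : excessOf G ≤ ∑ ω
    excess≤∑ω = m≤n+o⇒m∸n≤o (7 * Γ) (5 * n G + 4 * size G + 4) (by-≤ 0
      (+-mono-≤ Γ-bound (*-monoʳ-≤ 4 (Quotient.classes≤crossing+1 G sep p)))
      (eq Γ (crossing (edgesOf G) p full) (size G) (n G) (classes full p) (∑ ω)))
      where eq : ∀ Γ A m n κ w → 7 * Γ + (4 * m + 5 * n + 4 * κ + w + 4 * (1 + A)) + 0 ≡ 5 * n + 4 * m + 4 + w + (7 * Γ + 4 * A + 4 * κ)
            eq = solve-∀

    heavy-class : 0 < excessOf G → ∃ λ i → 0 < ω i × excessOf G ≤ ω i
    heavy-class r>0 with ∑-unique ω ω-unique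
    ... | inj₁ q = ⊥-elim (n≮0 (<-≤-trans r>0 (≤-trans excess≤∑ω (≤-reflexive q))))
    ... | inj₂ (i , wi , q) = i , wi , ≤-trans excess≤∑ω (≤-reflexive q)

    class-dense : ∀ {i} → 0 < ω i → Dense G (C i)
    class-dense {i} = weight-dense G cubic (C i) (C-TwoEdge i)

    heavy : ∀ {i k} → 0 < ω i → k ≤ ω i → 5 * vertices (C i) + k ≤ 3 * e (edgesOf G) (C i) + 10
    heavy {i} {k} w k≤ω = ≤-trans (≤-reflexive (+-comm (5 * vertices (C i)) k))
        (≤-trans (+-monoˡ-≤ (5 * vertices (C i)) k≤ω) (≤-reflexive (Dense.weighs (class-dense w))))

    excess≤8 : excessOf G ≤ 8
    excess≤8 with 0 <? excessOf G
    ... | no q = ≤-trans (≮⇒≥ q) z≤n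
    ... | yes q with heavy-class q
    ...   | i , w , r≤ω = ≤-trans r≤ω (+-cancelʳ-≤ (5 * vertices (C i)) _ _ (≤-trans (≤-reflexive (Dense.weighs d))
              (≤-trans (proj₁ (proj₂ (Dense.numbers d))) (≤-reflexive (+-comm _ 8)))))
      where d = class-dense w

    excess≤6 : ¬ Isomorphic G K4 → excessOf G ≤ 6
    excess≤6 ¬K4 = ≮⇒≥ λ r≥7 → let
        i , w , r≤ω = heavy-class (≤-trans (s≤s z≤n) r≥7)
        d = class-dense w
        s≡4 , m≡6 = proj₁ (proj₂ (proj₂ (proj₂ (Dense.numbers d)))) (heavy w (≤-trans r≥7 r≤ω))
      in ¬K4 (dense⇒K4 G (C i) cubic sep (Dense.inhabited d) s≡4 m≡6)

    excess≡6 : excessOf G ≡ 6 → HasTriangle G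
    excess≡6 r≡6 = has-triangle (heavy-class (subst (0 <_) (sym r≡6) (s≤s z≤n)))
      where
      has : ∀ {X} → Triangle G X → HasTriangle G
      has (a , b , c , _ , (ab , bc , ac)) = a , b , c , ≡⇒T ab , ≡⇒T bc , ≡⇒T ac
      has-triangle : (∃ λ i → 0 < ω i × excessOf G ≤ ω i) → HasTriangle G
      has-triangle (i , w , r≤ω) = shape (proj₁ (proj₂ (proj₂ (Dense.numbers d)))
          (heavy w (≤-trans (≤-reflexive (sym r≡6)) r≤ω)))
        where
        d = class-dense w
        member = proj₂ (any-elim (C i) (Dense.inhabited d))
        small-case : ∀ {s m} → vertices (C i) ≡ s → e (edgesOf G) (C i) ≡ m → 2 ≤ s → s ≤ 5 → 3 * s ≤ 2 * m + 1 →
            HasTriangle G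
        small-case refl refl a b c = has (Degrees.dense-triangle G (C i) cubic (C-TwoEdge i) member a b c)
        shape : _ → HasTriangle G
        -- The weight is only known to be at least 6 here, so the class of weight 8 has to be
        -- included.
        shape (inj₁ (s≡4 , m≡6)) = small-case s≡4 m≡6 (s≤s (s≤s z≤n)) (n≤1+n 4) (n≤1+n 12)
        shape (inj₂ (inj₁ (s≡5 , m≡7))) = small-case s≡5 m≡7 (s≤s (s≤s z≤n)) ≤-refl ≤-refl
        shape (inj₂ (inj₂ (s≡8 , m≡12))) = has (cube-triangle G (C i) cubic noTwo s≡8 m≡12 (ω-short w))

    excess-girth : GirthAtLeast5 G → excessOf G ≡ 0
    excess-girth girth with 0 <? excessOf G
    ... | no q = n<1⇒n≡0 (≰⇒> q)
    ... | yes q = let i , w , _ = heavy-class q in ⊥-elim (girth⇒¬Short G girth (C i) (ω-short w))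

  -- Deleting an edge

  module Deletion (G : Graph) {u v : V G} (uv : adj G u v ≡ true) where
    G′ : Graph
    G′ = deleteEdge G u v

    u≢v : u ≢ v
    u≢v refl = true≢false uv (adj-irr G u)

    adj′⇒ : ∀ {a b} → adj G′ a b ≡ true → adj G a b ≡ true
    adj′⇒ {a} {b} h = proj₁ (∧-true {adj G a b} h)

    adj-away : ∀ {X : VSet (n G)} {a b} → ¬ (X u ≡ true × X v ≡ true) → X a ≡ true → X b ≡ true → adj G′ a b ≡ adj
        G a b
    adj-away {X} {a} {b} away Xa Xb = trans (cong (λ c → adj G a b ∧ not c) (¬true⇒false λ h → away (ends h)))
        (Bool.∧-identityʳ (adj G a b))
      where
      ends : isEdge u v a b ≡ true → X u ≡ true × X v ≡ true
      ends h with ∨-true (eqb a u ∧ eqb b v) h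
      ... | inj₁ q = let r , s = ∧-true {eqb a u} q in subst (λ x → X x ≡ true) (eqb⇒≡ r) Xa , subst (λ x → X x ≡ true) (eqb⇒≡ s) Xb
      ... | inj₂ q = let r , s = ∧-true {eqb a v} q in subst (λ x → X x ≡ true) (eqb⇒≡ s) Xb , subst (λ x → X x ≡ true) (eqb⇒≡ r) Xa

    adj-split : ∀ a b → χ (adj G a b) ≡ χ (adj G′ a b) + (χ (eqb u a) * χ (eqb v b) + χ (eqb v a) * χ (eqb u b))
    adj-split a b = trans (χ-split (adj G a b) (isEdge u v a b)) (trans (+-comm (χ (adj G a b ∧ isEdge u v a b)) _)
      (cong (χ (adj G′ a b) +_) (trans (cong χ present) (trans exclusive
        (cong₂ _+_ (flip-∧ a u b v) (flip-∧ a v b u))))))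
      where
      flip-∧ : ∀ a u b v → χ (eqb a u ∧ eqb b v) ≡ χ (eqb u a) * χ (eqb v b)
      flip-∧ a u b v = trans (χ-∧ (eqb a u) (eqb b v)) (cong₂ (λ c d → χ c * χ d) (eqb-sym a u) (eqb-sym b v))
      present : adj G a b ∧ isEdge u v a b ≡ isEdge u v a b
      present with true-or-false (isEdge u v a b)
      ... | inj₂ q = trans (cong (adj G a b ∧_) q) (trans (Bool.∧-zeroʳ (adj G a b)) (sym q))
      ... | inj₁ q with ∨-true (eqb a u ∧ eqb b v) q
      ...   | inj₁ r = cong (_∧ isEdge u v a b) (trans (cong₂ (adj G) (eqb⇒≡ (proj₁ (∧-true {eqb a u} r)))
          (eqb⇒≡ (proj₂ (∧-true {eqb a u} r)))) uv)
      ...   | inj₂ r = cong (_∧ isEdge u v a b) (trans (cong₂ (adj G) (eqb⇒≡ (proj₁ (∧-true {eqb a v} r)))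
          (eqb⇒≡ (proj₂ (∧-true {eqb a v} r)))) (trans (adj-sym G v u) uv))
      exclusive : χ (isEdge u v a b) ≡ χ (eqb a u ∧ eqb b v) + χ (eqb a v ∧ eqb b u)
      exclusive with true-or-false (eqb a u ∧ eqb b v)
      ... | inj₂ q = trans (cong (λ c → χ (c ∨ (eqb a v ∧ eqb b u))) q) (cong (λ c → χ c + χ (eqb a v ∧ eqb b u))
          (sym q))
      ... | inj₁ q = trans (cong (λ c → χ (c ∨ (eqb a v ∧ eqb b u))) q) (trans (cong (λ c → 1 + χ c) (sym other))
          (cong (λ c → χ c + χ (eqb a v ∧ eqb b u)) (sym q)))
        where
        other : eqb a v ∧ eqb b u ≡ false
        other = ¬true⇒false λ r → u≢v (trans (sym (eqb⇒≡ (proj₁ (∧-true {eqb a u} q))))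
            (eqb⇒≡ (proj₁ (∧-true {eqb a v} r))))

    e-delete : ∀ X → e (edgesOf G) X ≡ χ (X u ∧ X v) + e (edgesOf G′) X
    e-delete X = *-cancelˡ-≡ _ _ 2 (begin
        2 * e (edgesOf G) X
          ≡⟨ sym (2e G X) ⟩
        ∑ (λ a → χ (X a) * ∑ λ b → χ (X b) * χ (adj G a b))
          ≡⟨ sum-cong (λ a → trans (cong (χ (X a) *_) (inner a)) (eq₁ (χ (X a)) _ (χ (eqb u a)) (χ (X v))
              (χ (eqb v a)) (χ (X u)))) ⟩
        ∑ (λ a → χ (X a) * (∑ λ b → χ (X b) * χ (adj G′ a b)) + (χ (eqb u a) * (χ (X a) * χ (X v)) + χ (eqb v a) *
            (χ (X a) * χ (X u))))
          ≡⟨ trans (sum-+ (λ a → χ (X a) * ∑ λ b → χ (X b) * χ (adj G′ a b)) _) (cong₂ _+_ (2e G′ X)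
               (trans (sum-+ (λ a → χ (eqb u a) * (χ (X a) * χ (X v))) _) (cong₂ _+_ (sum-pick (λ a → χ (X a) * χ
                   (X v)) u) (sum-pick (λ a → χ (X a) * χ (X u)) v)))) ⟩
        2 * e (edgesOf G′) X + (χ (X u) * χ (X v) + χ (X v) * χ (X u))
          ≡⟨ eq₂ (e (edgesOf G′) X) (χ (X u)) (χ (X v)) ⟩
        2 * (χ (X u) * χ (X v) + e (edgesOf G′) X)
          ≡⟨ cong (λ c → 2 * (c + e (edgesOf G′) X)) (sym (χ-∧ (X u) (X v))) ⟩
        2 * (χ (X u ∧ X v) + e (edgesOf G′) X) ∎)
      where
      open ≡-Reasoning
      eq₁ : ∀ x s a xv b xu → x * (s + (a * xv + b * xu)) ≡ x * s + (a * (x * xv) + b * (x * xu))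
      eq₁ = solve-∀
      eq₂ : ∀ m a b → 2 * m + (a * b + b * a) ≡ 2 * (a * b + m)
      eq₂ = solve-∀
      eq₃ : ∀ x g a c b d → x * (g + (a * c + b * d)) ≡ x * g + (a * (c * x) + b * (d * x))
      eq₃ = solve-∀
      inner : ∀ a → ∑ (λ b → χ (X b) * χ (adj G a b)) ≡ ∑ (λ b → χ (X b) * χ (adj G′ a b)) + (χ (eqb u a) * χ
          (X v) + χ (eqb v a) * χ (X u))
      inner a = trans (sum-cong λ b → trans (cong (χ (X b) *_) (adj-split a b)) (eq₃ (χ (X b)) (χ (adj G′ a b))
          (χ (eqb u a)) (χ (eqb v b)) (χ (eqb v a)) (χ (eqb u b))))
        (trans (sum-+ (λ b → χ (X b) * χ (adj G′ a b)) _) (cong (∑ (λ b → χ (X b) * χ (adj G′ a b)) +_)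
        (trans (sum-+ (λ b → χ (eqb u a) * (χ (eqb v b) * χ (X b))) _) (cong₂ _+_
          (trans (sum-* (χ (eqb u a)) (λ b → χ (eqb v b) * χ (X b))) (cong (χ (eqb u a) *_) (sum-pick (χ ∘ X) v)))
          (trans (sum-* (χ (eqb v a)) (λ b → χ (eqb u b) * χ (X b))) (cong (χ (eqb v a) *_) (sum-pick (χ ∘ X) u)))))))

    -- The two edge lists are not compared as lists. They give the same counts inside every set, and
    -- `e-split` transfers this to crossing edges.
    crossing-delete : ∀ q → crossing (edgesOf G) q full ≡ χ (not (eqb (q u) (q v))) + crossing (edgesOf G′) q full
    crossing-delete q = +-cancelˡ-≡ (∑ λ i → e (edgesOf G) (cls full q i)) _ _ (begin
        ∑ (λ i → e (edgesOf G) (cls full q i)) + crossing (edgesOf G) q full  ≡⟨ sym (e-split (edgesOf G) q full) ⟩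
        e (edgesOf G) full                                                    ≡⟨ e-delete full ⟩
        e ((u , v) ∷ edgesOf G′) full                                         ≡⟨ e-split ((u , v) ∷ edgesOf G′) q
            full ⟩
        ∑ (λ i → e ((u , v) ∷ edgesOf G′) (cls full q i)) + crossing ((u , v) ∷ edgesOf G′) q full
          ≡⟨ cong (_+ crossing ((u , v) ∷ edgesOf G′) q full) (sum-cong λ i → sym (e-delete (cls full q i))) ⟩
        ∑ (λ i → e (edgesOf G) (cls full q i)) + crossing ((u , v) ∷ edgesOf G′) q full ∎)
      where open ≡-Reasoning

    subcubic-delete : Subcubic G → Subcubic G′
    subcubic-delete cubic a = ≤-trans (subst₂ _≤_ (sym (degree≡ G′ a)) (sym (degree≡ G a)) (sum-mono λ b → χ-mono
        {adj G′ a b} adj′⇒)) (cubic a)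

    short-delete : ∀ {X} → Short G′ X → Short G X
    short-delete (inj₁ (a , b , c , i , (ab , bc , ac))) = inj₁ (a , b , c , i , (adj′⇒ ab , adj′⇒ bc , adj′⇒ ac))
    short-delete (inj₂ (a , b , c , d , i , j , (ab , bc , cd , da))) = inj₂ (a , b , c , d , i , j , (adj′⇒ ab ,
        adj′⇒ bc , adj′⇒ cd , adj′⇒ da))

    module _ (sep : Separates G) (cubic : Subcubic G) (noTwo : ¬ TwoDisjointShortCycles G) (free : FamilyFree G) (two : TwoEdge G full) where
      open Partition G′
      private
        E = edgesOf G
        E′ = edgesOf G′
        A′ = crossing E′ p full
        κ = classes full p

      class-dense : ∀ {i} → 0 < ω i → Dense G′ (C i)
      class-dense {i} = weight-dense G′ (subcubic-delete cubic) (C i) (C-TwoEdge i)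

      -- `free` speaks of G only. A class that misses an end of the deleted edge induces the same
      -- subgraph in G, so a forbidden copy in it would be induced in G too.
      off-short : ∀ {i} → ¬ (C i u ≡ true × C i v ≡ true) → 0 < ω i → Short G (C i)
      off-short {i} away w = [ short-delete , contained ]′ (weight-short G′ (C i) (subcubic-delete cubic)
          (C-TwoEdge i) w)
        where
        contained : (∃ λ H → H ∈ family × InducedCopy G′ (C i) H) → Short G (C i)
        contained (H , H∈ , f , f-inj , f-in , f-adj) = ⊥-elim (free H H∈ (H , base , f , f-inj ,
          λ a b → trans (f-adj a b) (adj-away {C i} away (f-in a) (f-in b))))

      -- Each class misses two units of degree: both ends of the deleted edge, or two edges leaving it.
      ω≤4 : ∀ i → ω i ≤ 4
      ω≤4 i with 0 <? ω i
      ... | no q = ≤-trans (≮⇒≥ q) z≤n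
      ... | yes w = +-cancelʳ-≤ (5 * vertices (C i)) _ _ (≤-trans (≤-reflexive (Dense.weighs d))
            (≤-trans (proj₂ (proj₂ (proj₂ (proj₂ (Dense.numbers d)))) slack) (≤-reflexive (+-comm _ 4))))
        where
        open ≤-Reasoning
        d = class-dense w
        slack : 2 * e E′ (C i) + 2 ≤ 3 * vertices (C i)
        slack with true-or-false (C i u ∧ C i v)
        ... | inj₁ q = begin
            2 * e E′ (C i) + 2                    ≡⟨ eq (e E′ (C i)) ⟩
            2 * (1 + e E′ (C i))                  ≡⟨ cong (λ c → 2 * (χ c + e E′ (C i))) (sym q) ⟩
            2 * (χ (C i u ∧ C i v) + e E′ (C i))  ≡⟨ cong (2 *_) (sym (e-delete (C i))) ⟩
            2 * e E (C i)                         ≤⟨ Degrees.degree-sum G (C i) cubic ⟩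
            3 * vertices (C i) ∎
          where eq : ∀ m → 2 * m + 2 ≡ 2 * (1 + m)
                eq = solve-∀
        ... | inj₂ q = begin
            2 * e E′ (C i) + 2                    ≤⟨ +-mono-≤ (*-monoʳ-≤ 2 (≤-trans (m≤n+m _ (χ (C i u ∧ C i v)))
                (≤-reflexive (sym (e-delete (C i)))))) boundary ⟩
            2 * e E (C i) + cut G (C i) (∁ (C i)) ≤⟨ Degrees.handshake-cut G (C i) cubic ⟩
            3 * vertices (C i) ∎
          where
          member = any-elim (C i) (Dense.inhabited d)
          boundary : 2 ≤ cut G (C i) (∁ (C i))
          boundary with true-or-false (C i u)
          ... | inj₂ ¬u = two (C i) {proj₁ member} {u} refl refl (proj₂ member) ¬u
          ... | inj₁ yu = two (C i) {proj₁ member} {v} refl refl (proj₂ member) (¬true⇒false λ yv → true≢false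
              (∧-intro yu yv) q)

      -- The weights to which `off-short` applies; at most one of them is positive.
      off : V G → ℕ
      off i = χ (not (C i u ∧ C i v)) * ω i

      off⇒ : ∀ {i} → 0 < off i → ¬ (C i u ≡ true × C i v ≡ true) × 0 < ω i
      off⇒ {i} h with C i u ∧ C i v in q
      ... | false = (λ (a , b) → true≢false (∧-intro a b) q) , subst (0 <_) (+-identityʳ (ω i)) h

      off-unique : ∀ {i j} → 0 < off i → 0 < off j → i ≡ j
      off-unique {i} {j} hi hj with i Fin.≟ j
      ... | yes q = q
      ... | no i≢j = let ai , wi = off⇒ hi ; aj , wj = off⇒ hj in
              ⊥-elim (noTwo (disjoint-Short G (off-short ai wi) (off-short aj wj) (C-disjoint i≢j)))

      off≤ω : ∀ i → off i ≤ ω i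
      off≤ω i = ≤-trans (*-monoˡ-≤ (ω i) (χ≤1 (not (C i u ∧ C i v)))) (≤-reflexive (+-identityʳ (ω i)))

      ∑off≤4 : ∑ off ≤ 4
      ∑off≤4 with ∑-unique off off-unique
      ... | inj₁ q = ≤-trans (≤-reflexive q) z≤n
      ... | inj₂ (i , _ , q) = ≤-trans (≤-reflexive q) (≤-trans (off≤ω i) (ω≤4 i))

      both⇒ : ∀ {i} → C i u ∧ C i v ≡ true → p u ≡ i × p v ≡ i
      both⇒ {i} h = let a , b = ∧-true {C i u} h in eqb⇒≡ a , eqb⇒≡ b

      ∑ω-apart : p u ≢ p v → ∑ ω ≤ 4
      ∑ω-apart pu≢pv = ≤-trans (≤-reflexive (sum-cong λ i → sym (trans
        (cong (λ c → χ (not c) * ω i) (¬true⇒false λ h → let a , b = both⇒ {i} h in pu≢pv (trans a (sym b)))) (+-identityʳ (ω i))))) ∑off≤4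

      -- At most one class contains both ends of the edge, and it weighs at most 4.
      ∑ω-split : ∑ ω ≤ 4 + ∑ off
      ∑ω-split = begin
          ∑ ω                                        ≤⟨ sum-mono pointwise ⟩
          ∑ (λ i → χ (eqb (p u) i) * 4 + off i)      ≡⟨ sum-+ (λ i → χ (eqb (p u) i) * 4) off ⟩
          ∑ (λ i → χ (eqb (p u) i) * 4) + ∑ off      ≡⟨ cong (_+ ∑ off) (sum-pick (λ _ → 4) (p u)) ⟩
          4 + ∑ off ∎
        where
        open ≤-Reasoning
        pointwise : ∀ i → ω i ≤ χ (eqb (p u) i) * 4 + off i
        pointwise i with true-or-false (C i u ∧ C i v)
        ... | inj₂ q = ≤-trans (≤-reflexive (sym (trans (cong (λ c → χ (not c) * ω i) q) (+-identityʳ (ω i)))))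
            (m≤n+m _ _)
        ... | inj₁ q = ≤-trans (ω≤4 i) (≤-trans (≤-reflexive (cong (λ c → χ c * 4)
            (sym (≡⇒eqb (proj₁ (both⇒ {i} q)))))) (m≤m+n _ _))

      ∑ω-single : p u ≡ p v → κ ≤ 1 → ∑ ω ≤ 4
      ∑ω-single pu≡pv κ≤1 = ≤-trans ∑ω-split (≤-trans (+-monoʳ-≤ 4 (≤-reflexive (sum-0 λ i → n<1⇒n≡0
          (≰⇒> (none i))))) ≤-refl)
        where
        none : ∀ i → ¬ (0 < off i)
        none i h with off⇒ {i} h
        ... | away , w = <⇒≱ (≤-trans (≤-reflexive (sym (cong₂ (λ c d → χ c + χ d)
                (any-intro (C (p u)) u (eqb-refl (p u))) (Dense.inhabited (class-dense w))))) (two-terms≤sum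
                    (λ j → χ (anyFin (C j))) other)) κ≤1
          where
          other : p u ≢ i
          other q = away (≡⇒eqb q , ≡⇒eqb (trans (sym pu≡pv) q))

      -- Both optima have the parity of |V|, so it suffices to refute that the optimum of G is at
      -- most that of G′. In `grown` the 9 consists of 4 for the deleted edge, 4 for the constant in
      -- `excessOf`, and 1 for its positivity.
      Γ-drops : 0 < excessOf G → 2 + Γ ≤ Partition.Γ G
      Γ-drops r>0 = par-< (trans (par-Φ-demand E′ (λ _ → 1) full p) (sym (par-Φ-demand E (λ _ → 1) full
          (Partition.p G))))
          (≰⇒> λ Γ≤ → impossible (grown Γ≤))
        where
        exceeds : 5 * n G + 4 * size G + 4 < 7 * Partition.Γ G
        exceeds with 5 * n G + 4 * size G + 4 <? 7 * Partition.Γ G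
        ... | yes q = q
        ... | no q  = ⊥-elim (n≮0 (≤-trans r>0 (≤-reflexive (m≤n⇒m∸n≡0 (≮⇒≥ q)))))
        grown : Partition.Γ G ≤ Γ → 9 + 4 * A′ ≤ 4 * κ + ∑ ω
        grown Γ≤ = by-≤ 0 (+-mono-≤ Γ-bound (+-mono-≤ exceeds (+-mono-≤ (*-monoʳ-≤ 7 Γ≤) (*-monoʳ-≤ 4 (≤-reflexive
            (sym (e-delete full)))))))
          (eq A′ κ (∑ ω) Γ (Partition.Γ G) (n G) (size G) (size G′))
          where eq : ∀ A κ w Γ′ Γ n m m′ → 9 + 4 * A + (4 * m′ + 5 * n + 4 * κ + w + (7 * Γ + (7 * Γ′ + 4 * m))) + 0 ≡
                       4 * κ + w + (7 * Γ′ + 4 * A + (1 + (5 * n + 4 * m + 4) + (7 * Γ + 4 * (1 + m′))))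
                eq = solve-∀
        A≡ = crossing-delete p
        κ≤A : 2 ≤ κ → κ ≤ χ (not (eqb (p u) (p v))) + A′
        κ≤A κ≥2 = ≤-trans (Quotient.classes≤crossing G sep two p κ≥2) (≤-reflexive A≡)
        -- If uv joins two classes, then κ ≤ 1 + A′ and ∑ ω ≤ 4. If not, either κ ≤ A′ and ∑ ω ≤ 8,
        -- or κ ≤ 1 and ∑ ω ≤ 4. The right side is at most 8 + 4 A′ each time.
        impossible : ¬ (9 + 4 * A′ ≤ 4 * κ + ∑ ω)
        impossible h with p u Fin.≟ p v
        ... | no pu≢pv = <⇒≱ {4 * κ + ∑ ω} {9 + 4 * A′} (s≤s (≤-trans
                (+-mono-≤ (*-monoʳ-≤ 4 (≤-trans (κ≤A apart) (≤-reflexive (cong (λ c → χ (not c) + A′)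
                    (≢⇒eqb pu≢pv))))) (∑ω-apart pu≢pv)) (≤-reflexive (eq A′)))) h
          where
          eq : ∀ A → 4 * (1 + A) + 4 ≡ 8 + 4 * A
          eq = solve-∀
          apart : 2 ≤ κ
          apart = subst (_≤ κ) (cong₂ (λ c d → χ c + χ d) (any-intro (C (p u)) u (eqb-refl (p u)))
              (any-intro (C (p v)) v (eqb-refl (p v))))
                    (two-terms≤sum (λ j → χ (anyFin (C j))) pu≢pv)
        ... | yes pu≡pv with 2 ≤? κ
        ...   | yes κ≥2 = <⇒≱ {4 * κ + ∑ ω} {9 + 4 * A′} (s≤s (≤-trans
                (+-mono-≤ (*-monoʳ-≤ 4 (≤-trans (κ≤A κ≥2) (≤-reflexive (cong (λ c → χ (not c) + A′)
                    (≡⇒eqb pu≡pv))))) (≤-trans ∑ω-split (+-monoʳ-≤ 4 ∑off≤4))) (≤-reflexive (+-comm (4 * A′) 8)))) h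
        ...   | no κ<2 = <⇒≱ {4 * κ + ∑ ω} {9 + 4 * A′} (s≤s (≤-trans
                (+-mono-≤ (*-monoʳ-≤ 4 (≤-pred (≰⇒> κ<2))) (∑ω-single pu≡pv (≤-pred (≰⇒> κ<2)))) (m≤m+n 8 _))) h

-- Sevenths and fourteenths

module Fractions where
  open import Data.Nat as ℕ using (ℕ; suc)
  import Data.Nat.Properties as ℕ
  import Data.Nat.Tactic.RingSolver as ℕ
  open import Data.Integer as ℤ using (ℤ; +_; _-_)
  import Data.Integer.Properties as ℤ
  import Data.Integer.Tactic.RingSolver as ℤ
  open import Data.Rational as ℚ using (ℚ; _/_; 0ℚ; fromℚᵘ)
  import Data.Rational.Properties as ℚ
  open import Data.Rational.Unnormalised as ℚᵘ using (mkℚᵘ; *≤*; *≡*)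
  import Data.Rational.Unnormalised.Properties as ℚᵘ
  open import Data.Empty using (⊥-elim)
  open import Relation.Nullary using (yes; no)
  open import Relation.Binary.PropositionalEquality

  fromℚᵘ-mono : ∀ {p q} → p ℚᵘ.≤ q → fromℚᵘ p ℚ.≤ fromℚᵘ q
  fromℚᵘ-mono {p} {q} h = ℚ.toℚᵘ-cancel-≤ (ℚᵘ.≤-respˡ-≃ (ℚᵘ.≃-sym (ℚ.toℚᵘ-fromℚᵘ p)) (ℚᵘ.≤-respʳ-≃
      (ℚᵘ.≃-sym (ℚ.toℚᵘ-fromℚᵘ q)) h))

  fromℚᵘ-≤-+ : ∀ {p q r} → p ℚᵘ.≤ q ℚᵘ.+ r → fromℚᵘ p ℚ.≤ fromℚᵘ q ℚ.+ fromℚᵘ r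
  fromℚᵘ-≤-+ {p} {q} {r} h = ℚ.toℚᵘ-cancel-≤ (ℚᵘ.≤-respˡ-≃ (ℚᵘ.≃-sym (ℚ.toℚᵘ-fromℚᵘ p)) (ℚᵘ.≤-respʳ-≃ (ℚᵘ.≃-sym
    (ℚᵘ.≃-trans (ℚ.toℚᵘ-homo-+ (fromℚᵘ q) (fromℚᵘ r)) (ℚᵘ.+-cong (ℚ.toℚᵘ-fromℚᵘ q) (ℚ.toℚᵘ-fromℚᵘ r)))) h))

  -- The factor 98 is the unreduced denominator of a sum of sevenths and fourteenths. The comparison
  -- is made in the natural numbers with `b` on the left, and `b` is moved across in the integers.
  fraction-bound : ∀ k a b R → 14 ℕ.* k ℕ.+ 2 ℕ.* b ℕ.≤ 2 ℕ.* a ℕ.+ R →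
                   (+ k / 1) ℚ.≤ ((+ a - + b) / 7) ℚ.+ (+ R / 14)
  fraction-bound k a b R h = fromℚᵘ-≤-+ {mkℚᵘ (+ k) 0} {mkℚᵘ (+ a - + b) 6} {mkℚᵘ (+ R) 13}
      (*≤* (cancel (+ 14 ℤ.* + b) _ _ (begin
        + k ℤ.* + 98 ℤ.+ + 14 ℤ.* + b
          ≡⟨ cong₂ ℤ._+_ (sym (ℤ.pos-* k 98)) (sym (ℤ.pos-* 14 b)) ⟩
        + (k ℕ.* 98 ℕ.+ 14 ℕ.* b)
          ≤⟨ ℤ.+≤+ (subst₂ ℕ._≤_ (eq₁ k b) (eq₂ a R) (ℕ.*-monoʳ-≤ 7 h)) ⟩
        + (a ℕ.* 14 ℕ.+ R ℕ.* 7)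
          ≡⟨ cong₂ ℤ._+_ (ℤ.pos-* a 14) (ℤ.pos-* R 7) ⟩
        + a ℤ.* + 14 ℤ.+ + R ℤ.* + 7
          ≡⟨ eq₃ (+ a) (+ b) (+ R) ⟩
        ((+ a - + b) ℤ.* + 14 ℤ.+ + R ℤ.* + 7) ℤ.* + 1 ℤ.+ + 14 ℤ.* + b ∎)))
    where
    open ℤ.≤-Reasoning
    cancel : ∀ z i j → i ℤ.+ z ℤ.≤ j ℤ.+ z → i ℤ.≤ j
    cancel z i j q = subst₂ ℤ._≤_ (eq z i) (eq z j) (ℤ.+-monoˡ-≤ (ℤ.- z) q)
      where eq : ∀ z i → i ℤ.+ z ℤ.+ ℤ.- z ≡ i
            eq = ℤ.solve-∀
    eq₁ : ∀ k b → 7 ℕ.* (14 ℕ.* k ℕ.+ 2 ℕ.* b) ≡ k ℕ.* 98 ℕ.+ 14 ℕ.* b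
    eq₁ = ℕ.solve-∀
    eq₂ : ∀ a R → 7 ℕ.* (2 ℕ.* a ℕ.+ R) ≡ a ℕ.* 14 ℕ.+ R ℕ.* 7
    eq₂ = ℕ.solve-∀
    eq₃ : ∀ a b R → a ℤ.* + 14 ℤ.+ R ℤ.* + 7 ≡ ((a - b) ℤ.* + 14 ℤ.+ R ℤ.* + 7) ℤ.* + 1 ℤ.+ + 14 ℤ.* b
    eq₃ = ℤ.solve-∀

  14ths≤7ths : ∀ {R c} → R ℕ.≤ 2 ℕ.* c → (+ R / 14) ℚ.≤ (+ c / 7)
  14ths≤7ths {R} {c} h = fromℚᵘ-mono {mkℚᵘ (+ R) 13} {mkℚᵘ (+ c) 6} (*≤* (subst₂ ℤ._≤_ (ℤ.pos-* R 7) (ℤ.pos-* c 14)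
      (ℤ.+≤+ (subst (R ℕ.* 7 ℕ.≤_) (eq c) (ℕ.*-monoˡ-≤ 7 h)))))
    where
    eq : ∀ c → 2 ℕ.* c ℕ.* 7 ≡ c ℕ.* 14
    eq = ℕ.solve-∀

  14ths≡7ths : ∀ {R c} → (+ R / 14) ≡ (+ c / 7) → R ≡ 2 ℕ.* c
  14ths≡7ths {R} {c} h with ℚ.fromℚᵘ-injective {mkℚᵘ (+ R) 13} {mkℚᵘ (+ c) 6} h
  ... | *≡* q = ℕ.*-cancelʳ-≡ R (2 ℕ.* c) 7 (trans (ℤ.+-injective (trans (ℤ.pos-* R 7)
      (trans q (sym (ℤ.pos-* c 14))))) (eq c))
    where
    eq : ∀ c → c ℕ.* 14 ≡ 2 ℕ.* c ℕ.* 7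
    eq = ℕ.solve-∀

  14ths-positive : ∀ {R} → 0ℚ ℚ.< (+ R / 14) → 0 ℕ.< R
  14ths-positive {0}     h = ⊥-elim (ℚ.<-irrefl refl h)
  14ths-positive {suc R} h = ℕ.s≤s ℕ.z≤n

open import Data.Nat using (ℕ; _+_; _*_)
open import Data.Integer using (+_; _-_)
open import Data.Rational using (ℚ; _/_; _≤_; _<_; 0ℚ) renaming (_+_ to _+ℚ_)
open import Data.List using (List)
open import Data.List.Relation.Unary.All using (All)
open import Data.List.Membership.Propositional using (_∈_)
open import Data.Bool using (T)
open import Data.Product using (Σ; _×_; _,_; proj₁; proj₂)
open import Relation.Nullary using (¬_)
open import Relation.Binary.PropositionalEquality using (_≡_; refl; cong; subst; sym; trans)

open FeedbackVertexSets
open Fractions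
import Data.Nat as ℕ
import Data.Nat.Properties as ℕ
import Data.Nat.Tactic.RingSolver as ℕ
import Data.List.Relation.Unary.All as All

-- Bounds on φ from the optimal partitions

FVS≤ : ∀ G {k} → IsPhi G k → 14 * k + 2 * n G ℕ.≤ 2 * (2 * numEdges G + 2) + excessOf G
FVS≤ G {k} φ = by-≤ 0 (ℕ.+-mono-≤ (ℕ.*-monoʳ-≤ 7 (FVS-bound G φ))
    (ℕ.m≤n+m∸n (7 * Γ) (5 * n G + 4 * size G + 4)))
    (trans (eq k (n G) (size G) Γ (excessOf G)) (cong (λ m → 2 * (2 * m + 2) + excessOf G + (7 * (2 * k + n G) + 7 * Γ)) (size≡numEdges G)))
  where
  open Partition G using (Γ)
  eq : ∀ k n m Γ r → 14 * k + 2 * n + (7 * Γ + (5 * n + 4 * m + 4 + r)) + 0 ≡ 2 * (2 * m + 2) + r + (7 * (2 * k + n) + 7 * Γ)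
  eq = ℕ.solve-∀

-- A drop of `Γ` by 2 is worth 14 after multiplication by 7: it cancels the constant 4 and leaves
-- the 10 = 2 * 5 on the left.
FVS-delete≤ : ∀ G {u v} → T (adj G u v) → Connected G → Subcubic G → ¬ TwoDisjointShortCycles G → FamilyFree G →
  0 ℕ.< excessOf G → TwoConnected G → ∀ {k} → IsPhi (deleteEdge G u v) k →
  14 * k + 2 * (n G + 5) ℕ.≤ 2 * (2 * numEdges G) + excessOf G
FVS-delete≤ G {u} {v} uv conn cubic noTwo free r>0 two {k} φ = by-≤ 0
    (ℕ.+-mono-≤ (ℕ.*-monoʳ-≤ 7 (FVS-bound (deleteEdge G u v) φ)) (ℕ.+-mono-≤ (ℕ.*-monoʳ-≤ 7 drops) (ℕ.m≤n+m∸n (7 * Γ) (5 * n G + 4 * size G + 4))))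
    (trans (eq k (n G) (size G) Γ Γ′ (excessOf G)) (cong (λ m → 2 * (2 * m) + excessOf G + (7 * (2 * k + n G) + (7 * (2 + Γ′) + 7 * Γ))) (size≡numEdges G)))
  where
  open Partition G using (Γ)
  Γ′ = Partition.Γ (deleteEdge G u v)
  drops : 2 + Γ′ ℕ.≤ Γ
  drops = Deletion.Γ-drops G (T⇒≡ uv) (Connected⇒Separates G conn) cubic noTwo free (TwoConnected⇒TwoEdge G two) r>0
  eq : ∀ k n m Γ Γ′ r → 14 * k + 2 * (n + 5) + (7 * Γ′ + (7 * Γ + (5 * n + 4 * m + 4 + r))) + 0 ≡
                        2 * (2 * m) + r + (7 * (2 * k + n) + (7 * (2 + Γ′) + 7 * Γ))
  eq = ℕ.solve-∀

theorem1p5 : Σ (List Graph) λ 𝓕 →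
    All (λ H → ¬ Planar H × TwoConnected H × Subcubic H) 𝓕 ×
    Σ (Graph → ℚ) λ r →
    ∀ (G : Graph) → Connected G → Subcubic G → ¬ TwoDisjointShortCycles G →
    (∀ H → H ∈ 𝓕 → ¬ ContainsInducedSubdivision G H) →
    (∀ k → IsPhi G k →
    (+ k / 1) ≤ ((+ (2 * numEdges G + 2) - + n G) / 7) +ℚ r G) ×
    (r G ≤ + 4 / 7) ×
    ((¬ Isomorphic G K4 → r G ≤ + 3 / 7) × (r G ≡ + 3 / 7 → HasTriangle G)) ×
    (0ℚ < r G → TwoConnected G →
    ∀ u v → T (adj G u v) → ∀ k → IsPhi (deleteEdge G u v) k →
    (+ k / 1) ≤ ((+ (2 * numEdges G) - + (n G + 5)) / 7) +ℚ r G) ×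
    (Planar G → GirthAtLeast5 G → r G ≡ 0ℚ)
theorem1p5 = family ,
  All.map (λ f → let n≥3 , cubic , two , _ = f in
    forbidden-nonplanar f , TwoEdge⇒TwoConnected _ n≥3 cubic two , cubic) family-forbidden ,
  (λ G → + excessOf G / 14) ,
  λ G conn cubic noTwo free → let open Critical G (Connected⇒Separates G conn) cubic noTwo free in
    (λ k φ → fraction-bound k (2 * numEdges G + 2) (n G) (excessOf G) (FVS≤ G φ)) ,
    14ths≤7ths {c = 4} excess≤8 ,
    ((λ ¬K4 → 14ths≤7ths {c = 3} (excess≤6 ¬K4)) , λ r≡ → excess≡6 (14ths≡7ths {c = 3} r≡)) ,
    (λ r>0 two u v uv k φ → fraction-bound k (2 * numEdges G) (n G + 5) (excessOf G)
      (FVS-delete≤ G uv conn cubic noTwo free (14ths-positive r>0) two φ)) ,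
    λ _ girth → cong (λ R → + R / 14) (excess-girth girth)
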